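{- Let $k\geq 1$ be an integer, let $p$ be an odd prime, let $\ell\geq 1$, and let $E\subset(\mathbb{Z}/p^\ell\mathbb{Z})^2$ satisfy $|E|\gtrsim \ell^{\frac{2}{k+1}}p^{\ell s}$, where $s=2-\frac{1}{\ell(k+1)}$. Then $|\mathcal{C}_{k+1}(E)|\gtrsim |\mathcal{C}_{k+1}((\mathbb{Z}/p^\ell\mathbb{Z})^2)|$.
   Context: For a commutative ring $R$ and $x=(x_1,x_2),y=(y_1,y_2)\in R^2$, write $y^\perp=(y_2,-y_1)$, so $x\cdot y^\perp=x_1y_2-x_2y_1$. A $(k+1)$-point configuration is an element $x=(x^1,\dots,x^{k+1})\in (R^2)^{k+1}$. For $E\subset R^2$, define an equivalence relation $\sim$ on $E^{k+1}$ by $x\sim y$ iff $x^i\cdot x^{j\perp}=y^i\cdot y^{j\perp}$ for every pair of indices $i,j$; $\mathcal{C}_{k+1}(E)$ denotes the set of equivalence classes of $E^{k+1}$ under $\sim$. The notation $X\lesssim Y$ (equivalently $Y\gtrsim X$) means $X\leq CY$ for a constant $C$ independent of $p,\ell$ and $E$ (it may depend on $k$); the hypothesis on $|E|$ means $|E|\geq C\ell^{\frac{2}{k+1}}p^{\ell s}$ for a sufficiently large such constant. -}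

module Defs where

open import Algebra.Bundles using (CommutativeRing)
open import Algebra.Consequences.Propositional
  using (comm∧idˡ⇒id; comm∧invˡ⇒inv; comm∧distrʳ⇒distr)
open import Data.Fin.Base using (Fin; toℕ)
open import Data.Fin.Properties as Fin using (all?; toℕ-fromℕ<; toℕ<n; toℕ-injective)
open import Data.Integer.Base as ℤ using ()
open import Data.List.Base as List using (List; allFin; cartesianProduct;
  cartesianProductWith; deduplicate; filter; length)
open import Data.Nat.Base using (ℕ; zero; suc; _+_; _*_; _∸_; _^_; _≥_; NonZero; >-nonZero⁻¹)
open import Data.Nat.DivMod
open import Data.Nat.Properties
open import Data.Product.Base using (_×_; _,_)
open import Data.Rational.Unnormalised.Base as ℚᵘ using (ℚᵘ; ↥_; ↧ₙ_)
open import Data.Vec.Base as Vec using (Vec; lookup)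
open import Level using (0ℓ)
open import Relation.Binary.Core using (Rel)
open import Relation.Binary.Definitions using () renaming (Decidable to Decidable₂)
open import Relation.Binary.PropositionalEquality
  using (_≡_; cong; cong₂; isEquivalence; sym; trans)
open import Relation.Unary using (Pred; Decidable)

module Geometry {c ℓ} (R : CommutativeRing c ℓ) where
  open CommutativeRing R using (Carrier; _≈_) renaming (_+_ to _⊕_; _*_ to _⊗_; -_ to ⊝_)

  Point : Set c
  Point = Carrier × Carrier

  infix 8 _^⊥
  infix 7 _·_

  _^⊥ : Point → Point
  (y₁ , y₂) ^⊥ = y₂ , ⊝ y₁

  _·_ : Point → Point → Carrier
  (x₁ , x₂) · (y₁ , y₂) = (x₁ ⊗ y₁) ⊕ (x₂ ⊗ y₂)

  Configuration : ℕ → Set c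
  Configuration m = Vec Point m

  infix 4 _∼_

  _∼_ : ∀ {m} → Rel (Configuration m) ℓ
  x ∼ y = ∀ i j → (lookup x i · lookup x j ^⊥) ≈ (lookup y i · lookup y j ^⊥)

module _ (n : ℕ) .{{_ : NonZero n}} where

  private
    infixl 6 _⊕_
    infixl 7 _⊗_

    _⊕_ _⊗_ : Fin n → Fin n → Fin n
    a ⊕ b = (toℕ a + toℕ b) mod n
    a ⊗ b = (toℕ a * toℕ b) mod n

    ⊝_ : Fin n → Fin n
    ⊝ a = (n ∸ toℕ a) mod n

    0ₙ 1ₙ : Fin n
    0ₙ = 0 mod n
    1ₙ = 1 mod n

    toℕ-mod : ∀ m → toℕ (m mod n) ≡ m % n
    toℕ-mod m = toℕ-fromℕ< (m%n<n m n)

    mod-cong : ∀ {l m} → l % n ≡ m % n → l mod n ≡ m mod n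
    mod-cong {l} {m} eq = toℕ-injective (trans (toℕ-mod l) (trans eq (sym (toℕ-mod m))))

    toℕ% : ∀ a → toℕ a % n ≡ toℕ a
    toℕ% a = m<n⇒m%n≡m (toℕ<n a)

    mod-toℕ : ∀ a → toℕ a mod n ≡ a
    mod-toℕ a = toℕ-injective (trans (toℕ-mod (toℕ a)) (toℕ% a))

    mod-+ : ∀ l m → (l mod n) ⊕ (m mod n) ≡ (l + m) mod n
    mod-+ l m = mod-cong (trans (cong (_% n) (cong₂ _+_ (toℕ-mod l) (toℕ-mod m)))
                                (sym (%-distribˡ-+ l m n)))

    mod-* : ∀ l m → (l mod n) ⊗ (m mod n) ≡ (l * m) mod n
    mod-* l m = mod-cong (trans (cong (_% n) (cong₂ _*_ (toℕ-mod l) (toℕ-mod m)))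
                                (sym (%-distribˡ-* l m n)))

    +-modʳ : ∀ a m → a ⊕ (m mod n) ≡ (toℕ a + m) mod n
    +-modʳ a m = trans (cong (_⊕ (m mod n)) (sym (mod-toℕ a))) (mod-+ (toℕ a) m)

    +-modˡ : ∀ m a → (m mod n) ⊕ a ≡ (m + toℕ a) mod n
    +-modˡ m a = trans (cong ((m mod n) ⊕_) (sym (mod-toℕ a))) (mod-+ m (toℕ a))

    *-modʳ : ∀ a m → a ⊗ (m mod n) ≡ (toℕ a * m) mod n
    *-modʳ a m = trans (cong (_⊗ (m mod n)) (sym (mod-toℕ a))) (mod-* (toℕ a) m)

    *-modˡ : ∀ m a → (m mod n) ⊗ a ≡ (m * toℕ a) mod n
    *-modˡ m a = trans (cong ((m mod n) ⊗_) (sym (mod-toℕ a))) (mod-* m (toℕ a))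

    ⊕-comm : ∀ a b → a ⊕ b ≡ b ⊕ a
    ⊕-comm a b = cong (_mod n) (+-comm (toℕ a) (toℕ b))

    ⊗-comm : ∀ a b → a ⊗ b ≡ b ⊗ a
    ⊗-comm a b = cong (_mod n) (*-comm (toℕ a) (toℕ b))

    ⊕-assoc : ∀ a b c → (a ⊕ b) ⊕ c ≡ a ⊕ (b ⊕ c)
    ⊕-assoc a b c = trans (+-modˡ (toℕ a + toℕ b) c)
      (trans (cong (_mod n) (+-assoc (toℕ a) (toℕ b) (toℕ c)))
             (sym (+-modʳ a (toℕ b + toℕ c))))

    ⊗-assoc : ∀ a b c → (a ⊗ b) ⊗ c ≡ a ⊗ (b ⊗ c)
    ⊗-assoc a b c = trans (*-modˡ (toℕ a * toℕ b) c)
      (trans (cong (_mod n) (*-assoc (toℕ a) (toℕ b) (toℕ c)))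
             (sym (*-modʳ a (toℕ b * toℕ c))))

    ⊕-identityˡ : ∀ a → 0ₙ ⊕ a ≡ a
    ⊕-identityˡ a = trans (+-modˡ 0 a) (mod-toℕ a)

    ⊗-identityˡ : ∀ a → 1ₙ ⊗ a ≡ a
    ⊗-identityˡ a = trans (*-modˡ 1 a) (trans (cong (_mod n) (*-identityˡ (toℕ a))) (mod-toℕ a))

    ⊝-inverseˡ : ∀ a → (⊝ a) ⊕ a ≡ 0ₙ
    ⊝-inverseˡ a = trans (+-modˡ (n ∸ toℕ a) a)
      (mod-cong (trans (cong (_% n) (m∸n+n≡m (<⇒≤ (toℕ<n a))))
                       (trans (n%n≡0 n) (sym (m<n⇒m%n≡m (>-nonZero⁻¹ n))))))

    ⊗-distribʳ-⊕ : ∀ c a b → (a ⊕ b) ⊗ c ≡ (a ⊗ c) ⊕ (b ⊗ c)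
    ⊗-distribʳ-⊕ c a b = trans (*-modˡ (toℕ a + toℕ b) c)
      (trans (cong (_mod n) (*-distribʳ-+ (toℕ c) (toℕ a) (toℕ b)))
             (sym (mod-+ (toℕ a * toℕ c) (toℕ b * toℕ c))))

  -- ℤ/nℤ, carried by the residues 0 , … , n ∸ 1.
  ℤ/ : CommutativeRing 0ℓ 0ℓ
  ℤ/ = record
    { Carrier = Fin n
    ; _≈_ = _≡_
    ; _+_ = _⊕_
    ; _*_ = _⊗_
    ; -_  = ⊝_
    ; 0#  = 0ₙ
    ; 1#  = 1ₙ
    ; isCommutativeRing = record
      { isRing = record
        { +-isAbelianGroup = record
          { isGroup = record
            { isMonoid = record
              { isSemigroup = record
                { isMagma = record { isEquivalence = isEquivalence ; ∙-cong = cong₂ _⊕_ }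
                ; assoc = ⊕-assoc
                }
              ; identity = comm∧idˡ⇒id ⊕-comm ⊕-identityˡ
              }
            ; inverse = comm∧invˡ⇒inv ⊕-comm ⊝-inverseˡ
            ; ⁻¹-cong = cong ⊝_
            }
          ; comm = ⊕-comm
          }
        ; *-cong = cong₂ _⊗_
        ; *-assoc = ⊗-assoc
        ; *-identity = comm∧idˡ⇒id ⊗-comm ⊗-identityˡ
        ; distrib = comm∧distrʳ⇒distr (cong₂ _⊕_) ⊗-comm ⊗-distribʳ-⊕
        }
      ; *-comm = ⊗-comm
      }
    }

module Plane (n : ℕ) .{{_ : NonZero n}} where
  open Geometry (ℤ/ n) public

  points : List Point
  points = cartesianProduct (allFin n) (allFin n)

  _∼?_ : ∀ {m} → Decidable₂ (_∼_ {m})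
  x ∼? y = all? λ i → all? λ j → (lookup x i · lookup x j ^⊥) Fin.≟ (lookup y i · lookup y j ^⊥)

  tuples : {A : Set} → List A → ∀ m → List (Vec A m)
  tuples xs zero    = List.[ Vec.[] ]
  tuples xs (suc m) = cartesianProductWith Vec._∷_ xs (tuples xs m)

  elements : {E : Pred Point 0ℓ} → Decidable E → List Point
  elements E? = filter E? points

  ∣_∣ : {E : Pred Point 0ℓ} → Decidable E → ℕ
  ∣ E? ∣ = length (elements E?)

  -- The set of ∼-classes of Eᵐ, given by exactly one representative per class.
  𝒞 : ∀ m {E : Pred Point 0ℓ} → Decidable E → List (Configuration m)
  𝒞 m E? = deduplicate _∼?_ (tuples (elements E?) m)

-- X ≥ C · a^α · b^β for naturals X, C, a, b and rationals α, β ≥ 0, with both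
-- sides raised to the N-th power, N a common denominator of α and β, so that
-- only natural exponents remain.
infix 4 _≥_·_^_·_^_

_≥_·_^_·_^_ : ℕ → ℕ → ℕ → ℚᵘ → ℕ → ℚᵘ → Set
X ≥ C · a ^ α · b ^ β =
  X ^ N ≥ C ^ N * a ^ (ℤ.∣ ↥ α ∣ * ↧ₙ β) * b ^ (ℤ.∣ ↥ β ∣ * ↧ₙ α)
  where N = ↧ₙ α * ↧ₙ β

{-# OPTIONS --safe #-}
module Submission where

-- Write R = ℤ/q with q = p^ℓ = p r, and let d i j be the determinant of the i-th and j-th points.
--
-- The classes of (R²)ᵏ⁺¹ are few: lift to ℤ and choose a pair (a , b) whose determinant has least
-- p-adic valuation. The Plücker relation d a b · d i j = d a i · d b j − d a j · d b i may then be
-- divided by that power of p twice, so every d i j is recovered from the 2k − 1 residues d a b,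
-- d a i, d b i.
--
-- The classes of Eᵏ⁺¹ are many: keep the points whose first coordinate is a unit, a of them. Two
-- equivalent configurations whose first determinant is a unit differ by an element g of SL₂(R),
-- so by Cauchy–Schwarz it is enough to bound Σ_g λ(g)ᵏ⁺¹, where λ(g) counts the points moved by g
-- into the set. Counting g by the images of two points turns Σ_g λ(g)² into the number of
-- quadruples with equal determinants, up to an error a² q² r from nonunit determinants, and a
-- point–line variance estimate bounds that number by a⁴/q + 2 a² q² r. As Σ_g λ(g) = q a², the g
-- with λ(g) above twice the mean a²/q² contribute at most 12 a² q² r to the second moment, and for
-- these λ(g)ᵏ⁺¹ ≤ aᵏ⁻¹ λ(g)².

-- Both counts are compared with q^(2k-1), the number q^(2k+2) of configurations divided by the
-- order of magnitude q³ of SL₂(R). The obstacle in the lower bound is matrices like the identity,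
-- whose overlap a is far above the mean a²/q². Together they contribute at most a^(k-1) · 12 a² q²
-- r, while the main term is of size q³ (a²/q²)^(k+1). As q = p r, the former is at most 12 times
-- the latter exactly when (q²)^(k+1) ≤ p a^(k+1): this is the origin of the exponent s. Unit first
-- coordinates remove the trouble with zero divisors. A point is then moved to another by exactly q
-- matrices of determinant 1, and a point y is determined by one coordinate together with its
-- determinant against a point of the set. At most q r points are discarded, and the density makes
-- this at most a quarter of E. All estimates are made in ℕ: denominators and roots are cleared, and
-- a subtracted term is moved to the other side of its inequality. This gives the arithmetic lemmas
-- their shape.

open import Defs

-- Indicators, finite sums over lists and Cauchy-Schwarz.

module FiniteSums where
  open import Data.Empty using (⊥)
  open import Data.List.Base using (List; []; _∷_; _++_; length; map; filter; cartesianProduct; cartesianProductWith)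
  open import Data.List.Membership.Propositional using (_∈_)
  open import Data.List.Properties using (map-cong; map-∘; map-++)
  open import Data.List.Relation.Unary.All as All using (All; []; _∷_)
  open import Data.List.Relation.Unary.AllPairs as AllPairs using (AllPairs; []; _∷_)
  open import Data.List.Relation.Unary.Any using (here; there)
  open import Data.List.Relation.Unary.Unique.Propositional using (Unique)
  open import Data.Nat.Base
  open import Data.Nat.ListAction using (sum)
  open import Data.Nat.ListAction.Properties using (sum-++)
  open import Data.Nat.Properties
  open import Data.Nat.Tactic.RingSolver using (solve-∀)
  open import Data.Product.Base using (_×_; _,_)
  open import Data.Sum.Base using (inj₁; inj₂)
  open import Level using (0ℓ)
  open import Relation.Binary.PropositionalEquality
  open import Relation.Nullary.Decidable using (Dec; yes; no; _×-dec_)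
  open import Relation.Nullary.Negation using (¬_; contradiction)
  open import Relation.Unary using (Pred; Decidable)

  private variable
    A B D : Set
    P Q : Set

  𝟙 : Dec P → ℕ
  𝟙 (yes _) = 1
  𝟙 (no _)  = 0

  𝟙-mono : (P? : Dec P) (Q? : Dec Q) → (P → Q) → 𝟙 P? ≤ 𝟙 Q?
  𝟙-mono (no _)  _       _ = z≤n
  𝟙-mono (yes p) (yes q) _ = ≤-refl
  𝟙-mono (yes p) (no ¬q) h = contradiction (h p) ¬q

  𝟙≤1 : (P? : Dec P) → 𝟙 P? ≤ 1
  𝟙≤1 (yes _) = ≤-refl
  𝟙≤1 (no _)  = z≤n

  𝟙-yes : (P? : Dec P) → P → 𝟙 P? ≡ 1
  𝟙-yes (yes _) _ = refl
  𝟙-yes (no ¬p) p = contradiction p ¬p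

  𝟙-no : (P? : Dec P) → ¬ P → 𝟙 P? ≡ 0
  𝟙-no (yes p) ¬p = contradiction p ¬p
  𝟙-no (no _)  _  = refl

  𝟙-× : (P? : Dec P) (Q? : Dec Q) → 𝟙 (P? ×-dec Q?) ≡ 𝟙 P? * 𝟙 Q?
  𝟙-× (yes _) (yes _) = refl
  𝟙-× (yes _) (no _)  = refl
  𝟙-× (no _)  (yes _) = refl
  𝟙-× (no _)  (no _)  = refl

  𝟙-split : (P? : Dec P) (Q? : Dec (¬ P)) → 𝟙 P? + 𝟙 Q? ≡ 1
  𝟙-split (yes p) Q? = cong suc (𝟙-no Q? (λ ¬p → ¬p p))
  𝟙-split (no ¬p) Q? = 𝟙-yes Q? ¬p

  ∑ : List A → (A → ℕ) → ℕ
  ∑ xs f = sum (map f xs)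

  infix 5 ∑
  syntax ∑ xs (λ x → e) = ∑[ x ← xs ] e

  ∑-cong : (xs : List A) {f g : A → ℕ} → (∀ x → f x ≡ g x) → ∑ xs f ≡ ∑ xs g
  ∑-cong xs eq = cong sum (map-cong eq xs)

  ∑-mono : (xs : List A) {f g : A → ℕ} → (∀ x → x ∈ xs → f x ≤ g x) → ∑ xs f ≤ ∑ xs g
  ∑-mono []       _ = z≤n
  ∑-mono (x ∷ xs) h = +-mono-≤ (h x (here refl)) (∑-mono xs λ y y∈ → h y (there y∈))

  ∑-const : (xs : List A) (c : ℕ) → ∑ xs (λ _ → c) ≡ length xs * c
  ∑-const []       c = refl
  ∑-const (x ∷ xs) c = cong (c +_) (∑-const xs c)

  ∑-1 : (xs : List A) → ∑ xs (λ _ → 1) ≡ length xs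
  ∑-1 xs = trans (∑-const xs 1) (*-identityʳ (length xs))

  ∑-≤const : (xs : List A) {f : A → ℕ} {c : ℕ} → (∀ x → x ∈ xs → f x ≤ c) → ∑ xs f ≤ length xs * c
  ∑-≤const xs {c = c} h = ≤-trans (∑-mono xs h) (≤-reflexive (∑-const xs c))

  ∑-zero : (xs : List A) {f : A → ℕ} → (∀ x → x ∈ xs → f x ≡ 0) → ∑ xs f ≡ 0
  ∑-zero xs h = n≤0⇒n≡0 (≤-trans (∑-≤const xs λ x x∈ → ≤-reflexive (h x x∈))
                                 (≤-reflexive (*-zeroʳ (length xs))))

  ∑-≥const : (xs : List A) {f : A → ℕ} {c : ℕ} → (∀ x → x ∈ xs → c ≤ f x) → length xs * c ≤ ∑ xs f
  ∑-≥const xs {c = c} h = ≤-trans (≤-reflexive (sym (∑-const xs c))) (∑-mono xs h)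

  ∑-+ : (xs : List A) (f g : A → ℕ) → ∑ xs (λ x → f x + g x) ≡ ∑ xs f + ∑ xs g
  ∑-+ []       f g = refl
  ∑-+ (x ∷ xs) f g = trans (cong (f x + g x +_) (∑-+ xs f g)) (lemma (f x) (g x) _ _)
    where
    lemma : ∀ a b c d → a + b + (c + d) ≡ a + c + (b + d)
    lemma = solve-∀

  ∑-*ˡ : (xs : List A) (c : ℕ) (f : A → ℕ) → ∑ xs (λ x → c * f x) ≡ c * ∑ xs f
  ∑-*ˡ []       c f = sym (*-zeroʳ c)
  ∑-*ˡ (x ∷ xs) c f = trans (cong (c * f x +_) (∑-*ˡ xs c f)) (sym (*-distribˡ-+ c (f x) _))

  ∑-*ʳ : (xs : List A) (c : ℕ) (f : A → ℕ) → ∑ xs (λ x → f x * c) ≡ ∑ xs f * c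
  ∑-*ʳ xs c f = trans (∑-cong xs λ x → *-comm (f x) c) (trans (∑-*ˡ xs c f) (*-comm c _))

  ∑-swap : (xs : List A) (ys : List B) (F : A → B → ℕ) →
           ∑[ x ← xs ] ∑[ y ← ys ] F x y ≡ ∑[ y ← ys ] ∑[ x ← xs ] F x y
  ∑-swap []       ys F = sym (trans (∑-const ys 0) (*-zeroʳ (length ys)))
  ∑-swap (x ∷ xs) ys F = trans (cong (∑ ys (F x) +_) (∑-swap xs ys F)) (sym (∑-+ ys _ _))

  ∑-prod : (xs : List A) (ys : List B) (f : A → ℕ) (g : B → ℕ) →
           ∑ xs f * ∑ ys g ≡ ∑[ x ← xs ] ∑[ y ← ys ] f x * g y
  ∑-prod xs ys f g = trans (sym (∑-*ʳ xs (∑ ys g) f)) (∑-cong xs λ x → sym (∑-*ˡ ys (f x) g))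

  ∑-++ : (xs ys : List A) (f : A → ℕ) → ∑ (xs ++ ys) f ≡ ∑ xs f + ∑ ys f
  ∑-++ xs ys f = trans (cong sum (map-++ f xs ys)) (sum-++ (map f xs) (map f ys))

  ∑-cartesianProductWith : (h : A → B → D) (xs : List A) (ys : List B) (F : D → ℕ) →
    ∑ (cartesianProductWith h xs ys) F ≡ ∑[ x ← xs ] ∑[ y ← ys ] F (h x y)
  ∑-cartesianProductWith h []       ys F = refl
  ∑-cartesianProductWith h (x ∷ xs) ys F = trans (∑-++ (map (h x) ys) _ F)
    (cong₂ _+_ (cong sum (sym (map-∘ ys))) (∑-cartesianProductWith h xs ys F))

  ∑-cartesianProduct : (xs : List A) (ys : List B) (F : A × B → ℕ) →
    ∑ (cartesianProduct xs ys) F ≡ ∑[ x ← xs ] ∑[ y ← ys ] F (x , y)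
  ∑-cartesianProduct = ∑-cartesianProductWith _,_

  ∑-filter : {P : Pred A 0ℓ} (P? : Decidable P) (xs : List A) (f : A → ℕ) →
             ∑ (filter P? xs) f ≡ ∑[ x ← xs ] 𝟙 (P? x) * f x
  ∑-filter P? []       f = refl
  ∑-filter P? (x ∷ xs) f with P? x
  ... | yes _ = cong₂ _+_ (sym (+-identityʳ (f x))) (∑-filter P? xs f)
  ... | no  _ = ∑-filter P? xs f

  length-filter : {P : Pred A 0ℓ} (P? : Decidable P) (xs : List A) →
                  length (filter P? xs) ≡ ∑[ x ← xs ] 𝟙 (P? x)
  length-filter P? xs = trans (sym (∑-1 (filter P? xs)))
    (trans (∑-filter P? xs _) (∑-cong xs λ x → *-identityʳ (𝟙 (P? x))))

  term≤∑ : (xs : List A) (f : A → ℕ) {x : A} → x ∈ xs → f x ≤ ∑ xs f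
  term≤∑ (x ∷ xs) f (here refl) = m≤m+n (f x) _
  term≤∑ (x ∷ xs) f (there x∈)  = ≤-trans (term≤∑ xs f x∈) (m≤n+m _ (f x))

  ∑-𝟙≤1 : {P : Pred A 0ℓ} (P? : Decidable P) {xs : List A} →
          AllPairs (λ x y → P x → P y → ⊥) xs → ∑[ x ← xs ] 𝟙 (P? x) ≤ 1
  ∑-𝟙≤1 P? []         = z≤n
  ∑-𝟙≤1 {P = P} P? {x ∷ xs} (h ∷ hs) with P? x
  ... | no  _ = ∑-𝟙≤1 P? hs
  ... | yes p = s≤s (≤-reflexive (∑-zero xs λ y y∈ → 𝟙-no (P? y) (All.lookup h y∈ p)))

  ∑-𝟙-unique : {P : Pred A 0ℓ} (P? : Decidable P) {xs : List A} → Unique xs →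
               (∀ {x y} → P x → P y → x ≡ y) → ∑[ x ← xs ] 𝟙 (P? x) ≤ 1
  ∑-𝟙-unique P? u h = ∑-𝟙≤1 P? (AllPairs.map (λ x≢y p p′ → x≢y (h p p′)) u)

  -- Double counting the pairs (x , φ x).
  ∑-injective : {P : Pred A 0ℓ} {Q : Pred B 0ℓ} (P? : Decidable P) (Q? : Decidable Q)
    (_≟_ : (x y : B) → Dec (x ≡ y)) {xs : List A} {ys : List B} → Unique xs → (∀ y → y ∈ ys) →
    (φ : A → B) → (∀ {x} → P x → Q (φ x)) → (∀ {x x′} → P x → P x′ → φ x ≡ φ x′ → x ≡ x′) →
    ∑[ x ← xs ] 𝟙 (P? x) ≤ ∑[ y ← ys ] 𝟙 (Q? y)
  ∑-injective P? Q? _≟_ {xs} {ys} uniq complete φ P⇒Q inj = begin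
    ∑[ x ← xs ] 𝟙 (P? x)
      ≤⟨ ∑-mono xs (λ x _ → ≤-trans (𝟙-mono (P? x) (P? x ×-dec (φ x ≟ φ x)) (_, refl))
                             (term≤∑ ys (λ y → 𝟙 (P? x ×-dec (φ x ≟ y))) (complete (φ x)))) ⟩
    ∑[ x ← xs ] ∑[ y ← ys ] 𝟙 (P? x ×-dec (φ x ≟ y))
      ≡⟨ ∑-swap xs ys _ ⟩
    ∑[ y ← ys ] ∑[ x ← xs ] 𝟙 (P? x ×-dec (φ x ≟ y))
      ≤⟨ ∑-mono ys (λ y _ → fibre y) ⟩
    ∑[ y ← ys ] 𝟙 (Q? y) ∎
    where
    open ≤-Reasoning
    fibre : ∀ y → ∑[ x ← xs ] 𝟙 (P? x ×-dec (φ x ≟ y)) ≤ 𝟙 (Q? y)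
    fibre y with Q? y
    ... | yes _ = ∑-𝟙-unique (λ x → P? x ×-dec (φ x ≟ y)) uniq
                    (λ (p , e) (p′ , e′) → inj p p′ (trans e (sym e′)))
    ... | no ¬q = ≤-reflexive (∑-zero xs λ x _ → 𝟙-no (P? x ×-dec (φ x ≟ y))
                    λ { (p , refl) → ¬q (P⇒Q p) })

  -- Subtraction on ℕ truncates, so the larger number is written as the smaller plus d; the two
  -- sides then differ by d².
  2ab≤a²+b² : ∀ a b → 2 * (a * b) ≤ a * a + b * b
  2ab≤a²+b² a b with ≤-total a b
  ... | inj₁ a≤b = subst (λ c → 2 * (a * c) ≤ a * a + c * c) (m+[n∸m]≡n a≤b)
                     (≤-trans (m≤m+n _ ((b ∸ a) * (b ∸ a))) (≤-reflexive (lemma a (b ∸ a))))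
    where
    lemma : ∀ a d → 2 * (a * (a + d)) + d * d ≡ a * a + (a + d) * (a + d)
    lemma = solve-∀
  ... | inj₂ b≤a = subst (λ c → 2 * (c * b) ≤ c * c + b * b) (m+[n∸m]≡n b≤a)
                     (≤-trans (m≤m+n _ ((a ∸ b) * (a ∸ b))) (≤-reflexive (lemma b (a ∸ b))))
    where
    lemma : ∀ b d → 2 * ((b + d) * b) + d * d ≡ (b + d) * (b + d) + b * b
    lemma = solve-∀

  -- Summing 2 f(x) f(y) ≤ f(x)² + f(y)² over all pairs gives twice the claim, and the factor 2
  -- cancels.
  cauchy-schwarz : (xs : List A) (f : A → ℕ) →
                   ∑ xs f * ∑ xs f ≤ length xs * (∑[ x ← xs ] f x * f x)
  cauchy-schwarz xs f = *-cancelˡ-≤ 2 (begin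
    2 * (∑ xs f * ∑ xs f)                         ≡⟨ cong (2 *_) (∑-prod xs xs f f) ⟩
    2 * (∑[ x ← xs ] ∑[ y ← xs ] f x * f y)       ≡⟨ ∑-*ˡ xs 2 _ ⟨
    ∑[ x ← xs ] 2 * (∑[ y ← xs ] f x * f y)       ≡⟨ ∑-cong xs (λ x → sym (∑-*ˡ xs 2 _)) ⟩
    ∑[ x ← xs ] ∑[ y ← xs ] 2 * (f x * f y)
      ≤⟨ ∑-mono xs (λ x _ → ∑-mono xs λ y _ → 2ab≤a²+b² (f x) (f y)) ⟩
    ∑[ x ← xs ] ∑[ y ← xs ] (f x * f x + f y * f y)
      ≡⟨ ∑-cong xs (λ x → trans (∑-+ xs _ _) (cong (_+ S) (∑-const xs (f x * f x)))) ⟩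
    ∑[ x ← xs ] (length xs * (f x * f x) + S)     ≡⟨ ∑-+ xs _ _ ⟩
    (∑[ x ← xs ] length xs * (f x * f x)) + ∑ xs (λ _ → S)
      ≡⟨ cong₂ _+_ (∑-*ˡ xs (length xs) _) (∑-const xs S) ⟩
    length xs * S + length xs * S                 ≡⟨ cong (length xs * S +_) (+-identityʳ _) ⟨
    2 * (length xs * S)                           ∎)
    where
    open ≤-Reasoning
    S : ℕ
    S = ∑[ x ← xs ] f x * f x

-- Arithmetic of the moment estimates.

module MomentArithmetic where
  open import Data.Nat.Base
  open import Data.Nat.Properties
  open import Data.Nat.Tactic.RingSolver using (solve-∀)
  open import Relation.Binary.PropositionalEquality
  open import Relation.Nullary.Decidable using (Dec; yes; no)
  open FiniteSums

  -- `T` stands for the total line energy of the set, `X` for the number of points with unit first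
  -- coordinate. Of the two copies of a q³ r, one is the error for pairs whose difference has a
  -- nonunit first coordinate; the other is the price of replacing `X` by q², from which it falls
  -- short by at most q r.
  first-moment-arithmetic : ∀ q r a X T .{{_ : NonZero q}} →
    q * q * T + a * (q * (a * a)) + X * (2 * (q * a * a)) ≤
      q * q * (a * (a * q) + q * q * (a * r)) + X * (q * (a * a)) + a * (2 * (q * a * a)) →
    q * q ≤ X + q * r → a ≤ q * q → q * T ≤ a * a * a + 2 * (a * (q * q * q * r))
  first-moment-arithmetic q r a X T h₁ h₂ h₃ = *-cancelˡ-≤ q (+-cancelʳ-≤ (q * q * Y) _ _ (begin
    q * (q * T) + q * q * Y
      ≤⟨ +-monoʳ-≤ (q * (q * T)) (*-monoˡ-≤ Y h₂) ⟩
    q * (q * T) + (X + q * r) * Y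
      ≡⟨ e₁ q T X r Y ⟩
    q * q * T + X * Y + q * r * Y
      ≤⟨ +-monoˡ-≤ (q * r * Y) h₁′ ⟩
    q * q * Y + q * q * (q * q * (a * r)) + a * Y + q * r * Y
      ≡⟨ e₂ q r a ⟩
    q * q * q * q * a * r + a * Y + q * r * q * a * a + q * q * Y
      ≤⟨ +-monoˡ-≤ (q * q * Y) (+-monoʳ-≤ (q * q * q * q * a * r + a * Y) (*-monoʳ-≤ (q * r * q * a) h₃)) ⟩
    q * q * q * q * a * r + a * Y + q * r * q * a * (q * q) + q * q * Y
      ≡⟨ e₃ q r a ⟩
    q * (a * a * a + 2 * (a * (q * q * q * r))) + q * q * Y ∎))
    where
    open ≤-Reasoning
    Y : ℕ
    Y = q * (a * a)
    e₀ : ∀ q a X T → q * q * T + X * (q * (a * a)) + (X * (q * (a * a)) + a * (q * (a * a))) ≡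
                     q * q * T + a * (q * (a * a)) + X * (2 * (q * a * a))
    e₀ = solve-∀
    e₀′ : ∀ q r a X → q * q * (a * (a * q) + q * q * (a * r)) + X * (q * (a * a)) + a * (2 * (q * a * a)) ≡
      q * q * (q * (a * a)) + q * q * (q * q * (a * r)) + a * (q * (a * a)) + (X * (q * (a * a)) + a * (q * (a * a)))
    e₀′ = solve-∀
    h₁′ : q * q * T + X * Y ≤ q * q * Y + q * q * (q * q * (a * r)) + a * Y
    h₁′ = +-cancelʳ-≤ (X * Y + a * Y) _ _
      (≤-trans (≤-reflexive (e₀ q a X T)) (≤-trans h₁ (≤-reflexive (e₀′ q r a X))))
    e₁ : ∀ q T X r Y → q * (q * T) + (X + q * r) * Y ≡ q * q * T + X * Y + q * r * Y
    e₁ = solve-∀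
    e₂ : ∀ q r a → q * q * (q * (a * a)) + q * q * (q * q * (a * r)) + a * (q * (a * a)) + q * r * (q * (a * a)) ≡
         q * q * q * q * a * r + a * (q * (a * a)) + q * r * q * a * a + q * q * (q * (a * a))
    e₂ = solve-∀
    e₃ : ∀ q r a → q * q * q * q * a * r + a * (q * (a * a)) + q * r * q * a * (q * q) + q * q * (q * (a * a)) ≡
         q * (a * a * a + 2 * (a * (q * q * q * r))) + q * q * (q * (a * a))
    e₃ = solve-∀

  -- The third copy of the error comes from pairs of points with nonunit determinant: at most a q r
  -- of them, each with at most a q matrices.
  second-moment-arithmetic : ∀ q r a T S → q * T ≤ a * a * a + 2 * (a * (q * q * q * r)) →
    S ≤ a * T + a * (q * r) * (a * q) → q * S ≤ a * a * (a * a) + 3 * (a * a * (q * q * q * r))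
  second-moment-arithmetic q r a T S h₁ h₂ = begin
    q * S                                         ≤⟨ *-monoʳ-≤ q h₂ ⟩
    q * (a * T + a * (q * r) * (a * q))           ≡⟨ e₁ q r a T ⟩
    a * (q * T) + a * a * (q * q * q * r)         ≤⟨ +-monoˡ-≤ _ (*-monoʳ-≤ a h₁) ⟩
    a * (a * a * a + 2 * (a * (q * q * q * r))) + a * a * (q * q * q * r) ≡⟨ e₂ q r a ⟩
    a * a * (a * a) + 3 * (a * a * (q * q * q * r)) ∎
    where
    open ≤-Reasoning
    e₁ : ∀ q r a T → q * (a * T + a * (q * r) * (a * q)) ≡ a * (q * T) + a * a * (q * q * q * r)
    e₁ = solve-∀
    e₂ : ∀ q r a → a * (a * a * a + 2 * (a * (q * q * q * r))) + a * a * (q * q * q * r) ≡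
         a * a * (a * a) + 3 * (a * a * (q * q * q * r))
    e₂ = solve-∀

  -- For L ≥ 2 M one has L² ≤ 4 (L − M)².
  excess : ∀ L M (bad? : Dec (2 * M ≤ L)) →
    𝟙 bad? * (L * L) + 8 * (L * M) ≤ 4 * (L * L) + 4 * (M * M)
  excess L M (no _)  = begin
    8 * (L * M)                 ≡⟨ *-assoc 4 2 (L * M) ⟩
    4 * (2 * (L * M))           ≤⟨ *-monoʳ-≤ 4 (2ab≤a²+b² L M) ⟩
    4 * (L * L + M * M)         ≡⟨ *-distribˡ-+ 4 (L * L) (M * M) ⟩
    4 * (L * L) + 4 * (M * M)   ∎
    where open ≤-Reasoning
  excess L M (yes 2M≤L) =
    subst (λ L → 1 * (L * L) + 8 * (L * M) ≤ 4 * (L * L) + 4 * (M * M)) (m+[n∸m]≡n 2M≤L)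
      (≤-trans (m≤m+n _ _) (≤-reflexive (e M (L ∸ 2 * M))))
    where
    e : ∀ M d → 1 * ((2 * M + d) * (2 * M + d)) + 8 * ((2 * M + d) * M) + (4 * (M * d) + 3 * (d * d)) ≡
        4 * ((2 * M + d) * (2 * M + d)) + 4 * (M * M)
    e = solve-∀

  -- The sum of 4 (q² λ(g) - a²)² over `G` matrices, expanded. The main terms 4 q³ a⁴ + 4 q³ a⁴ and
  -- 8 q³ a⁴ cancel exactly, so four times the threefold error remains, whence 12.
  excess-arithmetic : ∀ q r a B S₁ S₂ G .{{_ : NonZero q}} →
    q * q * (q * q) * B + 8 * (q * q * (a * a)) * S₁ ≤ 4 * (q * q * (q * q)) * S₂ + G * (4 * (a * a * (a * a))) →
    a * (a * q) ≤ S₁ → q * S₂ ≤ a * a * (a * a) + 3 * (a * a * (q * q * q * r)) → G ≤ q * q * q →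
    B ≤ 12 * (a * a * (q * q * r))
  excess-arithmetic q r a B S₁ S₂ G h h₁ h₂ h₃ =
    *-cancelˡ-≤ (q * q * (q * q)) {{m*n≢0 (q * q) (q * q) {{m*n≢0 q q}} {{m*n≢0 q q}}}}
      (+-cancelʳ-≤ (8 * (q * q * (a * a)) * (a * (a * q))) _ _ (begin
      q * q * (q * q) * B + 8 * (q * q * (a * a)) * (a * (a * q))
        ≤⟨ +-monoʳ-≤ (q * q * (q * q) * B) (*-monoʳ-≤ (8 * (q * q * (a * a))) h₁) ⟩
      q * q * (q * q) * B + 8 * (q * q * (a * a)) * S₁
        ≤⟨ h ⟩
      4 * (q * q * (q * q)) * S₂ + G * (4 * (a * a * (a * a)))
        ≡⟨ cong (_+ G * (4 * (a * a * (a * a)))) (e₁ q S₂) ⟩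
      4 * (q * q * q) * (q * S₂) + G * (4 * (a * a * (a * a)))
        ≤⟨ +-mono-≤ (*-monoʳ-≤ (4 * (q * q * q)) h₂) (*-monoˡ-≤ (4 * (a * a * (a * a))) h₃) ⟩
      4 * (q * q * q) * (a * a * (a * a) + 3 * (a * a * (q * q * q * r))) + q * q * q * (4 * (a * a * (a * a)))
        ≡⟨ e₂ q r a ⟩
      q * q * (q * q) * (12 * (a * a * (q * q * r))) + 8 * (q * q * (a * a)) * (a * (a * q)) ∎))
    where
    open ≤-Reasoning
    e₁ : ∀ q S → 4 * (q * q * (q * q)) * S ≡ 4 * (q * q * q) * (q * S)
    e₁ = solve-∀
    e₂ : ∀ q r a → 4 * (q * q * q) * (a * a * (a * a) + 3 * (a * a * (q * q * q * r))) + q * q * q * (4 * (a * a * (a * a))) ≡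
      q * q * (q * q) * (12 * (a * a * (q * q * r))) + 8 * (q * q * (a * a)) * (a * (a * q))
    e₂ = solve-∀

  ^-*-distrib : ∀ m n k → (m * n) ^ k ≡ m ^ k * n ^ k
  ^-*-distrib m n zero    = refl
  ^-*-distrib m n (suc k) = trans (cong (m * n *_) (^-*-distrib m n k)) (e m n (m ^ k) (n ^ k))
    where
    e : ∀ m n x y → m * n * (x * y) ≡ m * x * (n * y)
    e = solve-∀

  -- The bounds for the two cases are added rather than kept apart, so that one inequality holds for
  -- every matrix and can be summed over all of SL₂.
  power-split : ∀ Q L a M j → L ≤ a → (bad? : Dec (2 * M ≤ Q * L)) →
    Q ^ (2 + j) * L ^ (2 + j) ≤ (2 * M) ^ (2 + j) + Q ^ (2 + j) * a ^ j * (𝟙 bad? * (L * L))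
  power-split Q L a M j L≤a (no ¬bad) = begin
    Q ^ (2 + j) * L ^ (2 + j)   ≡⟨ ^-*-distrib Q L (2 + j) ⟨
    (Q * L) ^ (2 + j)           ≤⟨ ^-monoˡ-≤ (2 + j) (<⇒≤ (≰⇒> ¬bad)) ⟩
    (2 * M) ^ (2 + j)           ≤⟨ m≤m+n _ _ ⟩
    _                           ∎
    where open ≤-Reasoning
  power-split Q L a M j L≤a (yes _) = begin
    Q ^ (2 + j) * (L * (L * L ^ j))     ≤⟨ *-monoʳ-≤ (Q ^ (2 + j)) (*-monoʳ-≤ L (*-monoʳ-≤ L (^-monoˡ-≤ j L≤a))) ⟩
    Q ^ (2 + j) * (L * (L * a ^ j))     ≡⟨ e (Q ^ (2 + j)) L (a ^ j) ⟩
    Q ^ (2 + j) * a ^ j * (1 * (L * L)) ≤⟨ m≤n+m _ _ ⟩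
    _                                   ∎
    where
    open ≤-Reasoning
    e : ∀ x L y → x * (L * (L * y)) ≡ x * y * (1 * (L * L))
    e = solve-∀

  -- The density enters here: it supplies the factor `p` that completes `r` to `q`, so the matrices
  -- far above the mean cost no more than the main term. In the constant, 2^(2+j) belongs to the
  -- matrices below twice the mean and 12 to the others.
  moment-arithmetic : ∀ p q r a j B S G → q ≡ p * r → (q * q) ^ (2 + j) ≤ p * a ^ (2 + j) →
    (q * q) ^ (2 + j) * S ≤ G * (2 * (a * a)) ^ (2 + j) + (q * q) ^ (2 + j) * a ^ j * B →
    G ≤ q * q * q → B ≤ 12 * (a * a * (q * q * r)) →
    (q * q) ^ (2 + j) * S ≤ (2 ^ (2 + j) + 12) * (q * q * q) * (a ^ (2 + j) * a ^ (2 + j))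
  moment-arithmetic p q r a j B S G q≡pr h h₁ h₂ h₃ = begin
    (q * q) ^ (2 + j) * S
      ≤⟨ h₁ ⟩
    G * (2 * (a * a)) ^ (2 + j) + (q * q) ^ (2 + j) * a ^ j * B
      ≤⟨ +-mono-≤ (*-monoˡ-≤ _ h₂) (*-mono-≤ (*-monoˡ-≤ (a ^ j) h) h₃) ⟩
    q * q * q * (2 * (a * a)) ^ (2 + j) + p * a ^ (2 + j) * a ^ j * (12 * (a * a * (q * q * r)))
      ≡⟨ cong₂ (λ s t → q * q * q * s + t)
           (trans (^-*-distrib 2 (a * a) (2 + j)) (cong (2 ^ (2 + j) *_) (^-*-distrib a a (2 + j))))
           (e₁ p q r a (a ^ j)) ⟩
    q * q * q * (2 ^ (2 + j) * (A * A)) + 12 * (q * q * (p * r)) * (A * A)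
      ≡⟨ cong (λ s → q * q * q * (2 ^ (2 + j) * (A * A)) + 12 * (q * q * s) * (A * A)) q≡pr ⟨
    q * q * q * (2 ^ (2 + j) * (A * A)) + 12 * (q * q * q) * (A * A)
      ≡⟨ e₂ (q * q * q) (2 ^ (2 + j)) (A * A) ⟩
    (2 ^ (2 + j) + 12) * (q * q * q) * (A * A) ∎
    where
    open ≤-Reasoning
    A : ℕ
    A = a ^ (2 + j)
    e₁ : ∀ p q r a y → p * (a * (a * y)) * y * (12 * (a * a * (q * q * r))) ≡
         12 * (q * q * (p * r)) * (a * (a * y) * (a * (a * y)))
    e₁ = solve-∀
    e₂ : ∀ c t A → c * (t * A) + 12 * c * A ≡ (t + 12) * c * A
    e₂ = solve-∀

  -- `A` counts all tuples, `S` those with unit first determinant, `c` the classes and `P` the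
  -- equivalent pairs; `W` is (q²)^(k+1), `Z` the constant times q³. The 4 is the square of the
  -- factor 2 between `A` and `S`.
  count-arithmetic : ∀ W A c S P Z → A ≤ 2 * S → S * S ≤ c * P → W * P ≤ Z * (A * A) →
    A * A * W ≤ A * A * (4 * Z * c)
  count-arithmetic W A c S P Z h₁ h₂ h₃ = begin
    A * A * W               ≤⟨ *-monoˡ-≤ W (*-mono-≤ h₁ h₁) ⟩
    2 * S * (2 * S) * W     ≡⟨ e₁ S W ⟩
    4 * W * (S * S)         ≤⟨ *-monoʳ-≤ (4 * W) h₂ ⟩
    4 * W * (c * P)         ≡⟨ e₂ W c P ⟩
    4 * c * (W * P)         ≤⟨ *-monoʳ-≤ (4 * c) h₃ ⟩
    4 * c * (Z * (A * A))   ≡⟨ e₃ c Z (A * A) ⟩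
    A * A * (4 * Z * c)     ∎
    where
    open ≤-Reasoning
    e₁ : ∀ S W → 2 * S * (2 * S) * W ≡ 4 * W * (S * S)
    e₁ = solve-∀
    e₂ : ∀ W c P → 4 * W * (c * P) ≡ 4 * c * (W * P)
    e₂ = solve-∀
    e₃ : ∀ c Z A → 4 * c * (Z * A) ≡ A * (4 * Z * c)
    e₃ = solve-∀

-- Counting equivalence classes, and sums over tuples.

module Classification where
  open import Data.Fin.Base using (zero; suc)
  open import Data.List.Base using (List; []; _∷_; length; cartesianProduct; cartesianProductWith; filter)
  open import Data.List.Membership.Propositional using (_∈_; find)
  open import Data.List.Membership.Propositional.Properties using (∈-cartesianProductWith⁻; ∈-cartesianProductWith⁺)
  open import Data.List.Relation.Unary.AllPairs as AllPairs using (AllPairs)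
  open import Data.List.Relation.Unary.Any using (Any; here)
  open import Data.Nat.Base
  open import Data.Nat.Divisibility using (_∣_; divides)
  open import Data.Nat.Properties
  open import Data.Product.Base using (_,_)
  open import Data.Vec.Base as Vec using (Vec; []; _∷_; lookup)
  open import Level using (0ℓ)
  open import Relation.Binary.Core using (Rel)
  open import Relation.Binary.Definitions using (Symmetric; Transitive) renaming (Decidable to Decidable₂)
  open import Relation.Binary.PropositionalEquality
  open import Relation.Nullary.Decidable using (Dec; yes; no; _×-dec_)
  open import Relation.Nullary.Negation using (¬_)
  open import Relation.Unary using (Pred; Decidable)
  open FiniteSums
  open MomentArithmetic

  private variable
    X Y : Set

  ∑-filter-≤ : {P : Pred X 0ℓ} (P? : Decidable P) (xs : List X) (f : X → ℕ) → ∑ (filter P? xs) f ≤ ∑ xs f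
  ∑-filter-≤ P? xs f = ≤-trans (≤-reflexive (∑-filter P? xs f))
    (∑-mono xs λ x _ → ≤-trans (*-monoˡ-≤ (f x) (𝟙≤1 (P? x))) (≤-reflexive (*-identityˡ (f x))))

  length-cartesianProduct : (xs : List X) (ys : List Y) → length (cartesianProduct xs ys) ≡ length xs * length ys
  length-cartesianProduct xs ys = trans (sym (∑-1 (cartesianProduct xs ys)))
    (trans (∑-cartesianProduct xs ys _) (trans (∑-const xs _) (cong (length xs *_) (∑-1 ys))))

  ^-monoʳ-∣ : ∀ p {k l} → k ≤ l → p ^ k ∣ p ^ l
  ^-monoʳ-∣ p {k} {l} k≤l = divides (p ^ (l ∸ k)) (trans (cong (p ^_) (sym (m∸n+n≡m k≤l))) (^-distribˡ-+-* p (l ∸ k) k))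

  module Classes {_~_ : Rel X 0ℓ} (_~?_ : Decidable₂ _~_) (~-sym : Symmetric _~_) (~-trans : Transitive _~_)
    {reps : List X} (inequivalent : AllPairs (λ x y → ¬ x ~ y) reps) where

    private
      classOf≤1 : ∀ s → ∑[ r ← reps ] 𝟙 (s ~? r) ≤ 1
      classOf≤1 s = ∑-𝟙≤1 (s ~?_) (AllPairs.map (λ x≁y s~x s~y → x≁y (~-trans (~-sym s~x) s~y)) inequivalent)

    -- The class sizes inside `ss` sum to at least `length ss` and their squares count equivalent
    -- pairs; Cauchy-Schwarz over the representatives compares the two. As `reps` may represent more
    -- than `ss`, a subset of the tuples can bound the number of all classes from below.
    length²≤classes*pairs : (ss : List X) → (∀ {s} → s ∈ ss → Any (s ~_) reps) →
      length ss * length ss ≤ length reps * (∑[ s ← ss ] ∑[ t ← ss ] 𝟙 (s ~? t))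
    length²≤classes*pairs ss covers = begin
      length ss * length ss
        ≤⟨ *-mono-≤ cover cover ⟩
      ∑ reps class * ∑ reps class
        ≤⟨ cauchy-schwarz reps class ⟩
      length reps * (∑[ r ← reps ] class r * class r)
        ≡⟨ cong (length reps *_) (∑-cong reps λ r → ∑-prod ss ss _ _) ⟩
      length reps * (∑[ r ← reps ] ∑[ s ← ss ] ∑[ t ← ss ] 𝟙 (s ~? r) * 𝟙 (t ~? r))
        ≡⟨ cong (length reps *_) (trans (∑-swap reps ss _) (∑-cong ss λ s → ∑-swap reps ss _)) ⟩
      length reps * (∑[ s ← ss ] ∑[ t ← ss ] ∑[ r ← reps ] 𝟙 (s ~? r) * 𝟙 (t ~? r))
        ≤⟨ *-monoʳ-≤ (length reps) (∑-mono ss λ s _ → ∑-mono ss λ t _ → common s t) ⟩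
      length reps * (∑[ s ← ss ] ∑[ t ← ss ] 𝟙 (s ~? t)) ∎
      where
      open ≤-Reasoning
      class : X → ℕ
      class r = ∑[ s ← ss ] 𝟙 (s ~? r)
      one : ∀ {s} → Any (s ~_) reps → 1 ≤ ∑[ r ← reps ] 𝟙 (s ~? r)
      one {s} any with find any
      ... | r , r∈ , s~r = ≤-trans (≤-reflexive (sym (𝟙-yes (s ~? r) s~r))) (term≤∑ reps (λ r → 𝟙 (s ~? r)) r∈)
      cover : length ss ≤ ∑ reps class
      cover = begin
        length ss                                ≡⟨ ∑-1 ss ⟨
        ∑ ss (λ _ → 1)                           ≤⟨ ∑-mono ss (λ s s∈ → one (covers s∈)) ⟩
        ∑[ s ← ss ] ∑[ r ← reps ] 𝟙 (s ~? r)     ≡⟨ ∑-swap ss reps _ ⟩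
        ∑ reps class                             ∎
      common : ∀ s t → ∑[ r ← reps ] 𝟙 (s ~? r) * 𝟙 (t ~? r) ≤ 𝟙 (s ~? t)
      common s t with s ~? t
      ... | yes _  = ≤-trans (∑-mono reps λ r _ → ≤-trans (*-monoʳ-≤ (𝟙 (s ~? r)) (𝟙≤1 (t ~? r)))
                                                          (≤-reflexive (*-identityʳ _))) (classOf≤1 s)
      ... | no s≁t = ≤-reflexive (∑-zero reps λ r _ → trans (sym (𝟙-× (s ~? r) (t ~? r)))
                       (𝟙-no ((s ~? r) ×-dec (t ~? r)) λ (s~r , t~r) → s≁t (~-trans s~r (~-sym t~r))))

    classes≤codes : {ys : List Y} (_≟_ : (x y : Y) → Dec (x ≡ y)) → (∀ y → y ∈ ys) →
      (code : X → Y) → (∀ {s t} → code s ≡ code t → s ~ t) → length reps ≤ length ys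
    classes≤codes {ys = ys} _≟_ complete code inj = begin
      length reps                                  ≡⟨ ∑-1 reps ⟨
      ∑ reps (λ _ → 1)                             ≤⟨ ∑-mono reps (λ r _ → one r) ⟩
      ∑[ r ← reps ] ∑[ y ← ys ] 𝟙 (code r ≟ y)     ≡⟨ ∑-swap reps ys _ ⟩
      ∑[ y ← ys ] ∑[ r ← reps ] 𝟙 (code r ≟ y)     ≤⟨ ∑-≤const ys (λ y _ → ∑-𝟙≤1 (λ r → code r ≟ y)
        (AllPairs.map (λ r≁s e e′ → r≁s (inj (trans e (sym e′)))) inequivalent)) ⟩
      length ys * 1                                ≡⟨ *-identityʳ _ ⟩
      length ys                                    ∎
      where
      open ≤-Reasoning
      one : ∀ r → 1 ≤ ∑[ y ← ys ] 𝟙 (code r ≟ y)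
      one r = ≤-trans (≤-reflexive (sym (𝟙-yes (code r ≟ code r) refl))) (term≤∑ ys (λ y → 𝟙 (code r ≟ y)) (complete (code r)))

  vectors : List X → ∀ m → List (Vec X m)
  vectors xs zero    = [] ∷ []
  vectors xs (suc m) = cartesianProductWith _∷_ xs (vectors xs m)

  ∑-vectors : (xs : List X) (m : ℕ) (F : Vec X (suc m) → ℕ) →
    ∑ (vectors xs (suc m)) F ≡ ∑[ x ← xs ] ∑[ s ← vectors xs m ] F (x ∷ s)
  ∑-vectors xs m F = ∑-cartesianProductWith _∷_ xs (vectors xs m) F

  length-vectors : (xs : List X) (m : ℕ) → length (vectors xs m) ≡ length xs ^ m
  length-vectors xs zero    = refl
  length-vectors xs (suc m) = begin
    length (vectors xs (suc m))                 ≡⟨ ∑-1 (vectors xs (suc m)) ⟨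
    ∑ (vectors xs (suc m)) (λ _ → 1)            ≡⟨ ∑-vectors xs m _ ⟩
    ∑ xs (λ _ → ∑ (vectors xs m) (λ _ → 1))     ≡⟨ ∑-const xs _ ⟩
    length xs * ∑ (vectors xs m) (λ _ → 1)      ≡⟨ cong (length xs *_) (trans (∑-1 (vectors xs m)) (length-vectors xs m)) ⟩
    length xs ^ suc m                           ∎
    where open ≡-Reasoning

  lookup-vectors : {xs : List X} (m : ℕ) {s : Vec X m} → s ∈ vectors xs m → ∀ i → lookup s i ∈ xs
  lookup-vectors {xs = xs} (suc m) s∈ i with ∈-cartesianProductWith⁻ _∷_ xs (vectors xs m) s∈
  lookup-vectors (suc m) s∈ zero    | x , s , x∈ , s∈′ , refl = x∈
  lookup-vectors (suc m) s∈ (suc i) | x , s , x∈ , s∈′ , refl = lookup-vectors m s∈′ i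

  vectors-complete : {xs : List X} → (∀ x → x ∈ xs) → ∀ {m} (s : Vec X m) → s ∈ vectors xs m
  vectors-complete complete []      = here refl
  vectors-complete complete (x ∷ s) = ∈-cartesianProductWith⁺ _∷_ (complete x) (vectors-complete complete s)

  matches : (X → Y → ℕ) → ∀ {m} → Vec X m → Vec Y m → ℕ
  matches w []      []      = 1
  matches w (x ∷ s) (y ∷ t) = w x y * matches w s t

  -- The weight is a product over coordinates, so the double sum factors. With `w` the indicator of
  -- g x = y, this is how the power λ(g)ᵏ⁺¹ arises.
  ∑-matches : (xs : List X) (ys : List Y) (w : X → Y → ℕ) (m : ℕ) →
    ∑[ s ← vectors xs m ] ∑[ t ← vectors ys m ] matches w s t ≡ (∑[ x ← xs ] ∑[ y ← ys ] w x y) ^ m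
  ∑-matches xs ys w zero    = refl
  ∑-matches xs ys w (suc m) = begin
    ∑[ s ← vectors xs (suc m) ] ∑[ t ← vectors ys (suc m) ] matches w s t
      ≡⟨ trans (∑-vectors xs m _) (∑-cong xs λ x → ∑-cong (vectors xs m) λ s → ∑-vectors ys m _) ⟩
    ∑[ x ← xs ] ∑[ s ← vectors xs m ] ∑[ y ← ys ] ∑[ t ← vectors ys m ] w x y * matches w s t
      ≡⟨ ∑-cong xs (λ x → trans (∑-swap (vectors xs m) ys _) (∑-cong ys λ y →
           trans (∑-cong (vectors xs m) λ s → ∑-*ˡ (vectors ys m) (w x y) _) (∑-*ˡ (vectors xs m) (w x y) _))) ⟩
    ∑[ x ← xs ] ∑[ y ← ys ] w x y * (∑[ s ← vectors xs m ] ∑[ t ← vectors ys m ] matches w s t)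
      ≡⟨ trans (∑-cong xs λ x → ∑-*ʳ ys _ _) (∑-*ʳ xs _ _) ⟩
    (∑[ x ← xs ] ∑[ y ← ys ] w x y) * (∑[ s ← vectors xs m ] ∑[ t ← vectors ys m ] matches w s t)
      ≡⟨ cong ((∑[ x ← xs ] ∑[ y ← ys ] w x y) *_) (∑-matches xs ys w m) ⟩
    (∑[ x ← xs ] ∑[ y ← ys ] w x y) ^ suc m ∎
    where open ≡-Reasoning

  matches≡1 : (w : X → Y → ℕ) {m : ℕ} (s : Vec X m) (t : Vec Y m) →
    (∀ i → w (lookup s i) (lookup t i) ≡ 1) → matches w s t ≡ 1
  matches≡1 w []      []      h = refl
  matches≡1 w (x ∷ s) (y ∷ t) h = cong₂ _*_ (h zero) (matches≡1 w s t λ i → h (suc i))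

-- The canonical map from ℤ to a commutative ring.

module IntegerCoefficients where
  open import Algebra.Bundles using (CommutativeRing)
  open import Data.Integer.Base as ℤ using (ℤ)
  import Data.Integer.Properties as ℤ
  import Data.Maybe.Base as Maybe
  open import Data.Nat.Base as ℕ using (ℕ; zero; suc)
  open import Relation.Binary.PropositionalEquality as ≡ using (_≡_)
  open import Relation.Nullary.Decidable using (dec⇒maybe)

  module IntegerHomomorphism {c ℓ} (R : CommutativeRing c ℓ) where
    open CommutativeRing R
    open import Algebra.Properties.Ring ring
    open import Algebra.Properties.Semiring.Mult semiring
    open import Algebra.Properties.AbelianGroup +-abelianGroup using (⁻¹-∙-comm)
    open import Algebra.Solver.Ring.AlmostCommutativeRing using (fromCommutativeRing; _-Raw-AlmostCommutative⟶_)
    open import Relation.Binary.Reasoning.Setoid setoid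

    -- Serves twice: as coefficient map of the ring solver, integers having decidable equality, and
    -- as reduction modulo n when the ring is ℤ/n.
    fromℤ : ℤ → Carrier
    fromℤ (ℤ.+ n)      = n × 1#
    fromℤ (ℤ.-[1+ n ]) = - (suc n × 1#)

    fromℤ-neg : ∀ n → fromℤ (ℤ.- n) ≈ - fromℤ n
    fromℤ-neg (ℤ.+ zero)   = sym -0#≈0#
    fromℤ-neg (ℤ.+ suc n)  = refl
    fromℤ-neg (ℤ.-[1+ n ]) = sym (-‿involutive _)

    -- Adding integers of opposite sign computes through `⊖`, which cancels one successor on each
    -- side; in the ring this is the insertion of 1 + (-1).
    fromℤ-⊖ : ∀ m n → fromℤ (m ℤ.⊖ n) ≈ m × 1# + - (n × 1#)
    fromℤ-⊖ m zero = begin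
      m × 1#          ≈⟨ +-identityʳ _ ⟨
      m × 1# + 0#     ≈⟨ +-congˡ -0#≈0# ⟨
      m × 1# + - 0#   ∎
    fromℤ-⊖ zero (suc n) = sym (+-identityˡ _)
    fromℤ-⊖ (suc m) (suc n) = begin
      fromℤ (suc m ℤ.⊖ suc n)               ≡⟨ ≡.cong fromℤ (ℤ.[1+m]⊖[1+n]≡m⊖n m n) ⟩
      fromℤ (m ℤ.⊖ n)                       ≈⟨ fromℤ-⊖ m n ⟩
      M + - N                               ≈⟨ +-congˡ (+-identityˡ _) ⟨
      M + (0# + - N)                        ≈⟨ +-congˡ (+-congʳ (-‿inverseʳ 1#)) ⟨
      M + (1# + - 1# + - N)                 ≈⟨ +-congˡ (+-assoc _ _ _) ⟩
      M + (1# + (- 1# + - N))               ≈⟨ +-assoc _ _ _ ⟨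
      M + 1# + (- 1# + - N)                 ≈⟨ +-cong (+-comm _ _) (⁻¹-∙-comm _ _) ⟩
      1# + M + - (1# + N)                   ∎
      where M = m × 1# ; N = n × 1#

    fromℤ-+ : ∀ m n → fromℤ (m ℤ.+ n) ≈ fromℤ m + fromℤ n
    fromℤ-+ (ℤ.+ m)      (ℤ.+ n)      = ×-homo-+ 1# m n
    fromℤ-+ (ℤ.+ m)      (ℤ.-[1+ n ]) = fromℤ-⊖ m (suc n)
    fromℤ-+ (ℤ.-[1+ m ]) (ℤ.+ n)      = trans (fromℤ-⊖ n (suc m)) (+-comm _ _)
    fromℤ-+ (ℤ.-[1+ m ]) (ℤ.-[1+ n ]) = begin
      - (suc (suc (m ℕ.+ n)) × 1#)        ≡⟨ ≡.cong (λ k → - (k × 1#)) (≡.cong suc (≡.sym (ℕ.+-suc m n))) ⟩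
      - ((suc m ℕ.+ suc n) × 1#)          ≈⟨ -‿cong (×-homo-+ 1# (suc m) (suc n)) ⟩
      - (suc m × 1# + suc n × 1#)         ≈⟨ ⁻¹-∙-comm _ _ ⟨
      - (suc m × 1#) + - (suc n × 1#)     ∎
      where import Data.Nat.Properties as ℕ

    fromℤ-*⁺ : ∀ m n → fromℤ (ℤ.+ m ℤ.* n) ≈ m × 1# * fromℤ n
    fromℤ-*⁺ m (ℤ.+ n) = trans (reflexive (≡.cong fromℤ (≡.sym (ℤ.pos-* m n)))) (×1-homo-* m n)
    fromℤ-*⁺ m (ℤ.-[1+ n ]) = begin
      fromℤ (ℤ.+ m ℤ.* ℤ.- (ℤ.+ suc n))     ≡⟨ ≡.cong fromℤ (ℤ.neg-distribʳ-* (ℤ.+ m) (ℤ.+ suc n)) ⟨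
      fromℤ (ℤ.- (ℤ.+ m ℤ.* ℤ.+ suc n))     ≈⟨ fromℤ-neg (ℤ.+ m ℤ.* ℤ.+ suc n) ⟩
      - fromℤ (ℤ.+ m ℤ.* ℤ.+ suc n)         ≈⟨ -‿cong (fromℤ-*⁺ m (ℤ.+ suc n)) ⟩
      - (m × 1# * (suc n × 1#))             ≈⟨ -‿distribʳ-* _ _ ⟩
      m × 1# * - (suc n × 1#)               ∎

    fromℤ-* : ∀ m n → fromℤ (m ℤ.* n) ≈ fromℤ m * fromℤ n
    fromℤ-* (ℤ.+ m)      n = fromℤ-*⁺ m n
    fromℤ-* (ℤ.-[1+ m ]) n = begin
      fromℤ (ℤ.- (ℤ.+ suc m) ℤ.* n)       ≡⟨ ≡.cong fromℤ (ℤ.neg-distribˡ-* (ℤ.+ suc m) n) ⟨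
      fromℤ (ℤ.- (ℤ.+ suc m ℤ.* n))       ≈⟨ fromℤ-neg (ℤ.+ suc m ℤ.* n) ⟩
      - fromℤ (ℤ.+ suc m ℤ.* n)           ≈⟨ -‿cong (fromℤ-*⁺ (suc m) n) ⟩
      - (suc m × 1# * fromℤ n)            ≈⟨ -‿distribˡ-* _ _ ⟩
      - (suc m × 1#) * fromℤ n            ∎

    fromℤ-hom : CommutativeRing.rawRing ℤ.+-*-commutativeRing
                  -Raw-AlmostCommutative⟶ fromCommutativeRing R
    fromℤ-hom = record
      { ⟦_⟧ = fromℤ ; +-homo = fromℤ-+ ; *-homo = fromℤ-* ; -‿homo = fromℤ-neg
      ; 0-homo = refl ; 1-homo = +-identityʳ 1# }

    open import Algebra.Solver.Ring (CommutativeRing.rawRing ℤ.+-*-commutativeRing)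
      (fromCommutativeRing R) fromℤ-hom
      (λ m n → Maybe.map (λ m≡n → reflexive (≡.cong fromℤ m≡n)) (dec⇒maybe (m ℤ.≟ n)))
      public using (solve; _:=_; _:+_; _:*_; _:-_; :-_; con)

-- Determinants, transporting matrices and change of basis.

module PlaneAlgebra where
  open import Algebra.Bundles using (CommutativeRing)
  open import Algebra.Core using (Op₁; Op₂)
  open import Algebra.Structures using (IsCommutativeRing)
  open import Data.Product.Base using (_×_; _,_; proj₁; proj₂; ∃-syntax)
  open import Data.Product.Properties using (,-injective)
  open import Level using (0ℓ)
  open import Relation.Binary.PropositionalEquality
  open import Relation.Unary using (Pred)
  open FiniteSums
  open IntegerCoefficients

  module PlaneGeometry {A : Set} (add mul : Op₂ A) (neg : Op₁ A) (zer one : A)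
    (isCR : IsCommutativeRing _≡_ add mul neg zer one) where

    R : CommutativeRing 0ℓ 0ℓ
    R = record { isCommutativeRing = isCR }

    open IntegerHomomorphism R hiding (fromℤ)
    open CommutativeRing R using (_+_; _*_; -_; 0#; 1#; ring; *-comm; *-assoc; *-identityˡ)
    open import Algebra.Properties.Ring ring using (+-cancelˡ; +-cancelʳ; -‿involutive; -‿injective)
    open Geometry R

    Unit : Pred A 0ℓ
    Unit x = ∃[ y ] x * y ≡ 1#

    det : Point → Point → A
    det x y = x · y ^⊥

    unit-factor : ∀ {x y} → Unit (x * y) → Unit x
    unit-factor {x} {y} (z , eq) = y * z , trans (sym (*-assoc x y z)) eq

    unit-cancel : ∀ {c x y} → Unit c → c * x ≡ c * y → x ≡ y
    unit-cancel {c} {x} {y} (i , ci≡1) eq = begin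
      x             ≡⟨ *-identityˡ x ⟨
      1# * x        ≡⟨ cong (_* x) ci≡1 ⟨
      c * i * x     ≡⟨ solve 3 (λ c i x → c :* i :* x := i :* (c :* x)) refl c i x ⟩
      i * (c * x)   ≡⟨ cong (i *_) eq ⟩
      i * (c * y)   ≡⟨ solve 3 (λ c i x → i :* (c :* x) := c :* i :* x) refl c i y ⟩
      c * i * y     ≡⟨ cong (_* y) ci≡1 ⟩
      1# * y        ≡⟨ *-identityˡ y ⟩
      y             ∎
      where open ≡-Reasoning

    det-injective₂ : ∀ {x y z} → Unit (proj₁ x) → det x y ≡ det x z → proj₁ y ≡ proj₁ z → y ≡ z
    det-injective₂ {x₁ , x₂} {y₁ , y₂} {.y₁ , z₂} u eq refl =
      cong (y₁ ,_) (unit-cancel u (+-cancelʳ (x₂ * (- y₁)) _ _ eq))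

    det-injective₁ : ∀ {x y z} → Unit (proj₂ x) → det x y ≡ det x z → proj₂ y ≡ proj₂ z → y ≡ z
    det-injective₁ {x₁ , x₂} {y₁ , y₂} {z₁ , .y₂} u eq refl =
      cong (_, y₂) (-‿injective (unit-cancel u (+-cancelˡ (x₁ * y₂) _ _ eq)))

    _⊖_ : Point → Point → Point
    (x₁ , x₂) ⊖ (y₁ , y₂) = x₁ + - y₁ , x₂ + - y₂

    -- The difference stands in the first slot because the solutions x of det w x = e are later
    -- counted for a fixed w in that slot.
    det-⊖ : ∀ x y z → det x y ≡ det x z → det (y ⊖ z) x ≡ 0#
    det-⊖ x@(x₁ , x₂) y@(y₁ , y₂) z@(z₁ , z₂) eq = begin
      det (y ⊖ z) x         ≡⟨ solve 6 (λ x₁ x₂ y₁ y₂ z₁ z₂ →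
                                 (y₁ :+ :- z₁) :* x₂ :+ (y₂ :+ :- z₂) :* (:- x₁) :=
                                 :- (x₁ :* y₂ :+ x₂ :* (:- y₁)) :+ (x₁ :* z₂ :+ x₂ :* (:- z₁)))
                                 refl x₁ x₂ y₁ y₂ z₁ z₂ ⟩
      - det x y + det x z   ≡⟨ cong (λ d → - d + det x z) eq ⟩
      - det x z + det x z   ≡⟨ CommutativeRing.-‿inverseˡ R (det x z) ⟩
      0#                    ∎
      where open ≡-Reasoning

    Matrix : Set
    Matrix = Point × Point

    act : Matrix → Point → Point
    act (u , v) x = u · x , v · x

    det-act : ∀ u v x y → det u v ≡ 1# → det (act (u , v) x) (act (u , v) y) ≡ det x y
    det-act u@(u₁ , u₂) v@(v₁ , v₂) x@(x₁ , x₂) y@(y₁ , y₂) eq = begin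
      det (act (u , v) x) (act (u , v) y) ≡⟨ solve 8 (λ u₁ u₂ v₁ v₂ x₁ x₂ y₁ y₂ →
        (u₁ :* x₁ :+ u₂ :* x₂) :* (v₁ :* y₁ :+ v₂ :* y₂) :+
        (v₁ :* x₁ :+ v₂ :* x₂) :* (:- (u₁ :* y₁ :+ u₂ :* y₂)) :=
        (u₁ :* v₂ :+ u₂ :* (:- v₁)) :* (x₁ :* y₂ :+ x₂ :* (:- y₁))) refl u₁ u₂ v₁ v₂ x₁ x₂ y₁ y₂ ⟩
      det u v * det x y                   ≡⟨ cong (_* det x y) eq ⟩
      1# * det x y                        ≡⟨ *-identityˡ _ ⟩
      det x y                             ∎
      where open ≡-Reasoning

    -- Cramer's rule: det x y times either entry of a row is a combination of the products of that
    -- row with x and y.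
    row-unique : ∀ {u v x y} → Unit (det x y) → u · x ≡ v · x → u · y ≡ v · y → u ≡ v
    row-unique {u₁ , u₂} {v₁ , v₂} {x₁ , x₂} {y₁ , y₂} unit eq eq′ = cong₂ _,_
      (unit-cancel unit (begin
        D * u₁ ≡⟨ first u₁ u₂ ⟩
        (u₁ * x₁ + u₂ * x₂) * y₂ + - ((u₁ * y₁ + u₂ * y₂) * x₂) ≡⟨ cong₂ (λ s t → s * y₂ + - (t * x₂)) eq eq′ ⟩
        (v₁ * x₁ + v₂ * x₂) * y₂ + - ((v₁ * y₁ + v₂ * y₂) * x₂) ≡⟨ first v₁ v₂ ⟨
        D * v₁ ∎))
      (unit-cancel unit (begin
        D * u₂ ≡⟨ second u₁ u₂ ⟩
        (u₁ * y₁ + u₂ * y₂) * x₁ + - ((u₁ * x₁ + u₂ * x₂) * y₁) ≡⟨ cong₂ (λ s t → t * x₁ + - (s * y₁)) eq eq′ ⟩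
        (v₁ * y₁ + v₂ * y₂) * x₁ + - ((v₁ * x₁ + v₂ * x₂) * y₁) ≡⟨ second v₁ v₂ ⟨
        D * v₂ ∎))
      where
      open ≡-Reasoning
      D : A
      D = x₁ * y₂ + x₂ * (- y₁)
      first : ∀ w₁ w₂ → D * w₁ ≡ (w₁ * x₁ + w₂ * x₂) * y₂ + - ((w₁ * y₁ + w₂ * y₂) * x₂)
      first w₁ w₂ = solve 6 (λ w₁ w₂ x₁ x₂ y₁ y₂ → (x₁ :* y₂ :+ x₂ :* (:- y₁)) :* w₁ :=
        (w₁ :* x₁ :+ w₂ :* x₂) :* y₂ :+ :- ((w₁ :* y₁ :+ w₂ :* y₂) :* x₂)) refl w₁ w₂ x₁ x₂ y₁ y₂
      second : ∀ w₁ w₂ → D * w₂ ≡ (w₁ * y₁ + w₂ * y₂) * x₁ + - ((w₁ * x₁ + w₂ * x₂) * y₁)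
      second w₁ w₂ = solve 6 (λ w₁ w₂ x₁ x₂ y₁ y₂ → (x₁ :* y₂ :+ x₂ :* (:- y₁)) :* w₂ :=
        (w₁ :* y₁ :+ w₂ :* y₂) :* x₁ :+ :- ((w₁ :* x₁ :+ w₂ :* x₂) :* y₁)) refl w₁ w₂ x₁ x₂ y₁ y₂

    -- The matrices of determinant 1 taking x to y are parametrised by their upper right entry b.
    module Transporter {x y : Point} (ux : Unit (proj₁ x)) (uy : Unit (proj₁ y)) where
      private
        x₁ = proj₁ x ; x₂ = proj₂ x ; y₁ = proj₁ y ; y₂ = proj₂ y
        i = proj₁ ux ; j = proj₁ uy

      -- Sending x to y forces the left entries. Determinant 1, multiplied by x₁, then reduces to y₁
      -- e - b y₂ = x₁, which gives e; `i` and `j` are the inverses of x₁ and y₁.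
      transporter : A → Matrix
      transporter b = (i * (y₁ + - (b * x₂)) , b) , (i * (y₂ + - (e * x₂)) , e)
        where e = j * (x₁ + b * y₂)

      private
        scale : ∀ z b → i * (z + - (b * x₂)) * x₁ + b * x₂ ≡ z
        scale z b = begin
          i * (z + - (b * x₂)) * x₁ + b * x₂   ≡⟨ solve 5 (λ i z b x₁ x₂ →
              i :* (z :+ :- (b :* x₂)) :* x₁ :+ b :* x₂ := x₁ :* i :* (z :+ :- (b :* x₂)) :+ b :* x₂)
              refl i z b x₁ x₂ ⟩
          x₁ * i * (z + - (b * x₂)) + b * x₂   ≡⟨ cong (λ t → t * (z + - (b * x₂)) + b * x₂) (proj₂ ux) ⟩
          1# * (z + - (b * x₂)) + b * x₂       ≡⟨ cong (_+ b * x₂) (*-identityˡ _) ⟩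
          z + - (b * x₂) + b * x₂              ≡⟨ solve 3 (λ z b x₂ → z :+ :- (b :* x₂) :+ b :* x₂ := z) refl z b x₂ ⟩
          z                                    ∎
          where open ≡-Reasoning

      act-transporter : ∀ b → act (transporter b) x ≡ y
      act-transporter b = cong₂ _,_ (scale y₁ b) (scale y₂ _)

      det-transporter : ∀ b → det (proj₁ (transporter b)) (proj₂ (transporter b)) ≡ 1#
      det-transporter b = begin
        i * (y₁ + - (b * x₂)) * e + b * (- (i * (y₂ + - (e * x₂))))
          ≡⟨ solve 6 (λ i y₁ y₂ b x₂ e → i :* (y₁ :+ :- (b :* x₂)) :* e :+ b :* (:- (i :* (y₂ :+ :- (e :* x₂))))
               := i :* (y₁ :* e :+ :- (b :* y₂))) refl i y₁ y₂ b x₂ e ⟩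
        i * (y₁ * e + - (b * y₂))
          ≡⟨ cong (λ t → i * (t + - (b * y₂)))
             (trans (sym (*-assoc y₁ j _)) (trans (cong (_* (x₁ + b * y₂)) (proj₂ uy)) (*-identityˡ _))) ⟩
        i * (x₁ + b * y₂ + - (b * y₂))
          ≡⟨ solve 4 (λ i x₁ b y₂ → i :* (x₁ :+ b :* y₂ :+ :- (b :* y₂)) := x₁ :* i) refl i x₁ b y₂ ⟩
        x₁ * i ≡⟨ proj₂ ux ⟩
        1# ∎
        where
        open ≡-Reasoning
        e : A
        e = j * (x₁ + b * y₂)

      private
        -- The equation behind the choice of e in `transporter`, now for an arbitrary matrix: it
        -- forces the lower right entry.
        lower : ∀ u v → det u v ≡ 1# → act (u , v) x ≡ y → y₁ * proj₂ v ≡ x₁ + proj₂ u * y₂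
        lower (a , b) (c , d) eq eq′ with ,-injective eq′
        ... | e₁ , e₂ = begin
          y₁ * d                                             ≡⟨ cong (_* d) e₁ ⟨
          (a * x₁ + b * x₂) * d                              ≡⟨ solve 6 (λ a b c d x₁ x₂ →
              (a :* x₁ :+ b :* x₂) :* d := (a :* d :+ b :* (:- c)) :* x₁ :+ b :* (c :* x₁ :+ d :* x₂))
              refl a b c d x₁ x₂ ⟩
          (a * d + b * (- c)) * x₁ + b * (c * x₁ + d * x₂)   ≡⟨ cong₂ (λ s t → s * x₁ + b * t) eq e₂ ⟩
          1# * x₁ + b * y₂                                   ≡⟨ cong (_+ b * y₂) (*-identityˡ x₁) ⟩
          x₁ + b * y₂                                        ∎
          where open ≡-Reasoning

        upper : ∀ {u v z} → u · x ≡ z → v · x ≡ z → proj₂ u ≡ proj₂ v → u ≡ v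
        upper {a , b} {c , .b} {z} e e′ refl = cong (_, b) (unit-cancel ux
          (trans (*-comm x₁ a) (trans (+-cancelʳ (b * x₂) _ _ (trans e (sym e′))) (*-comm c x₁))))

      transporter-unique : ∀ {g h} → det (proj₁ g) (proj₂ g) ≡ 1# → act g x ≡ y →
        det (proj₁ h) (proj₂ h) ≡ 1# → act h x ≡ y → proj₂ (proj₁ g) ≡ proj₂ (proj₁ h) → g ≡ h
      transporter-unique {u , v} {u′ , v′} d e d′ e′ b≡b′ = cong₂ _,_
        (upper (proj₁ (,-injective e)) (proj₁ (,-injective e′)) b≡b′)
        (upper (proj₂ (,-injective e)) (proj₂ (,-injective e′))
          (unit-cancel uy (trans (lower u v d e) (trans (cong (λ b → x₁ + b * y₂) b≡b′) (sym (lower u′ v′ d′ e′))))))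

    module ChangeOfBasis {x y x′ y′ : Point} (unit : Unit (det x y)) (same : det x y ≡ det x′ y′) where
      private
        x₁ = proj₁ x ; x₂ = proj₂ x ; y₁ = proj₁ y ; y₂ = proj₂ y
        x₁′ = proj₁ x′ ; x₂′ = proj₂ x′ ; y₁′ = proj₁ y′ ; y₂′ = proj₂ y′
        i = proj₁ unit
        D = det x y

      -- By Cramer's rule, the row whose product with x is `s` and whose product with y is `t`.
      row : A → A → Point
      row s t = i * (s * y₂ + - (t * x₂)) , i * (t * x₁ + - (s * y₁))

      basisChange : Matrix
      basisChange = row x₁′ y₁′ , row x₂′ y₂′

      det-basisChange : det (proj₁ basisChange) (proj₂ basisChange) ≡ 1#
      det-basisChange = begin
        det (row x₁′ y₁′) (row x₂′ y₂′)
          ≡⟨ solve 9 (λ i x₁ x₂ y₁ y₂ s t s′ t′ →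
               (i :* (s :* y₂ :+ :- (t :* x₂))) :* (i :* (t′ :* x₁ :+ :- (s′ :* y₁))) :+
               (i :* (t :* x₁ :+ :- (s :* y₁))) :* (:- (i :* (s′ :* y₂ :+ :- (t′ :* x₂)))) :=
               ((x₁ :* y₂ :+ x₂ :* (:- y₁)) :* i) :* ((s :* t′ :+ s′ :* (:- t)) :* i))
               refl i x₁ x₂ y₁ y₂ x₁′ y₁′ x₂′ y₂′ ⟩
        D * i * (det x′ y′ * i)   ≡⟨ cong (λ t → D * i * (t * i)) same ⟨
        D * i * (D * i)           ≡⟨ cong₂ _*_ (proj₂ unit) (proj₂ unit) ⟩
        1# * 1#                   ≡⟨ *-identityˡ 1# ⟩
        1#                        ∎
        where open ≡-Reasoning

      -- Since D z = det z y · x + det x z · y, the product of the row with z depends only on the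
      -- two determinants of z with the basis; the same identity for the primed points recovers the
      -- first coordinate of z′. Arbitrary s′ and t′ let the rotated points of the second row be
      -- inserted as well.
      row-· : ∀ s t s′ t′ z z′ → det x z ≡ det (s , s′) z′ → det z y ≡ det z′ (t , t′) →
              det x y ≡ det (s , s′) (t , t′) → row s t · z ≡ proj₁ z′
      row-· s t s′ t′ z@(z₁ , z₂) z′@(z₁′ , z₂′) xz zy xy = begin
        row s t · z
          ≡⟨ solve 9 (λ i x₁ x₂ y₁ y₂ s t z₁ z₂ →
               i :* (s :* y₂ :+ :- (t :* x₂)) :* z₁ :+ i :* (t :* x₁ :+ :- (s :* y₁)) :* z₂ :=
               i :* ((x₁ :* z₂ :+ x₂ :* (:- z₁)) :* t :+ (z₁ :* y₂ :+ z₂ :* (:- y₁)) :* s))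
               refl i x₁ x₂ y₁ y₂ s t z₁ z₂ ⟩
        i * (det x z * t + det z y * s)
          ≡⟨ cong₂ (λ α β → i * (α * t + β * s)) xz zy ⟩
        i * (det (s , s′) z′ * t + det z′ (t , t′) * s)
          ≡⟨ solve 7 (λ i s t s′ t′ z₁ z₂ →
               i :* ((s :* z₂ :+ s′ :* (:- z₁)) :* t :+ (z₁ :* t′ :+ z₂ :* (:- t)) :* s) :=
               (s :* t′ :+ s′ :* (:- t)) :* i :* z₁) refl i s t s′ t′ z₁′ z₂′ ⟩
        det (s , s′) (t , t′) * i * z₁′   ≡⟨ cong (λ α → α * i * z₁′) xy ⟨
        D * i * z₁′                       ≡⟨ cong (_* z₁′) (proj₂ unit) ⟩
        1# * z₁′                          ≡⟨ *-identityˡ z₁′ ⟩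
        z₁′                               ∎
        where open ≡-Reasoning

      private
        -- Rotating x′, y′ and z′ by a quarter turn reduces the second row to the first.
        rotate-det : ∀ z w → det (proj₂ z , - proj₁ z) (proj₂ w , - proj₁ w) ≡ det z w
        rotate-det (z₁ , z₂) (w₁ , w₂) =
          solve 4 (λ z₁ z₂ w₁ w₂ → z₂ :* (:- w₁) :+ (:- z₁) :* (:- w₂) := z₁ :* w₂ :+ z₂ :* (:- w₁))
            refl z₁ z₂ w₁ w₂

      act-basisChange : ∀ {z z′} → det x z ≡ det x′ z′ → det z y ≡ det z′ y′ → act basisChange z ≡ z′
      act-basisChange {z} {z′} xz zy = cong₂ _,_
        (row-· x₁′ y₁′ x₂′ y₂′ z z′ xz zy same)
        (row-· x₂′ y₂′ (- x₁′) (- y₁′) z (proj₂ z′ , - proj₁ z′)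
          (trans xz (sym (rotate-det x′ z′))) (trans zy (sym (rotate-det z′ y′)))
          (trans same (sym (rotate-det x′ y′))))

-- Counting points and matrices over a finite local ring.

module SpecialLinearCounting where
  open import Algebra.Bundles using (CommutativeRing)
  open import Algebra.Core using (Op₁; Op₂)
  open import Algebra.Structures using (IsCommutativeRing)
  open import Data.Fin.Base using (zero; suc)
  open import Data.List.Base using (List; length; filter; cartesianProduct)
  open import Data.List.Membership.Propositional using (_∈_)
  open import Data.List.Membership.Propositional.Properties using (∈-cartesianProduct⁺; ∈-filter⁺; ∈-filter⁻)
  open import Data.List.Properties using () renaming (length-filter to length-filter-≤)
  open import Data.List.Relation.Unary.AllPairs using (AllPairs)
  open import Data.List.Relation.Unary.Any using (Any)
  open import Data.List.Relation.Unary.Unique.Propositional using (Unique)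
  open import Data.List.Relation.Unary.Unique.Propositional.Properties as Unique using ()
  open import Data.Nat.Base as ℕ using (ℕ; zero; suc; _≤_; _+_; _*_; _^_; z≤n; NonZero)
  open import Data.Nat.Properties
  open import Data.Nat.Tactic.RingSolver using (solve-∀)
  open import Data.Product.Base using (_×_; _,_; proj₁; proj₂)
  open import Data.Product.Properties using (≡-dec; ,-injective)
  open import Data.Sum.Base using (_⊎_; inj₁; inj₂; [_,_]′)
  open import Data.Unit.Base using (tt)
  open import Data.Vec.Base using (lookup)
  open import Function.Base using (_∘_)
  open import Level using (0ℓ)
  open import Relation.Binary.Definitions using (DecidableEquality)
  open import Relation.Binary.PropositionalEquality
  open import Relation.Nullary.Decidable using (Dec; yes; no; _×-dec_; _⊎-dec_; ¬?)
  open import Relation.Nullary.Negation using (¬_; contradiction)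
  open import Relation.Unary using (Pred; Decidable)
  open FiniteSums
  open IntegerCoefficients
  open PlaneAlgebra
  open MomentArithmetic
  open Classification

  private variable
    X : Set

  ∑-filter-𝟙 : {P Q : Pred X 0ℓ} (P? : Decidable P) (Q? : Decidable Q) (xs : List X) →
    ∑[ x ← filter P? xs ] 𝟙 (Q? x) ≡ ∑[ x ← xs ] 𝟙 (P? x ×-dec Q? x)
  ∑-filter-𝟙 P? Q? xs = trans (∑-filter P? xs _) (∑-cong xs λ x → sym (𝟙-× (P? x) (Q? x)))

  module LocalRingCounting {A : Set} (add mul : Op₂ A) (neg : Op₁ A) (zer one : A)
    (isCR : IsCommutativeRing _≡_ add mul neg zer one) where

    open PlaneGeometry add mul neg zer one isCR
    open CommutativeRing R using (0#; 1#; -_) renaming (_+_ to _⊞_; _*_ to _⊡_)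
    open import Algebra.Properties.Ring (CommutativeRing.ring R) using (+-cancelˡ; -‿injective)
    open Geometry R

    -- What the second moment estimate takes from ℤ/p^ℓ: a finite ring in which one of two elements
    -- with sum 1 is a unit, with at most `r` nonunits. The relation q = p r joins only for the
    -- higher moment.
    module _ (_≟_ : DecidableEquality A) (Unit? : Decidable Unit)
      (local : ∀ {x y} → x ⊞ y ≡ 1# → Unit x ⊎ Unit y)
      (elems : List A) (elems-unique : Unique elems) (elems-complete : ∀ x → x ∈ elems)
      (r : ℕ) (nonunits≤r : ∑[ x ← elems ] 𝟙 (¬? (Unit? x)) ≤ r) where

      private
        q : ℕ
        q = length elems

      _≟ₚ_ : DecidableEquality Point
      _≟ₚ_ = ≡-dec _≟_ _≟_

      points : List Point
      points = cartesianProduct elems elems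

      points-unique : Unique points
      points-unique = Unique.cartesianProduct⁺ elems-unique elems-unique

      points-complete : ∀ x → x ∈ points
      points-complete (x₁ , x₂) = ∈-cartesianProduct⁺ (elems-complete x₁) (elems-complete x₂)

      count-point : (f : Point → ℕ) → ∑ points f ≡ ∑[ x ← elems ] ∑[ y ← elems ] f (x , y)
      count-point = ∑-cartesianProduct elems elems

      count≤q : {P : Pred X 0ℓ} (P? : Decidable P) {xs : List X} → Unique xs → (φ : X → A) →
        (∀ {x y} → P x → P y → φ x ≡ φ y → x ≡ y) → ∑[ x ← xs ] 𝟙 (P? x) ≤ q
      count≤q P? uniq φ inj = ≤-trans
        (∑-injective P? (λ _ → yes tt) _≟_ uniq elems-complete φ (λ _ → tt) inj)
        (≤-reflexive (∑-1 elems))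

      Primitive : Pred Point 0ℓ
      Primitive x = Unit (proj₁ x) ⊎ Unit (proj₂ x)

      count-det : ∀ {x} e → Primitive x → ∑[ y ← points ] 𝟙 (det x y ≟ e) ≤ q
      count-det {x} e (inj₁ u) = count≤q (λ y → det x y ≟ e) points-unique proj₁
        λ p p′ → det-injective₂ u (trans p (sym p′))
      count-det {x} e (inj₂ u) = count≤q (λ y → det x y ≟ e) points-unique proj₂
        λ p p′ → det-injective₁ u (trans p (sym p′))

      -- As x₁ is a unit, y ↦ (y₁ , det x y) is injective, so the determinant may be treated as a
      -- free coordinate.
      count-nonunit-det : ∀ {x} → Unit (proj₁ x) →
        ∑[ y ← points ] 𝟙 (¬? (Unit? (det x y))) ≤ q * r
      count-nonunit-det {x} u = begin
        ∑[ y ← points ] 𝟙 (¬? (Unit? (det x y)))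
          ≤⟨ ∑-injective (λ y → ¬? (Unit? (det x y))) (λ z → ¬? (Unit? (proj₂ z))) _≟ₚ_
               points-unique points-complete (λ y → proj₁ y , det x y) (λ p → p)
               (λ _ _ eq → det-injective₂ u (proj₂ (,-injective eq)) (proj₁ (,-injective eq))) ⟩
        ∑[ z ← points ] 𝟙 (¬? (Unit? (proj₂ z)))   ≡⟨ count-point _ ⟩
        ∑ elems (λ _ → ∑[ d ← elems ] 𝟙 (¬? (Unit? d)))
          ≤⟨ ∑-≤const elems (λ _ _ → nonunits≤r) ⟩
        q * r ∎
        where open ≤-Reasoning

      SL₂ : List Matrix
      SL₂ = filter (λ (u , v) → det u v ≟ 1#) (cartesianProduct points points)

      SL₂-complete : ∀ {u v} → det u v ≡ 1# → (u , v) ∈ SL₂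
      SL₂-complete eq = ∈-filter⁺ _ (∈-cartesianProduct⁺ (points-complete _) (points-complete _)) eq

      SL₂-det : ∀ {u v} → (u , v) ∈ SL₂ → det u v ≡ 1#
      SL₂-det = proj₂ ∘ ∈-filter⁻ (λ (u , v) → det u v ≟ 1#) {xs = cartesianProduct points points}

      private
        matrices-unique : Unique (cartesianProduct points points)
        matrices-unique = Unique.cartesianProduct⁺ points-unique points-unique

      SL₂-unique : Unique SL₂
      SL₂-unique = Unique.filter⁺ _ matrices-unique

      length-points : length points ≡ q * q
      length-points = trans (sym (∑-1 points)) (trans (count-point _)
        (trans (∑-cong elems λ _ → ∑-1 elems) (∑-const elems q)))

      -- By locality, u₁ v₂ - u₂ v₁ = 1 makes an entry of the first row a unit. Each of the at most
      -- q² first rows then leaves at most q second rows.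
      length-SL₂ : length SL₂ ≤ q * q * q
      length-SL₂ = begin
        length SL₂
          ≡⟨ length-filter _ (cartesianProduct points points) ⟩
        ∑[ g ← cartesianProduct points points ] 𝟙 (det (proj₁ g) (proj₂ g) ≟ 1#)
          ≡⟨ ∑-cartesianProduct points points _ ⟩
        ∑[ u ← points ] ∑[ v ← points ] 𝟙 (det u v ≟ 1#)
          ≤⟨ ∑-≤const points (λ u _ → second-row u) ⟩
        length points * q  ≡⟨ cong (_* q) length-points ⟩
        q * q * q          ∎
        where
        open ≤-Reasoning
        is-primitive : ∀ {u v} → det u v ≡ 1# → Primitive u
        is-primitive eq = [ inj₁ ∘ unit-factor , inj₂ ∘ unit-factor ]′ (local eq)
        second-row : ∀ u → ∑[ v ← points ] 𝟙 (det u v ≟ 1#) ≤ q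
        second-row u with Unit? (proj₁ u) ⊎-dec Unit? (proj₂ u)
        ... | yes prim = count-det 1# prim
        ... | no ¬prim = ≤-trans (≤-reflexive (∑-zero points λ v _ → 𝟙-no (det u v ≟ 1#) (¬prim ∘ is-primitive {v = v}))) z≤n

      module _ {x y : Point} (ux : Unit (proj₁ x)) (uy : Unit (proj₁ y)) where
        open Transporter {x} {y} ux uy

        private
          transports? : (g : Matrix) → Dec (det (proj₁ g) (proj₂ g) ≡ 1# × act g x ≡ y)
          transports? g = (det (proj₁ g) (proj₂ g) ≟ 1#) ×-dec (act g x ≟ₚ y)

          as-filter : ∑[ g ← SL₂ ] 𝟙 (act g x ≟ₚ y) ≡ ∑[ g ← cartesianProduct points points ] 𝟙 (transports? g)
          as-filter = ∑-filter-𝟙 (λ g → det (proj₁ g) (proj₂ g) ≟ 1#) (λ g → act g x ≟ₚ y) (cartesianProduct points points)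

        count-transporter-≤ : ∑[ g ← SL₂ ] 𝟙 (act g x ≟ₚ y) ≤ q
        count-transporter-≤ = ≤-trans (≤-reflexive as-filter)
          (count≤q transports? matrices-unique (proj₂ ∘ proj₁) λ (d , e) (d′ , e′) → transporter-unique d e d′ e′)

        count-transporter-≥ : q ≤ ∑[ g ← SL₂ ] 𝟙 (act g x ≟ₚ y)
        count-transporter-≥ = ≤-trans (≤-reflexive (sym (∑-1 elems))) (≤-trans
          (∑-injective (λ _ → yes tt) transports? (≡-dec _≟ₚ_ _≟ₚ_) elems-unique
            (λ g → ∈-cartesianProduct⁺ (points-complete (proj₁ g)) (points-complete (proj₂ g))) transporter
            (λ {b} _ → det-transporter b , act-transporter b)
            (λ _ _ eq → proj₂ (,-injective (proj₁ (,-injective eq)))))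
          (≤-reflexive (sym as-filter)))

      -- A matrix is determined by the images of two points with unit determinant, and in SL₂ it
      -- preserves that determinant, so no matrix exists when the determinants differ.
      count-transporter₂ : ∀ {x x′} y y′ → Unit (det x x′) →
        ∑[ g ← SL₂ ] 𝟙 (act g x ≟ₚ y) * 𝟙 (act g x′ ≟ₚ y′) ≤ 𝟙 (det x x′ ≟ det y y′)
      count-transporter₂ {x} {x′} y y′ unit with det x x′ ≟ det y y′
      ... | yes _ = ≤-trans
        (≤-reflexive (∑-cong SL₂ λ g → sym (𝟙-× (act g x ≟ₚ y) (act g x′ ≟ₚ y′))))
        (∑-𝟙-unique (λ g → (act g x ≟ₚ y) ×-dec (act g x′ ≟ₚ y′)) SL₂-unique λ (e , e′) (f , f′) →
          cong₂ _,_
            (row-unique unit (proj₁ (,-injective (trans e (sym f)))) (proj₁ (,-injective (trans e′ (sym f′)))))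
            (row-unique unit (proj₂ (,-injective (trans e (sym f)))) (proj₂ (,-injective (trans e′ (sym f′))))))
      ... | no ¬eq = ≤-reflexive (∑-zero SL₂ λ g g∈ →
        trans (sym (𝟙-× (act g x ≟ₚ y) (act g x′ ≟ₚ y′)))
              (𝟙-no ((act g x ≟ₚ y) ×-dec (act g x′ ≟ₚ y′)) (λ { (refl , refl) → ¬eq (sym (det-act _ _ x x′ (SL₂-det g∈))) })))

      count-value : ∀ e → ∑[ d ← elems ] 𝟙 (e ≟ d) ≡ 1
      count-value e = ≤-antisym
        (∑-𝟙-unique (e ≟_) elems-unique (λ p p′ → trans (sym p) p′))
        (≤-trans (≤-reflexive (sym (𝟙-yes (e ≟ e) refl))) (term≤∑ elems (λ d → 𝟙 (e ≟ d)) (elems-complete e)))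

      ∑-value : ∀ e e′ → ∑[ d ← elems ] 𝟙 (e ≟ d) * 𝟙 (e′ ≟ d) ≡ 𝟙 (e ≟ e′)
      ∑-value e e′ = begin
        ∑[ d ← elems ] 𝟙 (e ≟ d) * 𝟙 (e′ ≟ d)    ≡⟨ ∑-cong elems at-e′ ⟩
        ∑[ d ← elems ] 𝟙 (e ≟ e′) * 𝟙 (e′ ≟ d)   ≡⟨ ∑-*ˡ elems (𝟙 (e ≟ e′)) (λ d → 𝟙 (e′ ≟ d)) ⟩
        𝟙 (e ≟ e′) * (∑[ d ← elems ] 𝟙 (e′ ≟ d))   ≡⟨ cong (𝟙 (e ≟ e′) *_) (count-value e′) ⟩
        𝟙 (e ≟ e′) * 1                           ≡⟨ *-identityʳ _ ⟩
        𝟙 (e ≟ e′)                               ∎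
        where
        open ≡-Reasoning
        at-e′ : ∀ d → 𝟙 (e ≟ d) * 𝟙 (e′ ≟ d) ≡ 𝟙 (e ≟ e′) * 𝟙 (e′ ≟ d)
        at-e′ d with e′ ≟ d
        ... | yes refl = refl
        ... | no  _    = trans (*-zeroʳ (𝟙 (e ≟ d))) (sym (*-zeroʳ (𝟙 (e ≟ e′))))

      multiplicity : List X → (X → A) → A → ℕ
      multiplicity xs φ d = ∑[ x ← xs ] 𝟙 (φ x ≟ d)

      ∑-multiplicity : (xs : List X) (φ : X → A) → ∑ elems (multiplicity xs φ) ≡ length xs
      ∑-multiplicity xs φ = trans (∑-swap elems xs _)
        (trans (∑-cong xs λ x → count-value (φ x)) (∑-1 xs))

      ∑-multiplicity² : (xs : List X) (φ : X → A) →
        ∑[ d ← elems ] multiplicity xs φ d * multiplicity xs φ d ≡ ∑[ x ← xs ] ∑[ y ← xs ] 𝟙 (φ x ≟ φ y)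
      ∑-multiplicity² xs φ = begin
        ∑[ d ← elems ] multiplicity xs φ d * multiplicity xs φ d
          ≡⟨ ∑-cong elems (λ d → ∑-prod xs xs _ _) ⟩
        ∑[ d ← elems ] ∑[ x ← xs ] ∑[ y ← xs ] 𝟙 (φ x ≟ d) * 𝟙 (φ y ≟ d)
          ≡⟨ ∑-swap elems xs _ ⟩
        ∑[ x ← xs ] ∑[ d ← elems ] ∑[ y ← xs ] 𝟙 (φ x ≟ d) * 𝟙 (φ y ≟ d)
          ≡⟨ ∑-cong xs (λ x → ∑-swap elems xs _) ⟩
        ∑[ x ← xs ] ∑[ y ← xs ] ∑[ d ← elems ] 𝟙 (φ x ≟ d) * 𝟙 (φ y ≟ d)
          ≡⟨ ∑-cong xs (λ x → ∑-cong xs λ y → ∑-value (φ x) (φ y)) ⟩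
        ∑[ x ← xs ] ∑[ y ← xs ] 𝟙 (φ x ≟ φ y) ∎
        where open ≡-Reasoning

      Primitive? : Decidable Primitive
      Primitive? x = Unit? (proj₁ x) ⊎-dec Unit? (proj₂ x)

      -- If y - z is primitive, x lies on the line det (y - z) x = 0, which has at most q points for
      -- given y and z. Otherwise y - z has a nonunit first coordinate, which leaves at most r
      -- choices of z for given x and y.
      same-det-bound : ∀ x y z → 𝟙 (Unit? (proj₁ x)) * 𝟙 (det x y ≟ det x z) ≤
        𝟙 (Primitive? (y ⊖ z)) * 𝟙 (det (y ⊖ z) x ≟ 0#)
        + 𝟙 (Unit? (proj₁ x)) * 𝟙 (¬? (Unit? (proj₁ (y ⊖ z))) ×-dec (det x y ≟ det x z))
      same-det-bound x y z = split (Unit? (proj₁ x)) (det x y ≟ det x z) (det (y ⊖ z) x ≟ 0#)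
        (Primitive? (y ⊖ z)) (Unit? (proj₁ (y ⊖ z))) (det-⊖ x y z) inj₁
        where
        split : {P Q S T V : Set} (P? : Dec P) (Q? : Dec Q) (S? : Dec S) (T? : Dec T) (V? : Dec V) →
          (Q → S) → (V → T) → 𝟙 P? * 𝟙 Q? ≤ 𝟙 T? * 𝟙 S? + 𝟙 P? * 𝟙 (¬? V? ×-dec Q?)
        split P? Q? S? (yes _) V? Q⇒S _ =
          ≤-trans (*-mono-≤ (𝟙≤1 P?) (𝟙-mono Q? S? Q⇒S)) (m≤m+n (1 * 𝟙 S?) _)
        split P? Q? S? (no ¬t) (yes v) _ V⇒T = contradiction (V⇒T v) ¬t
        split P? Q? S? (no ¬t) (no ¬v) _ _   =
          *-monoʳ-≤ (𝟙 P?) (𝟙-mono Q? (yes ¬v ×-dec Q?) (¬v ,_))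

      units : ℕ
      units = ∑[ x ← points ] 𝟙 (Unit? (proj₁ x))

      nonunit-points : ∑[ x ← points ] 𝟙 (¬? (Unit? (proj₁ x))) ≤ q * r
      nonunit-points = begin
        ∑[ x ← points ] 𝟙 (¬? (Unit? (proj₁ x)))                 ≡⟨ count-point _ ⟩
        ∑[ x ← elems ] ∑ elems (λ _ → 𝟙 (¬? (Unit? x)))          ≡⟨ ∑-cong elems (λ x → ∑-const elems _) ⟩
        ∑[ x ← elems ] q * 𝟙 (¬? (Unit? x))                      ≡⟨ ∑-*ˡ elems q _ ⟩
        q * (∑[ x ← elems ] 𝟙 (¬? (Unit? x)))                    ≤⟨ *-monoʳ-≤ q nonunits≤r ⟩
        q * r                                                    ∎
        where open ≤-Reasoning

      q*q≤units+q*r : q * q ≤ units + q * r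
      q*q≤units+q*r = begin
        q * q                                                      ≡⟨ trans (sym length-points) (sym (∑-1 points)) ⟩
        ∑ points (λ _ → 1)
          ≡⟨ ∑-cong points (λ x → sym (𝟙-split (Unit? (proj₁ x)) (¬? (Unit? (proj₁ x))))) ⟩
        ∑ points (λ x → 𝟙 (Unit? (proj₁ x)) + 𝟙 (¬? (Unit? (proj₁ x)))) ≡⟨ ∑-+ points _ _ ⟩
        units + (∑[ x ← points ] 𝟙 (¬? (Unit? (proj₁ x))))          ≤⟨ +-monoʳ-≤ units nonunit-points ⟩
        units + q * r                                              ∎
        where open ≤-Reasoning

      -- The value z₁ - y₁ fixes y₁, and the common determinant with x then fixes y; so these y
      -- inject into the nonunits.
      count-imprimitive : ∀ {x z} → Unit (proj₁ x) →
        ∑[ y ← points ] 𝟙 (¬? (Unit? (proj₁ (z ⊖ y))) ×-dec (det x z ≟ det x y)) ≤ r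
      count-imprimitive {x} {z} u = ≤-trans
        (∑-injective (λ y → ¬? (Unit? (proj₁ (z ⊖ y))) ×-dec (det x z ≟ det x y)) (λ d → ¬? (Unit? d)) _≟_
          points-unique elems-complete (λ y → proj₁ (z ⊖ y)) proj₁
          (λ (_ , e) (_ , e′) eq → det-injective₂ u (trans (sym e) e′) (-‿injective (+-cancelˡ (proj₁ z) _ _ eq))))
        nonunits≤r

      -- Second moment of the overlap, for a set of points with unit first coordinate.

      module _ {E : Pred Point 0ℓ} (E? : Decidable E) (E-unit : ∀ {x} → E x → Unit (proj₁ x)) where

        es : List Point
        es = filter E? points

        private
          a : ℕ
          a = length es

        es-unique : Unique es
        es-unique = Unique.filter⁺ _ points-unique

        es-unit : ∀ {x} → x ∈ es → Unit (proj₁ x)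
        es-unit x∈ = E-unit (proj₂ (∈-filter⁻ E? {xs = points} x∈))

        a≤q*q : a ≤ q * q
        a≤q*q = ≤-trans (length-filter-≤ E? points) (≤-reflexive length-points)

        hits : Matrix → Point → ℕ
        hits g x = ∑[ y ← es ] 𝟙 (act g x ≟ₚ y)

        -- The λ(g) of the overview; `hits g x` is 1 or 0 according as g x lies in the set or not.
        common : Matrix → ℕ
        common g = ∑ es (hits g)

        hits≤1 : ∀ g x → hits g x ≤ 1
        hits≤1 g x = ∑-𝟙-unique (act g x ≟ₚ_) es-unique (λ e e′ → trans (sym e) e′)

        common≤a : ∀ g → common g ≤ a
        common≤a g = ≤-trans (∑-≤const es λ x _ → hits≤1 g x) (≤-reflexive (*-identityʳ a))

        overlap-sum : a * (a * q) ≤ ∑ SL₂ common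
        overlap-sum = begin
          a * (a * q)
            ≤⟨ ∑-≥const es (λ x x∈ → ∑-≥const es λ y y∈ → count-transporter-≥ (es-unit x∈) (es-unit y∈)) ⟩
          ∑[ x ← es ] ∑[ y ← es ] ∑[ g ← SL₂ ] 𝟙 (act g x ≟ₚ y)
            ≡⟨ ∑-cong es (λ x → ∑-swap es SL₂ _) ⟩
          ∑[ x ← es ] ∑[ g ← SL₂ ] hits g x
            ≡⟨ ∑-swap es SL₂ _ ⟩
          ∑ SL₂ common ∎
          where open ≤-Reasoning

        onLine : Point → A → ℕ
        onLine x = multiplicity es (det x)

        pairs : A → ℕ
        pairs d = ∑[ x ← es ] onLine x d

        pairs² : ∑[ d ← elems ] pairs d * pairs d ≡
          ∑[ x ← es ] ∑[ x′ ← es ] ∑[ y ← es ] ∑[ y′ ← es ] 𝟙 (det x x′ ≟ det y y′)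
        pairs² = begin
          ∑[ d ← elems ] pairs d * pairs d
            ≡⟨ ∑-cong elems (λ d → cong₂ _*_ (flat d) (flat d)) ⟨
          ∑[ d ← elems ] multiplicity es² φ d * multiplicity es² φ d
            ≡⟨ ∑-multiplicity² es² φ ⟩
          ∑[ s ← es² ] ∑[ t ← es² ] 𝟙 (φ s ≟ φ t)
            ≡⟨ ∑-cong es² (λ s → ∑-cartesianProduct es es _) ⟩
          ∑[ s ← es² ] ∑[ y ← es ] ∑[ y′ ← es ] 𝟙 (φ s ≟ det y y′)
            ≡⟨ ∑-cartesianProduct es es _ ⟩
          ∑[ x ← es ] ∑[ x′ ← es ] ∑[ y ← es ] ∑[ y′ ← es ] 𝟙 (det x x′ ≟ det y y′) ∎
          where
          open ≡-Reasoning
          es² : List (Point × Point)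
          es² = cartesianProduct es es
          φ : Point × Point → A
          φ (x , y) = det x y
          flat : ∀ d → multiplicity es² φ d ≡ pairs d
          flat d = ∑-cartesianProduct es es _

        nonunit-pairs : ∑[ x ← es ] ∑[ x′ ← es ] 𝟙 (¬? (Unit? (det x x′))) ≤ a * (q * r)
        nonunit-pairs = ∑-≤const es λ x x∈ → ≤-trans (∑-filter-≤ E? points _) (count-nonunit-det (es-unit x∈))

        common² : ∑[ g ← SL₂ ] common g * common g ≤
                   (∑[ d ← elems ] pairs d * pairs d) + a * (q * r) * (a * q)
        common² = begin
          ∑[ g ← SL₂ ] common g * common g
            ≡⟨ ∑-cong SL₂ (λ g → ∑-prod es es _ _) ⟩
          ∑[ g ← SL₂ ] ∑[ x ← es ] ∑[ x′ ← es ] hits g x * hits g x′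
            ≡⟨ trans (∑-swap SL₂ es _) (∑-cong es λ x → ∑-swap SL₂ es _) ⟩
          ∑[ x ← es ] ∑[ x′ ← es ] ∑[ g ← SL₂ ] hits g x * hits g x′
            ≤⟨ ∑-mono es (λ x x∈ → ∑-mono es λ x′ x′∈ → pair x x∈ x′) ⟩
          ∑[ x ← es ] ∑[ x′ ← es ] (same x x′ + non x x′ * (a * q))
            ≡⟨ trans (∑-cong es λ x → ∑-+ es _ _) (∑-+ es _ _) ⟩
          (∑[ x ← es ] ∑[ x′ ← es ] same x x′) + (∑[ x ← es ] ∑[ x′ ← es ] non x x′ * (a * q))
            ≡⟨ cong₂ _+_ (sym pairs²) (trans (∑-cong es λ x → ∑-*ʳ es (a * q) _) (∑-*ʳ es (a * q) _)) ⟩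
          (∑[ d ← elems ] pairs d * pairs d) + (∑[ x ← es ] ∑[ x′ ← es ] non x x′) * (a * q)
            ≤⟨ +-monoʳ-≤ (∑[ d ← elems ] pairs d * pairs d) (*-monoˡ-≤ (a * q) nonunit-pairs) ⟩
          (∑[ d ← elems ] pairs d * pairs d) + a * (q * r) * (a * q) ∎
          where
          open ≤-Reasoning
          same non : Point → Point → ℕ
          same x x′ = ∑[ y ← es ] ∑[ y′ ← es ] 𝟙 (det x x′ ≟ det y y′)
          non x x′ = 𝟙 (¬? (Unit? (det x x′)))
          pair : ∀ x → x ∈ es → ∀ x′ → ∑[ g ← SL₂ ] hits g x * hits g x′ ≤ same x x′ + non x x′ * (a * q)
          pair x x∈ x′ with Unit? (det x x′)
          ... | yes u = ≤-trans (begin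
            ∑[ g ← SL₂ ] hits g x * hits g x′
              ≡⟨ ∑-cong SL₂ (λ g → ∑-prod es es _ _) ⟩
            ∑[ g ← SL₂ ] ∑[ y ← es ] ∑[ y′ ← es ] 𝟙 (act g x ≟ₚ y) * 𝟙 (act g x′ ≟ₚ y′)
              ≡⟨ trans (∑-swap SL₂ es _) (∑-cong es λ y → ∑-swap SL₂ es _) ⟩
            ∑[ y ← es ] ∑[ y′ ← es ] ∑[ g ← SL₂ ] 𝟙 (act g x ≟ₚ y) * 𝟙 (act g x′ ≟ₚ y′)
              ≤⟨ ∑-mono es (λ y _ → ∑-mono es λ y′ _ → count-transporter₂ y y′ u) ⟩
            same x x′ ∎) (m≤m+n _ _)
          -- Without a unit determinant the condition on x′ is dropped: at most a q matrices move x
          -- into the set.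
          ... | no _ = ≤-trans (begin
            ∑[ g ← SL₂ ] hits g x * hits g x′
              ≤⟨ ∑-mono SL₂ (λ g _ → *-monoʳ-≤ (hits g x) (hits≤1 g x′)) ⟩
            ∑[ g ← SL₂ ] hits g x * 1
              ≡⟨ ∑-cong SL₂ (λ g → *-identityʳ _) ⟩
            ∑[ g ← SL₂ ] ∑[ y ← es ] 𝟙 (act g x ≟ₚ y)
              ≡⟨ ∑-swap SL₂ es _ ⟩
            ∑[ y ← es ] ∑[ g ← SL₂ ] 𝟙 (act g x ≟ₚ y)
              ≤⟨ ∑-≤const es (λ y y∈ → count-transporter-≤ (es-unit x∈) (es-unit y∈)) ⟩
            a * q ≡⟨ *-identityˡ (a * q) ⟨
            1 * (a * q) ∎) (m≤n+m (1 * (a * q)) (same x x′))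

        -- Second moment of the set along the parallel lines det x y = d. It is at least a²/q, and
        -- close to that when the set is spread evenly over the lines.
        lineEnergy : Point → ℕ
        lineEnergy x = ∑[ d ← elems ] onLine x d * onLine x d

        pairs²≤lineEnergy : ∑[ d ← elems ] pairs d * pairs d ≤ a * ∑ es lineEnergy
        pairs²≤lineEnergy = begin
          ∑[ d ← elems ] pairs d * pairs d
            ≤⟨ ∑-mono elems (λ d _ → cauchy-schwarz es (λ x → onLine x d)) ⟩
          ∑[ d ← elems ] a * (∑[ x ← es ] onLine x d * onLine x d)
            ≡⟨ ∑-*ˡ elems a _ ⟩
          a * (∑[ d ← elems ] ∑[ x ← es ] onLine x d * onLine x d)
            ≡⟨ cong (a *_) (∑-swap elems es _) ⟩
          a * ∑ es lineEnergy ∎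
          where open ≤-Reasoning

        -- Letting x range over all points with unit first coordinate makes it a free variable:
        -- triples with y - z primitive are summed over x first, the remaining ones over z first.
        unit-lineEnergy : ∑[ x ← points ] 𝟙 (Unit? (proj₁ x)) * lineEnergy x ≤ a * (a * q) + q * q * (a * r)
        unit-lineEnergy = begin
          ∑[ x ← points ] 𝟙 (Unit? (proj₁ x)) * lineEnergy x
            ≡⟨ ∑-cong points (λ x → trans (cong (𝟙 (Unit? (proj₁ x)) *_) (∑-multiplicity² es (det x)))
                 (trans (sym (∑-*ˡ es (𝟙 (Unit? (proj₁ x))) _)) (∑-cong es λ y → sym (∑-*ˡ es (𝟙 (Unit? (proj₁ x))) _)))) ⟩
          ∑[ x ← points ] ∑[ y ← es ] ∑[ z ← es ] 𝟙 (Unit? (proj₁ x)) * 𝟙 (det x y ≟ det x z)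
            ≤⟨ ∑-mono points (λ x _ → ∑-mono es λ y _ → ∑-mono es λ z _ → same-det-bound x y z) ⟩
          ∑[ x ← points ] ∑[ y ← es ] ∑[ z ← es ] (prim x y z + imprim x y z)
            ≡⟨ trans (∑-cong points λ x → trans (∑-cong es λ y → ∑-+ es _ _) (∑-+ es _ _)) (∑-+ points _ _) ⟩
          (∑[ x ← points ] ∑[ y ← es ] ∑[ z ← es ] prim x y z) + (∑[ x ← points ] ∑[ y ← es ] ∑[ z ← es ] imprim x y z)
            ≤⟨ +-mono-≤ prim-sum imprim-sum ⟩
          a * (a * q) + q * q * (a * r) ∎
          where
          open ≤-Reasoning
          prim imprim : Point → Point → Point → ℕ
          prim x y z = 𝟙 (Primitive? (y ⊖ z)) * 𝟙 (det (y ⊖ z) x ≟ 0#)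
          imprim x y z = 𝟙 (Unit? (proj₁ x)) * 𝟙 (¬? (Unit? (proj₁ (y ⊖ z))) ×-dec (det x y ≟ det x z))

          prim-fibre : ∀ y z → ∑[ x ← points ] prim x y z ≤ q
          prim-fibre y z with Primitive? (y ⊖ z)
          ... | yes p = ≤-trans (≤-reflexive (∑-cong points λ x → *-identityˡ _)) (count-det 0# p)
          ... | no  _ = ≤-trans (≤-reflexive (∑-zero points λ x _ → refl)) z≤n

          prim-sum : ∑[ x ← points ] ∑[ y ← es ] ∑[ z ← es ] prim x y z ≤ a * (a * q)
          prim-sum = begin
            ∑[ x ← points ] ∑[ y ← es ] ∑[ z ← es ] prim x y z
              ≡⟨ trans (∑-swap points es _) (∑-cong es λ y → ∑-swap points es _) ⟩
            ∑[ y ← es ] ∑[ z ← es ] ∑[ x ← points ] prim x y z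
              ≤⟨ ∑-≤const es (λ y _ → ∑-≤const es λ z _ → prim-fibre y z) ⟩
            a * (a * q) ∎

          imprim-fibre : ∀ x y → ∑[ z ← es ] imprim x y z ≤ r
          imprim-fibre x y with Unit? (proj₁ x)
          ... | yes u = ≤-trans (∑-filter-≤ E? points _)
                  (≤-trans (≤-reflexive (∑-cong points λ z → *-identityˡ _)) (count-imprimitive {x} {y} u))
          ... | no  _ = ≤-trans (≤-reflexive (∑-zero es λ z _ → refl)) z≤n

          imprim-sum : ∑[ x ← points ] ∑[ y ← es ] ∑[ z ← es ] imprim x y z ≤ q * q * (a * r)
          imprim-sum = ≤-trans (∑-≤const points λ x _ → ∑-≤const es λ y _ → imprim-fibre x y)
            (≤-reflexive (cong (_* (a * r)) length-points))

        -- The sum of (q n - a)² ≥ 0 over the lines, n being the number of points of the set on the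
        -- line; these n add up to a.
        mean-lineEnergy : ∀ x → 2 * (q * a * a) ≤ q * q * lineEnergy x + q * (a * a)
        mean-lineEnergy x = begin
          2 * (q * a * a)
            ≡⟨ cong (λ k → 2 * (q * a * k)) (∑-multiplicity es (det x)) ⟨
          2 * (q * a * ∑ elems (onLine x))
            ≡⟨ trans (∑-*ˡ elems 2 _) (cong (2 *_) (∑-*ˡ elems (q * a) (onLine x))) ⟨
          ∑[ d ← elems ] 2 * (q * a * onLine x d)
            ≤⟨ ∑-mono elems (λ d _ → ≤-trans (≤-reflexive (cong (2 *_) (swap q a (onLine x d))))
                 (≤-trans (2ab≤a²+b² (q * onLine x d) a) (≤-reflexive (cong (_+ a * a) (square q (onLine x d)))))) ⟩
          ∑[ d ← elems ] (q * q * (onLine x d * onLine x d) + a * a)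
            ≡⟨ trans (∑-+ elems _ _) (cong₂ _+_ (∑-*ˡ elems (q * q) _) (∑-const elems (a * a))) ⟩
          q * q * lineEnergy x + q * (a * a) ∎
          where
          open ≤-Reasoning
          swap : ∀ q a n → q * a * n ≡ q * n * a
          swap = solve-∀
          square : ∀ q n → q * n * (q * n) ≡ q * q * (n * n)
          square = solve-∀

        -- The deviation q²·lineEnergy + q a² − 2 q a² is nonnegative at every point, so its sum over E
        -- is at most its sum over all points with invertible first coordinate.
        variance : q * q * ∑ es lineEnergy + a * (q * (a * a)) + units * (2 * (q * a * a)) ≤
          q * q * (a * (a * q) + q * q * (a * r)) + units * (q * (a * a)) + a * (2 * (q * a * a))
        variance = begin
          q * q * ∑ es lineEnergy + a * (q * (a * a)) + units * M
            ≡⟨ cong₂ (λ s t → s + t + units * M) (sym (∑-*ˡ es (q * q) lineEnergy)) (sym (∑-const es (q * (a * a)))) ⟩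
          (∑[ x ← es ] q * q * lineEnergy x) + ∑ es (λ _ → q * (a * a)) + units * M
            ≡⟨ cong₂ _+_ (sym (∑-+ es _ _)) (sym (∑-*ʳ points M _)) ⟩
          ∑ es V + (∑[ x ← points ] h x * M)
            ≡⟨ cong (_+ (∑[ x ← points ] h x * M)) (∑-filter E? points V) ⟩
          (∑[ x ← points ] f x * V x) + (∑[ x ← points ] h x * M)
            ≡⟨ ∑-+ points _ _ ⟨
          ∑[ x ← points ] (f x * V x + h x * M)
            ≤⟨ ∑-mono points (λ x _ → pointwise (E? x) (Unit? (proj₁ x)) E-unit (mean-lineEnergy x)) ⟩
          ∑[ x ← points ] (h x * V x + f x * M)
            ≡⟨ ∑-+ points _ _ ⟩
          (∑[ x ← points ] h x * V x) + (∑[ x ← points ] f x * M)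
            ≡⟨ cong₂ _+_ (∑-cong points λ x → distr (h x) (lineEnergy x)) (sym (∑-filter E? points (λ _ → M))) ⟩
          (∑[ x ← points ] (q * q * (h x * lineEnergy x) + h x * (q * (a * a)))) + ∑ es (λ _ → M)
            ≡⟨ cong₂ _+_ (trans (∑-+ points _ _) (cong₂ _+_ (∑-*ˡ points (q * q) _) (∑-*ʳ points (q * (a * a)) _))) (∑-const es M) ⟩
          q * q * (∑[ x ← points ] h x * lineEnergy x) + units * (q * (a * a)) + a * M
            ≤⟨ +-monoˡ-≤ (a * M) (+-monoˡ-≤ (units * (q * (a * a))) (*-monoʳ-≤ (q * q) unit-lineEnergy)) ⟩
          q * q * (a * (a * q) + q * q * (a * r)) + units * (q * (a * a)) + a * M ∎
          where
          open ≤-Reasoning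
          M : ℕ
          M = 2 * (q * a * a)
          f h V : Point → ℕ
          f x = 𝟙 (E? x)
          h x = 𝟙 (Unit? (proj₁ x))
          V x = q * q * lineEnergy x + q * (a * a)
          distr : ∀ h w → h * (q * q * w + q * (a * a)) ≡ q * q * (h * w) + h * (q * (a * a))
          distr h w = lemma h w q a
            where
            lemma : ∀ h w q a → h * (q * q * w + q * (a * a)) ≡ q * q * (h * w) + h * (q * (a * a))
            lemma = solve-∀
          pointwise : {P Q : Set} (P? : Dec P) (Q? : Dec Q) → (P → Q) → ∀ {v m} → m ≤ v →
            𝟙 P? * v + 𝟙 Q? * m ≤ 𝟙 Q? * v + 𝟙 P? * m
          pointwise (yes p) (yes q) _   _   = ≤-refl
          pointwise (yes p) (no ¬q) P⇒Q _   = contradiction (P⇒Q p) ¬q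
          pointwise (no _)  (no _)  _   _   = z≤n
          pointwise (no _)  (yes _) _   {v} {m} m≤v = begin
            1 * m       ≤⟨ *-monoʳ-≤ 1 m≤v ⟩
            1 * v       ≡⟨ +-identityʳ (1 * v) ⟨
            1 * v + 0   ∎

        private instance
          q-nonZero : NonZero q
          q-nonZero = ℕ.>-nonZero (≤-trans (term≤∑ elems (λ _ → 1) (elems-complete 0#)) (≤-reflexive (∑-1 elems)))

        private
          -- The part of the second moment carried by matrices with λ(g) ≥ 2 a²/q², a condition
          -- multiplied by q² to stay in ℕ.
          B : ℕ
          B = ∑[ g ← SL₂ ] 𝟙 (2 * (a * a) ≤? q * q * common g) * (common g * common g)

        common²-bound : q * (∑[ g ← SL₂ ] common g * common g) ≤ a * a * (a * a) + 3 * (a * a * (q * q * q * r))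
        common²-bound = second-moment-arithmetic q r a (∑ es lineEnergy) _
          (first-moment-arithmetic q r a units (∑ es lineEnergy) variance q*q≤units+q*r a≤q*q)
          (≤-trans common² (+-monoˡ-≤ _ pairs²≤lineEnergy))

        -- This is `excess` with L = q² λ(g) and M = a², summed over SL₂.
        large-common-bound : B ≤ 12 * (a * a * (q * q * r))
        large-common-bound = excess-arithmetic q r a B (∑ SL₂ common) _ (length SL₂) (begin
          q * q * (q * q) * B + 8 * (q * q * (a * a)) * ∑ SL₂ common
            ≡⟨ cong₂ _+_ (∑-*ˡ SL₂ (q * q * (q * q)) _) (∑-*ˡ SL₂ (8 * (q * q * (a * a))) common) ⟨
          (∑[ g ← SL₂ ] q * q * (q * q) * (bad g * (common g * common g))) + (∑[ g ← SL₂ ] 8 * (q * q * (a * a)) * common g)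
            ≡⟨ ∑-+ SL₂ _ _ ⟨
          ∑[ g ← SL₂ ] (q * q * (q * q) * (bad g * (common g * common g)) + 8 * (q * q * (a * a)) * common g)
            ≤⟨ ∑-mono SL₂ (λ g _ → pointwise g) ⟩
          ∑[ g ← SL₂ ] (4 * (q * q * (q * q)) * (common g * common g) + 4 * (a * a * (a * a)))
            ≡⟨ trans (∑-+ SL₂ _ _) (cong₂ _+_ (∑-*ˡ SL₂ (4 * (q * q * (q * q))) _) (∑-const SL₂ (4 * (a * a * (a * a))))) ⟩
          4 * (q * q * (q * q)) * (∑[ g ← SL₂ ] common g * common g) + length SL₂ * (4 * (a * a * (a * a))) ∎)
          overlap-sum common²-bound length-SL₂
          where
          open ≤-Reasoning
          bad : Matrix → ℕ
          bad g = 𝟙 (2 * (a * a) ≤? q * q * common g)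
          e₁ : ∀ Q b c M → Q * Q * (b * (c * c)) + 8 * (Q * M) * c ≡ b * (Q * c * (Q * c)) + 8 * (Q * c * M)
          e₁ = solve-∀
          e₂ : ∀ Q c M → 4 * (Q * c * (Q * c)) + 4 * (M * M) ≡ 4 * (Q * Q) * (c * c) + 4 * (M * M)
          e₂ = solve-∀
          pointwise : ∀ g → q * q * (q * q) * (bad g * (common g * common g)) + 8 * (q * q * (a * a)) * common g ≤
                            4 * (q * q * (q * q)) * (common g * common g) + 4 * (a * a * (a * a))
          pointwise g = begin
            q * q * (q * q) * (bad g * (common g * common g)) + 8 * (q * q * (a * a)) * common g
              ≡⟨ e₁ (q * q) (bad g) (common g) (a * a) ⟩
            bad g * (q * q * common g * (q * q * common g)) + 8 * (q * q * common g * (a * a))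
              ≤⟨ excess (q * q * common g) (a * a) (2 * (a * a) ≤? q * q * common g) ⟩
            4 * (q * q * common g * (q * q * common g)) + 4 * (a * a * (a * a))
              ≡⟨ e₂ (q * q) (common g) (a * a) ⟩
            4 * (q * q * (q * q)) * (common g * common g) + 4 * (a * a * (a * a)) ∎

        -- From the second moment to the power k + 1 and to the number of classes.

        module _ (p j : ℕ) (q≡p*r : q ≡ p * r) (dense : (q * q) ^ (2 ℕ.+ j) ≤ p * a ^ (2 ℕ.+ j)) where
          private
            m K : ℕ
            m = 2 ℕ.+ j
            K = 2 ^ m + 12

          moment-bound : (q * q) ^ m * (∑[ g ← SL₂ ] common g ^ m) ≤ K * (q * q * q) * (a ^ m * a ^ m)
          moment-bound = moment-arithmetic p q r a j B _ (length SL₂) q≡p*r dense (begin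
            (q * q) ^ m * (∑[ g ← SL₂ ] common g ^ m)
              ≡⟨ ∑-*ˡ SL₂ ((q * q) ^ m) _ ⟨
            ∑[ g ← SL₂ ] (q * q) ^ m * common g ^ m
              ≤⟨ ∑-mono SL₂ (λ g _ → power-split (q * q) (common g) a (a * a) j (common≤a g)
                   (2 * (a * a) ≤? q * q * common g)) ⟩
            ∑[ g ← SL₂ ] ((2 * (a * a)) ^ m + (q * q) ^ m * a ^ j *
                            (𝟙 (2 * (a * a) ≤? q * q * common g) * (common g * common g)))
              ≡⟨ trans (∑-+ SL₂ _ _) (cong₂ _+_ (∑-const SL₂ _) (∑-*ˡ SL₂ ((q * q) ^ m * a ^ j) _)) ⟩
            length SL₂ * (2 * (a * a)) ^ m + (q * q) ^ m * a ^ j * B ∎)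
            length-SL₂ large-common-bound
            where open ≤-Reasoning

          independent? : (s : Configuration m) → Dec (Unit (det (lookup s zero) (lookup s (suc zero))))
          independent? s = Unit? (det (lookup s zero) (lookup s (suc zero)))

          independents : List (Configuration m)
          independents = filter independent? (vectors es m)

          -- Each equivalent pair with unit first determinant is matched by its `basisChange`, hence
          -- counted by some matrix. Dropping independence afterwards only enlarges the sum and lets
          -- it factor into powers of λ(g).
          equivalent-independents : (_∼?_ : (s t : Configuration m) → Dec (s ∼ t)) →
            ∑[ s ← independents ] ∑[ t ← independents ] 𝟙 (s ∼? t) ≤ ∑[ g ← SL₂ ] common g ^ m
          equivalent-independents _∼?_ = begin
            ∑[ s ← independents ] ∑[ t ← independents ] 𝟙 (s ∼? t)
              ≤⟨ ∑-mono independents (λ s s∈ → ∑-mono independents λ t _ → moved s t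
                   (proj₂ (∈-filter⁻ independent? {xs = vectors es m} s∈))) ⟩
            ∑[ s ← independents ] ∑[ t ← independents ] ∑[ g ← SL₂ ] matches (w g) s t
              ≤⟨ ∑-mono independents (λ s _ → ∑-filter-≤ independent? (vectors es m) _) ⟩
            ∑[ s ← independents ] ∑[ t ← vectors es m ] ∑[ g ← SL₂ ] matches (w g) s t
              ≤⟨ ∑-filter-≤ independent? (vectors es m) _ ⟩
            ∑[ s ← vectors es m ] ∑[ t ← vectors es m ] ∑[ g ← SL₂ ] matches (w g) s t
              ≡⟨ trans (∑-cong (vectors es m) λ s → ∑-swap (vectors es m) SL₂ _) (∑-swap (vectors es m) SL₂ _) ⟩
            ∑[ g ← SL₂ ] ∑[ s ← vectors es m ] ∑[ t ← vectors es m ] matches (w g) s t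
              ≡⟨ ∑-cong SL₂ (λ g → ∑-matches es es (w g) m) ⟩
            ∑[ g ← SL₂ ] common g ^ m ∎
            where
            open ≤-Reasoning
            w : Matrix → Point → Point → ℕ
            w g x y = 𝟙 (act g x ≟ₚ y)
            moved : ∀ s t → Unit (det (lookup s zero) (lookup s (suc zero))) →
                    𝟙 (s ∼? t) ≤ ∑[ g ← SL₂ ] matches (w g) s t
            moved s t unit with s ∼? t
            ... | no _    = z≤n
            ... | yes s∼t = ≤-trans
              (≤-reflexive (sym (matches≡1 (w basisChange) s t λ i →
                𝟙-yes (act basisChange (lookup s i) ≟ₚ lookup t i)
                  -- The determinants of a point with the first two points already decide where the
                  -- matrix sends it.
                  (act-basisChange {lookup s i} {lookup t i} (s∼t zero i) (s∼t i (suc zero))))))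
              (term≤∑ SL₂ (λ g → matches (w g) s t) (SL₂-complete det-basisChange))
              where
              open ChangeOfBasis {lookup s zero} {lookup s (suc zero)} {lookup t zero} {lookup t (suc zero)}
                unit (s∼t zero (suc zero))

          -- At most a q r of the a² pairs have a nonunit determinant, and 2 q r ≤ a makes this at
          -- most half. The `a ^ m` added to both sides replaces a subtraction.
          many-independents : 2 * (q * r) ≤ a → a ^ m ≤ 2 * length independents
          many-independents 2qr≤a = +-cancelʳ-≤ (a ^ m) _ _ (begin
            a ^ m + a ^ m
              ≡⟨ cong (a ^ m +_) (+-identityʳ (a ^ m)) ⟨
            2 * a ^ m
              ≡⟨ cong (2 *_) (trans (sym (length-vectors es m)) (sym (∑-1 (vectors es m)))) ⟩
            2 * ∑ (vectors es m) (λ _ → 1)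
              ≡⟨ cong (2 *_) (∑-cong (vectors es m) λ s → 𝟙-split (independent? s) (¬? (independent? s))) ⟨
            2 * ∑ (vectors es m) (λ s → 𝟙 (independent? s) + 𝟙 (¬? (independent? s)))
              ≡⟨ cong (2 *_) (∑-+ (vectors es m) _ _) ⟩
            2 * ((∑[ s ← vectors es m ] 𝟙 (independent? s)) + (∑[ s ← vectors es m ] 𝟙 (¬? (independent? s))))
              ≡⟨ *-distribˡ-+ 2 (∑[ s ← vectors es m ] 𝟙 (independent? s)) _ ⟩
            2 * (∑[ s ← vectors es m ] 𝟙 (independent? s)) + 2 * (∑[ s ← vectors es m ] 𝟙 (¬? (independent? s)))
              ≡⟨ cong (λ n → 2 * n + 2 * (∑[ s ← vectors es m ] 𝟙 (¬? (independent? s))))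
                 (sym (length-filter independent? (vectors es m))) ⟩
            2 * length independents + 2 * (∑[ s ← vectors es m ] 𝟙 (¬? (independent? s)))
              ≤⟨ +-monoʳ-≤ (2 * length independents) dependents ⟩
            2 * length independents + a ^ m ∎)
            where
            open ≤-Reasoning
            rearrange : ∀ A q r y → 2 * (A * (q * r) * y) ≡ A * (2 * (q * r) * y)
            rearrange = solve-∀
            dependents : 2 * (∑[ s ← vectors es m ] 𝟙 (¬? (independent? s))) ≤ a ^ m
            dependents = begin
              2 * (∑[ s ← vectors es m ] 𝟙 (¬? (independent? s)))
                ≡⟨ cong (2 *_) (trans (∑-vectors es (suc j) _) (∑-cong es λ x → ∑-vectors es j _)) ⟩
              2 * (∑[ x ← es ] ∑[ y ← es ] ∑ (vectors es j) (λ _ → 𝟙 (¬? (Unit? (det x y)))))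
                ≡⟨ cong (2 *_) (trans (∑-cong es λ x → trans (∑-cong es λ y → trans (∑-const (vectors es j) _)
                     (trans (cong (_* _) (length-vectors es j)) (*-comm (a ^ j) _))) (∑-*ʳ es (a ^ j) _)) (∑-*ʳ es (a ^ j) _)) ⟩
              2 * ((∑[ x ← es ] ∑[ y ← es ] 𝟙 (¬? (Unit? (det x y)))) * a ^ j)
                ≤⟨ *-monoʳ-≤ 2 (*-monoˡ-≤ (a ^ j) nonunit-pairs) ⟩
              2 * (a * (q * r) * a ^ j)     ≡⟨ rearrange a q r (a ^ j) ⟩
              a * (2 * (q * r) * a ^ j)     ≤⟨ *-monoʳ-≤ a (*-monoˡ-≤ (a ^ j) 2qr≤a) ⟩
              a * (a * a ^ j)               ∎

          class-bound : 2 * (q * r) ≤ a → (_∼?_ : (s t : Configuration m) → Dec (s ∼ t)) →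
            {reps : List (Configuration m)} → AllPairs (λ s t → ¬ s ∼ t) reps →
            (∀ s → (∀ i → lookup s i ∈ es) → Any (s ∼_) reps) →
            (q * q) ^ m ≤ 4 * (K * (q * q * q)) * length reps
          class-bound 2qr≤a _∼?_ {reps} inequivalent covers = *-cancelˡ-≤ (a ^ m * a ^ m) {{m*n≢0 _ _ {{a^m≢0}} {{a^m≢0}}}}
            (count-arithmetic ((q * q) ^ m) (a ^ m) (length reps) (length independents) _ (K * (q * q * q))
              (many-independents 2qr≤a)
              (length²≤classes*pairs independents λ {s} s∈ → covers s
                (lookup-vectors m (proj₁ (∈-filter⁻ independent? {xs = vectors es m} s∈))))
              (≤-trans (*-monoʳ-≤ ((q * q) ^ m) (equivalent-independents _∼?_)) moment-bound))
            where
            open Classes {_~_ = _∼_} _∼?_ (λ s∼t i j → sym (s∼t i j)) (λ s∼t t∼u i j → trans (s∼t i j) (t∼u i j)) inequivalent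
            -- With `a ^ m` zero, `dense` would bound a positive power of q² by 0.
            a^m≢0 : NonZero (a ^ m)
            a^m≢0 = ℕ.≢-nonZero λ a^m≡0 → ℕ.≢-nonZero⁻¹ ((q * q) ^ m) {{m^n≢0 (q * q) m {{m*n≢0 q q}}}}
              (n≤0⇒n≡0 (≤-trans dense (≤-reflexive (trans (cong (p *_) a^m≡0) (*-zeroʳ p)))))

-- Residues modulo p^ℓ: reduction from ℤ, units and nonunits.

module ResidueRings where
  open import Algebra.Bundles using (CommutativeRing)
  open import Data.Fin.Base using (Fin; zero; suc; toℕ; fromℕ<)
  open import Data.Fin.Properties as Fin using (toℕ-fromℕ<; toℕ-injective; toℕ<n)
  open import Data.Integer.Base as ℤ using (ℤ)
  import Data.Integer.Divisibility.Signed as ℤ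
  import Data.Integer.Properties as ℤ
  open import Data.List.Base using (allFin)
  open import Data.List.Membership.Propositional.Properties using (∈-allFin)
  open import Data.List.Properties using (length-tabulate)
  open import Data.List.Relation.Unary.Unique.Propositional.Properties using (allFin⁺)
  open import Data.Nat.Base as ℕ using (ℕ; zero; suc; _≤_; _<_; NonZero)
  open import Data.Nat.Coprimality as Coprime using (Coprime; coprime-Bézout)
  open import Data.Nat.DivMod
  open import Data.Nat.Divisibility as ℕ using ()
  open import Data.Nat.GCD using (module Bézout)
  open import Data.Nat.Primality using (Prime; prime⇒nonZero; prime⇒nonTrivial; prime⇒irreducible)
  import Data.Nat.Properties as ℕ
  open import Data.Product.Base using (_×_; _,_)
  open import Data.Sum.Base using (_⊎_; inj₁; inj₂)
  open import Data.Unit.Base using (tt)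
  open import Relation.Binary.PropositionalEquality
  open import Relation.Nullary.Decidable using (yes; no; ¬?; map′)
  open import Relation.Nullary.Negation using (¬_; contradiction)
  open import Relation.Unary using (Decidable)
  open FiniteSums
  open IntegerCoefficients
  open PlaneAlgebra
  open Classification

  module Residues (n : ℕ) .{{_ : NonZero n}} where
    open CommutativeRing (ℤ/ n)
      using (Carrier; _+_; _*_; -_; 0#; 1#; isCommutativeRing; ring; +-group; +-comm; +-identityʳ; zeroʳ; *-comm; *-assoc) public
    open IntegerHomomorphism (ℤ/ n) using (fromℤ; fromℤ-+; fromℤ-*; fromℤ-neg) public
    open import Algebra.Properties.Group +-group using (x∙y⁻¹≈ε⇒x≈y; x≈y⇒x∙y⁻¹≈ε; ε⁻¹≈ε; ⁻¹-involutive; inverseʳ-unique)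
    open import Algebra.Properties.Ring ring using (-‿distribʳ-*)
    open import Algebra.Properties.Semiring.Mult (CommutativeRing.semiring (ℤ/ n)) using () renaming (_×_ to _·#_)
    open PlaneGeometry _+_ _*_ -_ 0# 1# isCommutativeRing public

    toℕ-mod : ∀ m → toℕ (m mod n) ≡ m % n
    toℕ-mod m = toℕ-fromℕ< (m%n<n m n)

    fromℕ≡mod : ∀ m → m ·# 1# ≡ m mod n
    fromℕ≡mod zero    = refl
    fromℕ≡mod (suc m) = trans (cong (1# +_) (fromℕ≡mod m)) (toℕ-injective (begin
      toℕ ((toℕ (1 mod n) ℕ.+ toℕ (m mod n)) mod n)   ≡⟨ toℕ-mod _ ⟩
      (toℕ (1 mod n) ℕ.+ toℕ (m mod n)) % n           ≡⟨ cong₂ (λ s t → (s ℕ.+ t) % n) (toℕ-mod 1) (toℕ-mod m) ⟩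
      (1 % n ℕ.+ m % n) % n                           ≡⟨ %-distribˡ-+ 1 m n ⟨
      suc m % n                                       ≡⟨ toℕ-mod (suc m) ⟨
      toℕ (suc m mod n)                               ∎))
      where open ≡-Reasoning

    lift : Carrier → ℤ
    lift x = ℤ.+ toℕ x

    fromℤ-lift : ∀ x → fromℤ (lift x) ≡ x
    fromℤ-lift x = trans (fromℕ≡mod (toℕ x)) (toℕ-injective (trans (toℕ-mod (toℕ x)) (m<n⇒m%n≡m (toℕ<n x))))

    fromℤ≡0⇒∣ : ∀ z → fromℤ z ≡ 0# → ℤ.+ n ℤ.∣ z
    fromℤ≡0⇒∣ (ℤ.+ m) eq = ℤ.∣ᵤ⇒∣ (ℕ.m%n≡0⇒n∣m m n (begin
      m % n          ≡⟨ toℕ-mod m ⟨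
      toℕ (m mod n)  ≡⟨ cong toℕ (trans (sym (fromℕ≡mod m)) eq) ⟩
      toℕ (0 mod n)  ≡⟨ toℕ-mod 0 ⟩
      0 % n          ≡⟨ m*n%n≡0 0 n ⟩
      0              ∎))
      where open ≡-Reasoning
    fromℤ≡0⇒∣ (ℤ.-[1+ m ]) eq = ℤ.∣m⇒∣-m (fromℤ≡0⇒∣ (ℤ.+ suc m)
      (trans (sym (⁻¹-involutive _)) (trans (cong -_ eq) ε⁻¹≈ε)))

    fromℤ-multiple : ∀ z → fromℤ (z ℤ.* ℤ.+ n) ≡ 0#
    fromℤ-multiple z = trans (fromℤ-* z (ℤ.+ n)) (trans (cong (fromℤ z *_) n≡0) (zeroʳ (fromℤ z)))
      where
      n≡0 : fromℤ (ℤ.+ n) ≡ 0#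
      n≡0 = trans (fromℕ≡mod n) (toℕ-injective (trans (toℕ-mod n) (trans (n%n≡0 n) (sym (trans (toℕ-mod 0) (m*n%n≡0 0 n))))))

    ∣⇒fromℤ≡0 : ∀ {z} → ℤ.+ n ℤ.∣ z → fromℤ z ≡ 0#
    ∣⇒fromℤ≡0 (ℤ.divides k refl) = fromℤ-multiple k

    fromℤ-sub : ∀ z w → fromℤ (z ℤ.- w) ≡ fromℤ z + - fromℤ w
    fromℤ-sub z w = trans (fromℤ-+ z (ℤ.- w)) (cong (_ +_) (fromℤ-neg w))

    fromℤ≡⇒∣ : ∀ z w → fromℤ z ≡ fromℤ w → ℤ.+ n ℤ.∣ z ℤ.- w
    fromℤ≡⇒∣ z w eq = fromℤ≡0⇒∣ (z ℤ.- w) (trans (fromℤ-sub z w) (x≈y⇒x∙y⁻¹≈ε eq))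

    ∣⇒fromℤ≡ : ∀ z w → ℤ.+ n ℤ.∣ z ℤ.- w → fromℤ z ≡ fromℤ w
    ∣⇒fromℤ≡ z w n∣ = x∙y⁻¹≈ε⇒x≈y _ _ (trans (sym (fromℤ-sub z w)) (∣⇒fromℤ≡0 n∣))

    -- Over ℕ the Bézout identity comes in two forms, according to which product is the larger by 1;
    -- in the second form the inverse is negated.
    coprime⇒unit : ∀ {x} → Coprime (toℕ x) n → Unit x
    coprime⇒unit {x} coprime with coprime-Bézout coprime
    ... | Bézout.+- u v eq = fromℤ (ℤ.+ u) , (begin
      x * fromℤ (ℤ.+ u)                        ≡⟨ cong (_* fromℤ (ℤ.+ u)) (fromℤ-lift x) ⟨
      fromℤ (lift x) * fromℤ (ℤ.+ u)           ≡⟨ fromℤ-* (lift x) (ℤ.+ u) ⟨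
      fromℤ (lift x ℤ.* ℤ.+ u)                 ≡⟨ cong fromℤ (trans (ℤ.*-comm (lift x) (ℤ.+ u)) (sym (ℤ.pos-* u (toℕ x)))) ⟩
      fromℤ (ℤ.+ (u ℕ.* toℕ x))                ≡⟨ cong (λ m → fromℤ (ℤ.+ m)) eq ⟨
      1# + fromℤ (ℤ.+ (v ℕ.* n))               ≡⟨ cong (1# +_) (trans (cong fromℤ (ℤ.pos-* v n)) (fromℤ-multiple (ℤ.+ v))) ⟩
      1# + 0#                                ≡⟨ +-identityʳ 1# ⟩
      1#                                     ∎)
      where open ≡-Reasoning
    ... | Bézout.-+ u v eq = - fromℤ (ℤ.+ u) , (begin
      x * - fromℤ (ℤ.+ u)                      ≡⟨ -‿distribʳ-* x _ ⟨
      - (x * fromℤ (ℤ.+ u))                    ≡⟨ cong (λ y → - (y * fromℤ (ℤ.+ u))) (fromℤ-lift x) ⟨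
      - (fromℤ (lift x) * fromℤ (ℤ.+ u))       ≡⟨ cong -_ (fromℤ-* (lift x) (ℤ.+ u)) ⟨
      - fromℤ (lift x ℤ.* ℤ.+ u)               ≡⟨ cong (λ z → - fromℤ z) (trans (ℤ.*-comm (lift x) (ℤ.+ u)) (sym (ℤ.pos-* u (toℕ x)))) ⟩
      - fromℤ (ℤ.+ (u ℕ.* toℕ x))              ≡⟨ cong -_ (inverseʳ-unique 1# _ (trans (cong (λ m → fromℤ (ℤ.+ m)) eq)
                                                  (trans (cong fromℤ (ℤ.pos-* v n)) (fromℤ-multiple (ℤ.+ v))))) ⟩
      - (- 1#)                               ≡⟨ ⁻¹-involutive 1# ⟩
      1#                                     ∎)
      where open ≡-Reasoning

  -- A common divisor of m and p^(k+1) is coprime to p, as otherwise p would divide m; so it divides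
  -- p^k and induction applies.
  prime-power-coprime : ∀ {p m} → Prime p → ¬ p ℕ.∣ m → ∀ k → Coprime m (p ℕ.^ k)
  prime-power-coprime {p} {m} p-prime p∤m zero    (d∣m , d∣1) = ℕ.∣1⇒≡1 d∣1
  prime-power-coprime {p} {m} p-prime p∤m (suc k) {d} (d∣m , d∣p^) = prime-power-coprime p-prime p∤m k
    (d∣m , Coprime.coprime-divisor d-coprime-p d∣p^)
    where
    d-coprime-p : Coprime d p
    d-coprime-p (e∣d , e∣p) with prime⇒irreducible p-prime e∣p
    ... | inj₁ e≡1  = e≡1
    ... | inj₂ refl = contradiction (ℕ.∣-trans e∣d d∣m) p∤m

  module PrimePower (p : ℕ) (p-prime : Prime p) (e : ℕ) where
    private instance
      p≢0 : NonZero p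
      p≢0 = prime⇒nonZero p-prime
      n≢0 : NonZero (p ℕ.^ suc e)
      n≢0 = ℕ.m^n≢0 p (suc e)

    private
      n r : ℕ
      n = p ℕ.^ suc e
      r = p ℕ.^ e

    open Residues n

    p∣n : p ℕ.∣ n
    p∣n = ℕ.m∣m*n r

    p∤1# : ¬ p ℕ.∣ toℕ 1#
    p∤1# p∣ = ℕ.nonTrivial⇒≢1 {{prime⇒nonTrivial p-prime}} (ℕ.∣1⇒≡1
      (ℕ.∣n∣m%n⇒∣m {m = 1} p∣n (subst (p ℕ.∣_) (toℕ-mod 1) p∣)))

    ∤⇒unit : ∀ {x} → ¬ p ℕ.∣ toℕ x → Unit x
    ∤⇒unit p∤x = coprime⇒unit (prime-power-coprime p-prime p∤x (suc e))

    unit⇒∤ : ∀ {x} → Unit x → ¬ p ℕ.∣ toℕ x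
    unit⇒∤ {x} (y , xy≡1) p∣x = p∤1# (subst (λ z → p ℕ.∣ toℕ z) xy≡1
      (subst (p ℕ.∣_) (sym (toℕ-mod (toℕ x ℕ.* toℕ y))) (ℕ.%-presˡ-∣ (ℕ.∣m⇒∣m*n (toℕ y) p∣x) p∣n)))

    Unit? : Decidable Unit
    Unit? x = map′ ∤⇒unit unit⇒∤ (¬? (p ℕ.∣? toℕ x))

    local : ∀ {x y} → x + y ≡ 1# → Unit x ⊎ Unit y
    local {x} {y} x+y≡1 with p ℕ.∣? toℕ x | p ℕ.∣? toℕ y
    ... | no p∤x  | _       = inj₁ (∤⇒unit p∤x)
    ... | yes _   | no p∤y  = inj₂ (∤⇒unit p∤y)
    ... | yes p∣x | yes p∣y = contradiction (subst (λ z → p ℕ.∣ toℕ z) x+y≡1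
      (subst (p ℕ.∣_) (sym (toℕ-mod (toℕ x ℕ.+ toℕ y))) (ℕ.%-presˡ-∣ (ℕ.∣m∣n⇒∣m+n p∣x p∣y) p∣n))) p∤1#

    -- Nonunits are the multiples of p below p r, and division by p sends them injectively below r.
    nonunits≤r : ∑[ x ← allFin n ] 𝟙 (¬? (Unit? x)) ≤ r
    nonunits≤r = ℕ.≤-trans
      (∑-injective (λ x → ¬? (Unit? x)) (λ _ → yes tt) Fin._≟_ (allFin⁺ n) ∈-allFin
        quot (λ _ → tt) quot-injective)
      (ℕ.≤-reflexive (trans (∑-1 (allFin r)) (length-tabulate (λ x → x))))
      where
      quot<r : ∀ x → toℕ x / p < r
      quot<r x = m<n*o⇒m/o<n (subst (toℕ x <_) (ℕ.*-comm p r) (toℕ<n x))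
      quot : Fin n → Fin r
      quot x = fromℕ< (quot<r x)
      p∣nonunit : ∀ {x} → ¬ Unit x → p ℕ.∣ toℕ x
      p∣nonunit {x} ¬u with p ℕ.∣? toℕ x
      ... | yes p∣x = p∣x
      ... | no p∤x  = contradiction (∤⇒unit p∤x) ¬u
      quot-injective : ∀ {x y} → ¬ Unit x → ¬ Unit y → quot x ≡ quot y → x ≡ y
      quot-injective {x} {y} ¬ux ¬uy eq = toℕ-injective (begin
        toℕ x                 ≡⟨ m/n*n≡m (p∣nonunit ¬ux) ⟨
        toℕ x / p ℕ.* p       ≡⟨ cong (ℕ._* p) (trans (sym (toℕ-fromℕ< (quot<r x))) (trans (cong toℕ eq) (toℕ-fromℕ< (quot<r y)))) ⟩
        toℕ y / p ℕ.* p       ≡⟨ m/n*n≡m (p∣nonunit ¬uy) ⟩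
        toℕ y                 ∎)
        where open ≡-Reasoning

-- Upper bound for the number of classes by encoding.

module UpperBound where
  open import Data.Fin.Base using (Fin; zero; suc; punchIn; punchOut)
  open import Data.Fin.Properties as Fin using (all?; ¬∀⟶∃¬; punchIn-punchOut)
  open import Data.Integer.Base as ℤ using (ℤ)
  import Data.Integer.Coprimality as ℤ
  import Data.Integer.Divisibility.Signed as ℤ
  import Data.Integer.Properties as ℤ
  open import Data.Integer.Tactic.RingSolver using () renaming (solve-∀ to solve-∀ᶻ)
  open import Data.List.Base using (List; allFin; length; cartesianProduct)
  open import Data.List.Membership.Propositional using (_∈_)
  open import Data.List.Membership.Propositional.Properties using (∈-allFin; ∈-cartesianProduct⁺)
  open import Data.List.Properties using (length-tabulate)
  open import Data.List.Relation.Unary.AllPairs using (AllPairs)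
  open import Data.Nat.Base as ℕ using (ℕ; zero; suc; _≤_; NonZero)
  open import Data.Nat.Divisibility as ℕ using ()
  open import Data.Nat.Primality using (Prime; prime⇒nonZero)
  import Data.Nat.Properties as ℕ
  open import Data.Product.Base using (_×_; _,_; proj₁; proj₂; Σ-syntax)
  open import Data.Product.Properties using (≡-dec; ,-injective)
  open import Data.Sum.Base using (_⊎_; inj₁; inj₂)
  open import Data.Vec.Base as Vec using (Vec; lookup; tabulate)
  open import Data.Vec.Properties as Vec using (lookup∘tabulate)
  open import Relation.Binary.PropositionalEquality
  open import Relation.Nullary.Decidable using (Dec; yes; no)
  open import Relation.Nullary.Negation using (¬_)
  open FiniteSums
  open IntegerCoefficients
  open PlaneAlgebra
  open Classification
  open ResidueRings

  module ClassCount (p : ℕ) (p-prime : Prime p) (e : ℕ) where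
    private instance
      p≢0 : NonZero p
      p≢0 = prime⇒nonZero p-prime
      n≢0 : NonZero (p ℕ.^ suc e)
      n≢0 = ℕ.m^n≢0 p (suc e)

    private
      ℓ n : ℕ
      ℓ = suc e
      n = p ℕ.^ ℓ

    open Residues n
    open Geometry (ℤ/ n)

    _≡ₙ_ : ℤ → ℤ → Set
    z ≡ₙ w = ℤ.+ n ℤ.∣ z ℤ.- w

    module _ {m : ℕ} where

      -- Determinants are lifted to ℤ because relations among them must be divided by powers of p,
      -- which cannot be cancelled modulo p^ℓ.
      minor : Configuration m → Fin m → Fin m → ℤ
      minor s i j = lift (proj₁ (lookup s i)) ℤ.* lift (proj₂ (lookup s j))
                    ℤ.- lift (proj₂ (lookup s i)) ℤ.* lift (proj₁ (lookup s j))

      fromℤ-minor : ∀ s i j → fromℤ (minor s i j) ≡ lookup s i · lookup s j ^⊥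
      fromℤ-minor s i j = begin
        fromℤ (x₁ ℤ.* y₂ ℤ.- x₂ ℤ.* y₁)
          ≡⟨ cong (λ z → fromℤ (x₁ ℤ.* y₂ ℤ.+ z)) (ℤ.neg-distribʳ-* x₂ y₁) ⟩
        fromℤ (x₁ ℤ.* y₂ ℤ.+ x₂ ℤ.* ℤ.- y₁)
          ≡⟨ trans (fromℤ-+ (x₁ ℤ.* y₂) _) (cong₂ _+_ (fromℤ-* x₁ y₂) (fromℤ-* x₂ _)) ⟩
        fromℤ x₁ * fromℤ y₂ + fromℤ x₂ * fromℤ (ℤ.- y₁)
          ≡⟨ cong₂ _+_ (cong₂ _*_ (fromℤ-lift (proj₁ (lookup s i))) (fromℤ-lift (proj₂ (lookup s j))))
                       (cong₂ _*_ (fromℤ-lift (proj₂ (lookup s i))) (trans (fromℤ-neg y₁) (cong -_ (fromℤ-lift (proj₁ (lookup s j)))))) ⟩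
        lookup s i · lookup s j ^⊥ ∎
        where
        open ≡-Reasoning
        x₁ = lift (proj₁ (lookup s i)) ; x₂ = lift (proj₂ (lookup s i))
        y₁ = lift (proj₁ (lookup s j)) ; y₂ = lift (proj₂ (lookup s j))

      minor-self : ∀ s i → minor s i i ≡ ℤ.0ℤ
      minor-self s i = cancel (lift (proj₁ (lookup s i))) (lift (proj₂ (lookup s i)))
        where
        cancel : ∀ x y → x ℤ.* y ℤ.- y ℤ.* x ≡ ℤ.0ℤ
        cancel = solve-∀ᶻ

      minor-swap : ∀ s i j → minor s i j ≡ ℤ.- minor s j i
      minor-swap s i j = swap
        (lift (proj₁ (lookup s i))) (lift (proj₂ (lookup s i))) (lift (proj₁ (lookup s j))) (lift (proj₂ (lookup s j)))
        where
        swap : ∀ x₁ x₂ y₁ y₂ → x₁ ℤ.* y₂ ℤ.- x₂ ℤ.* y₁ ≡ ℤ.- (y₁ ℤ.* x₂ ℤ.- y₂ ℤ.* x₁)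
        swap = solve-∀ᶻ

      plücker : ∀ s a b i j → minor s a b ℤ.* minor s i j ≡
        minor s a i ℤ.* minor s b j ℤ.- minor s a j ℤ.* minor s b i
      plücker s a b i j = identity
        (lift (proj₁ (lookup s a))) (lift (proj₂ (lookup s a))) (lift (proj₁ (lookup s b))) (lift (proj₂ (lookup s b)))
        (lift (proj₁ (lookup s i))) (lift (proj₂ (lookup s i))) (lift (proj₁ (lookup s j))) (lift (proj₂ (lookup s j)))
        where
        identity : ∀ a₁ a₂ b₁ b₂ i₁ i₂ j₁ j₂ →
          (a₁ ℤ.* b₂ ℤ.- a₂ ℤ.* b₁) ℤ.* (i₁ ℤ.* j₂ ℤ.- i₂ ℤ.* j₁) ≡
          (a₁ ℤ.* i₂ ℤ.- a₂ ℤ.* i₁) ℤ.* (b₁ ℤ.* j₂ ℤ.- b₂ ℤ.* j₁) ℤ.-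
          (a₁ ℤ.* j₂ ℤ.- a₂ ℤ.* j₁) ℤ.* (b₁ ℤ.* i₂ ℤ.- b₂ ℤ.* i₁)
        identity = solve-∀ᶻ

      -- The capped valuation min(ℓ, v_p) of the minors is least at (a , b).
      record Minimal (s : Configuration m) (a b : Fin m) : Set where
        field
          v        : ℕ
          v≤ℓ      : v ≤ ℓ
          divides  : ∀ i j → ℤ.+ (p ℕ.^ v) ℤ.∣ minor s i j
          attained : v ≡ ℓ ⊎ ¬ ℤ.+ (p ℕ.^ suc v) ℤ.∣ minor s a b

      ∣-respects : ∀ {z w k} → k ≤ ℓ → z ≡ₙ w → ℤ.+ (p ℕ.^ k) ℤ.∣ z → ℤ.+ (p ℕ.^ k) ℤ.∣ w
      ∣-respects {z} {w} {k} k≤ℓ z≡w ∣z = subst (ℤ.+ (p ℕ.^ k) ℤ.∣_) (cancel z w)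
        (ℤ.∣m∣n⇒∣m-n ∣z (ℤ.∣-trans (ℤ.∣ᵤ⇒∣ (^-monoʳ-∣ p k≤ℓ)) z≡w))
        where
        cancel : ∀ z w → z ℤ.- (z ℤ.- w) ≡ w
        cancel = solve-∀ᶻ

      -- The residue of the minor at (a , b) determines the capped valuation: were v′ < v, the power
      -- p^(v′+1) would divide this minor of s and, modulo p^ℓ, that of t.
      v≤v′ : ∀ {s t a b} (M : Minimal s a b) (N : Minimal t a b) →
        minor s a b ≡ₙ minor t a b → Minimal.v M ≤ Minimal.v N
      v≤v′ {a = a} {b} M N s≡t with Minimal.attained N
      ... | inj₁ v′≡ℓ = ℕ.≤-trans (Minimal.v≤ℓ M) (ℕ.≤-reflexive (sym v′≡ℓ))
      ... | inj₂ ∤ = ℕ.≮⇒≥ λ v′<v → ∤ (∣-respects (ℕ.≤-trans v′<v (Minimal.v≤ℓ M)) s≡t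
        (ℤ.∣-trans (ℤ.∣ᵤ⇒∣ (^-monoʳ-∣ p v′<v)) (Minimal.divides M a b)))

      -- Both valuations are v; the minors are E P and F P with P = p^v, and p^ℓ = Q P. The
      -- hypotheses become congruences modulo Q for rows a and b of E and F. The Plücker relation,
      -- an exact identity in ℤ, loses nothing when P² is cancelled, and E a b is coprime to p
      -- unless Q = 1; so E i j ≡ F i j modulo Q, and multiplying by P restores the modulus p^ℓ.
      minors-agree : ∀ {s t a b} → Minimal s a b → Minimal t a b →
        (∀ i → minor s a i ≡ₙ minor t a i) → (∀ i → minor s b i ≡ₙ minor t b i) →
        ∀ i j → minor s i j ≡ₙ minor t i j
      minors-agree {s} {t} {a} {b} M N sa≡ta sb≡tb i j = restore i j (coprime-part (attained (Minimal.attained M)))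
        where
        v k : ℕ
        v = Minimal.v M
        k = ℓ ℕ.∸ v
        P Q : ℤ
        P = ℤ.+ (p ℕ.^ v)
        Q = ℤ.+ (p ℕ.^ k)
        instance
          P≢0 : NonZero (p ℕ.^ v)
          P≢0 = ℕ.m^n≢0 p v
        v≡ : Minimal.v N ≡ v
        v≡ = ℕ.≤-antisym
          (v≤v′ N M (subst (ℤ.+ n ℤ.∣_) (anti (minor s a b) (minor t a b)) (ℤ.∣m⇒∣-m (sa≡ta b)))) (v≤v′ M N (sa≡ta b))
          where
          anti : ∀ z w → ℤ.- (z ℤ.- w) ≡ w ℤ.- z
          anti = solve-∀ᶻ
        n≡QP : ℤ.+ n ≡ Q ℤ.* P
        n≡QP = trans (cong ℤ.+_ (trans (cong (p ℕ.^_)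
          (sym (ℕ.m∸n+n≡m (Minimal.v≤ℓ M)))) (ℕ.^-distribˡ-+-* p k v))) (ℤ.pos-* (p ℕ.^ k) (p ℕ.^ v))

        E F : Fin m → Fin m → ℤ
        E x y = ℤ._∣_.quotient (Minimal.divides M x y)
        F x y = ℤ._∣_.quotient (Minimal.divides N x y)
        E-eq : ∀ x y → minor s x y ≡ E x y ℤ.* P
        E-eq x y = ℤ._∣_.equality (Minimal.divides M x y)
        F-eq : ∀ x y → minor t x y ≡ F x y ℤ.* P
        F-eq x y = trans (ℤ._∣_.equality (Minimal.divides N x y)) (cong (λ u → F x y ℤ.* ℤ.+ (p ℕ.^ u)) v≡)

        factor : ∀ x y → minor s x y ℤ.- minor t x y ≡ (E x y ℤ.- F x y) ℤ.* P
        factor x y = trans (cong₂ ℤ._-_ (E-eq x y) (F-eq x y)) (distr (E x y) (F x y) P)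
          where
          distr : ∀ x y z → x ℤ.* z ℤ.- y ℤ.* z ≡ (x ℤ.- y) ℤ.* z
          distr = solve-∀ᶻ

        reduce : ∀ x y → minor s x y ≡ₙ minor t x y → Q ℤ.∣ E x y ℤ.- F x y
        reduce x y h = ℤ.*-cancelʳ-∣ P (subst₂ ℤ._∣_ n≡QP (factor x y) h)

        restore : ∀ x y → Q ℤ.∣ E x y ℤ.- F x y → minor s x y ≡ₙ minor t x y
        restore x y h = subst₂ ℤ._∣_ (sym n≡QP) (sym (factor x y)) (ℤ.*-monoˡ-∣ P h)

        plücker′ : (s : Configuration m) (G : Fin m → Fin m → ℤ) → (∀ x y → minor s x y ≡ G x y ℤ.* P) →
          G a b ℤ.* G i j ≡ G a i ℤ.* G b j ℤ.- G a j ℤ.* G b i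
        plücker′ s G G-eq = ℤ.*-cancelʳ-≡ _ _ P (ℤ.*-cancelʳ-≡ _ _ P (begin
          G a b ℤ.* G i j ℤ.* P ℤ.* P                       ≡⟨ e₁ (G a b) (G i j) P ⟩
          G a b ℤ.* P ℤ.* (G i j ℤ.* P)                     ≡⟨ cong₂ ℤ._*_ (G-eq a b) (G-eq i j) ⟨
          minor s a b ℤ.* minor s i j                       ≡⟨ plücker s a b i j ⟩
          minor s a i ℤ.* minor s b j ℤ.- minor s a j ℤ.* minor s b i
            ≡⟨ cong₂ ℤ._-_ (cong₂ ℤ._*_ (G-eq a i) (G-eq b j)) (cong₂ ℤ._*_ (G-eq a j) (G-eq b i)) ⟩
          G a i ℤ.* P ℤ.* (G b j ℤ.* P) ℤ.- G a j ℤ.* P ℤ.* (G b i ℤ.* P)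
            ≡⟨ e₂ (G a i) (G b j) (G a j) (G b i) P ⟩
          (G a i ℤ.* G b j ℤ.- G a j ℤ.* G b i) ℤ.* P ℤ.* P ∎))
          where
          open ≡-Reasoning
          e₁ : ∀ x y P → x ℤ.* y ℤ.* P ℤ.* P ≡ x ℤ.* P ℤ.* (y ℤ.* P)
          e₁ = solve-∀ᶻ
          e₂ : ∀ x y z w P → x ℤ.* P ℤ.* (y ℤ.* P) ℤ.- z ℤ.* P ℤ.* (w ℤ.* P) ≡ (x ℤ.* y ℤ.- z ℤ.* w) ℤ.* P ℤ.* P
          e₂ = solve-∀ᶻ

        -- Both Plücker relations are subtracted and each product is telescoped, so that every term
        -- contains a difference from row a or b.
        difference : E a b ℤ.* (E i j ℤ.- F i j) ≡
          (E a i ℤ.- F a i) ℤ.* E b j ℤ.+ F a i ℤ.* (E b j ℤ.- F b j)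
          ℤ.- ((E a j ℤ.- F a j) ℤ.* E b i ℤ.+ F a j ℤ.* (E b i ℤ.- F b i))
          ℤ.- (E a b ℤ.- F a b) ℤ.* F i j
        difference = begin
          E a b ℤ.* (E i j ℤ.- F i j)
            ≡⟨ e₁ (E a b) (E i j) (F a b) (F i j) ⟩
          E a b ℤ.* E i j ℤ.- F a b ℤ.* F i j ℤ.- (E a b ℤ.- F a b) ℤ.* F i j
            ≡⟨ cong₂ (λ x y → x ℤ.- y ℤ.- (E a b ℤ.- F a b) ℤ.* F i j) (plücker′ s E E-eq) (plücker′ t F F-eq) ⟩
          E a i ℤ.* E b j ℤ.- E a j ℤ.* E b i ℤ.- (F a i ℤ.* F b j ℤ.- F a j ℤ.* F b i) ℤ.- (E a b ℤ.- F a b) ℤ.* F i j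
            ≡⟨ e₂ (E a i) (E b j) (E a j) (E b i) (F a i) (F b j) (F a j) (F b i) ((E a b ℤ.- F a b) ℤ.* F i j) ⟩
          _ ∎
          where
          open ≡-Reasoning
          e₁ : ∀ x y z w → x ℤ.* (y ℤ.- w) ≡ x ℤ.* y ℤ.- z ℤ.* w ℤ.- (x ℤ.- z) ℤ.* w
          e₁ = solve-∀ᶻ
          e₂ : ∀ ai bj aj bi ai′ bj′ aj′ bi′ c →
            ai ℤ.* bj ℤ.- aj ℤ.* bi ℤ.- (ai′ ℤ.* bj′ ℤ.- aj′ ℤ.* bi′) ℤ.- c ≡
            (ai ℤ.- ai′) ℤ.* bj ℤ.+ ai′ ℤ.* (bj ℤ.- bj′)
            ℤ.- ((aj ℤ.- aj′) ℤ.* bi ℤ.+ aj′ ℤ.* (bi ℤ.- bi′)) ℤ.- c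
          e₂ = solve-∀ᶻ

        product∣ : Q ℤ.∣ E a b ℤ.* (E i j ℤ.- F i j)
        product∣ = subst (Q ℤ.∣_) (sym difference) (ℤ.∣m∣n⇒∣m-n (ℤ.∣m∣n⇒∣m-n
          (ℤ.∣m∣n⇒∣m+n (ℤ.∣m⇒∣m*n (E b j) (reduce a i (sa≡ta i))) (ℤ.∣n⇒∣m*n (F a i) (reduce b j (sb≡tb j))))
          (ℤ.∣m∣n⇒∣m+n (ℤ.∣m⇒∣m*n (E b i) (reduce a j (sa≡ta j))) (ℤ.∣n⇒∣m*n (F a j) (reduce b i (sb≡tb i)))))
          (ℤ.∣m⇒∣m*n (F i j) (reduce a b (sa≡ta b))))

        attained : v ≡ ℓ ⊎ ¬ ℤ.+ (p ℕ.^ suc v) ℤ.∣ minor s a b → k ≡ 0 ⊎ ¬ p ℕ.∣ ℤ.∣ E a b ∣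
        attained (inj₁ v≡ℓ) = inj₁ (ℕ.m≤n⇒m∸n≡0 (ℕ.≤-reflexive (sym v≡ℓ)))
        attained (inj₂ ∤)   = inj₂ λ p∣ → ∤ (subst₂ ℤ._∣_ (sym (ℤ.pos-* p (p ℕ.^ v))) (sym (E-eq a b))
          (ℤ.*-monoˡ-∣ P (ℤ.∣ᵤ⇒∣ {ℤ.+ p} {E a b} p∣)))

        coprime-part : k ≡ 0 ⊎ ¬ p ℕ.∣ ℤ.∣ E a b ∣ → Q ℤ.∣ E i j ℤ.- F i j
        -- The valuation has reached the cap ℓ, so Q = 1.
        coprime-part (inj₁ k≡0) = ℤ.∣ᵤ⇒∣ (subst (λ k → p ℕ.^ k ℕ.∣ ℤ.∣ E i j ℤ.- F i j ∣) (sym k≡0) (ℕ.1∣ _))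
        coprime-part (inj₂ p∤)  = ℤ.∣ᵤ⇒∣ (ℤ.coprime-divisor Q (E a b) (E i j ℤ.- F i j)
          (ℤ.sym {E a b} {Q} (prime-power-coprime p-prime p∤ k)) (ℤ.∣⇒∣ᵤ product∣))

    module _ {m : ℕ} where

      -- Storing the second index through `punchIn a` makes it differ from `a` by construction.
      MinimalPair : Configuration (suc (suc m)) → Set
      MinimalPair s = Σ[ a ∈ Fin (suc (suc m)) ] Σ[ b ∈ Fin (suc m) ] Minimal s a (punchIn a b)

      -- The exponent v grows while p^(v+1) divides all minors, `fuel` being ℓ - v. A minor that
      -- stops the search is off the diagonal, since diagonal minors vanish.
      minimalPair : ∀ s → MinimalPair s
      minimalPair s = search ℓ 0 refl λ i j → ℤ.∣ᵤ⇒∣ (ℕ.1∣ _)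
        where
        search : ∀ fuel v → v ℕ.+ fuel ≡ ℓ → (∀ i j → ℤ.+ (p ℕ.^ v) ℤ.∣ minor s i j) → MinimalPair s
        -- At v = ℓ every pair is minimal; the default `zero , zero` stands for the indices 0 and 1.
        search zero v v≡ℓ ∣all = zero , zero , record
          { v = v ; v≤ℓ = ℕ.m+n≤o⇒m≤o v (ℕ.≤-reflexive v≡ℓ) ; divides = ∣all
          ; attained = inj₁ (trans (sym (ℕ.+-identityʳ v)) v≡ℓ) }
        search (suc fuel) v v≡ℓ ∣all with all? (λ i → all? (λ j → ℤ.+ (p ℕ.^ suc v) ℤ.∣? minor s i j))
        ... | yes ∣all′ = search fuel (suc v) (trans (sym (ℕ.+-suc v fuel)) v≡ℓ) ∣all′
        ... | no ¬∣all with ¬∀⟶∃¬ _ _ (λ i → all? (λ j → ℤ.+ (p ℕ.^ suc v) ℤ.∣? minor s i j)) ¬∣all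
        ...   | a , ¬∣row with ¬∀⟶∃¬ _ _ (λ j → ℤ.+ (p ℕ.^ suc v) ℤ.∣? minor s a j) ¬∣row
        ...     | b , ∤ = a , punchOut a≢b , record
          { v = v ; v≤ℓ = ℕ.m+n≤o⇒m≤o v (ℕ.≤-reflexive v≡ℓ) ; divides = ∣all
          ; attained = inj₂ (subst (λ b → ¬ ℤ.+ (p ℕ.^ suc v) ℤ.∣ minor s a b) (sym (punchIn-punchOut a≢b)) ∤) }
          where
          a≢b : a ≢ b
          a≢b refl = ∤ (subst (ℤ.+ (p ℕ.^ suc v) ℤ.∣_) (sym (minor-self s a)) (ℤ.divides ℤ.0ℤ refl))

      -- Here `m` is k - 1, the number of indices other than a and b. The code holds the pair, its
      -- determinant, and the determinants of a and of b with the remaining points: 1 + 2m = 2k - 1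
      -- residues.
      Code : Set
      Code = Fin (suc (suc m)) × Fin (suc m) × Fin n × Vec (Fin n) m × Vec (Fin n) m

      codes : List Code
      codes = cartesianProduct (allFin (suc (suc m))) (cartesianProduct (allFin (suc m))
        (cartesianProduct (allFin n) (cartesianProduct (vectors (allFin n) m) (vectors (allFin n) m))))

      codes-complete : ∀ c → c ∈ codes
      codes-complete (a , b , d , u , w) = ∈-cartesianProduct⁺ (∈-allFin a) (∈-cartesianProduct⁺ (∈-allFin b)
        (∈-cartesianProduct⁺ (∈-allFin d) (∈-cartesianProduct⁺ (vectors-complete ∈-allFin u) (vectors-complete ∈-allFin w))))

      length-codes : length codes ≡ suc (suc m) ℕ.* (suc m ℕ.* (n ℕ.* (n ℕ.^ m ℕ.* n ℕ.^ m)))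
      length-codes = trans (length-cartesianProduct (allFin (suc (suc m))) c₁) (cong₂ ℕ._*_ (allFin-length (suc (suc m)))
        (trans (length-cartesianProduct (allFin (suc m)) c₂) (cong₂ ℕ._*_ (allFin-length (suc m))
        (trans (length-cartesianProduct (allFin n) c₃) (cong₂ ℕ._*_ (allFin-length n)
        (trans (length-cartesianProduct (vectors (allFin n) m) _) (cong₂ ℕ._*_ vectors-length vectors-length)))))))
        where
        c₃ = cartesianProduct (vectors (allFin n) m) (vectors (allFin n) m)
        c₂ = cartesianProduct (allFin n) c₃
        c₁ = cartesianProduct (allFin (suc m)) c₂
        allFin-length : ∀ k → length (allFin k) ≡ k
        allFin-length k = length-tabulate (λ x → x)
        vectors-length : length (vectors (allFin n) m) ≡ n ℕ.^ m
        vectors-length = trans (length-vectors (allFin n) m) (cong (ℕ._^ m) (allFin-length n))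

      _≟ᶜ_ : (c d : Code) → Dec (c ≡ d)
      _≟ᶜ_ = ≡-dec Fin._≟_ (≡-dec Fin._≟_ (≡-dec Fin._≟_ (≡-dec (Vec.≡-dec Fin._≟_) (Vec.≡-dec Fin._≟_))))

      private
        δ : Configuration (suc (suc m)) → Fin (suc (suc m)) → Fin (suc (suc m)) → Fin n
        δ s i j = lookup s i · lookup s j ^⊥

      encode : ∀ s → MinimalPair s → Code
      encode s (a , b , _) = a , b , δ s a (punchIn a b)
        , tabulate (λ i → δ s a (punchIn a (punchIn b i))) , tabulate (λ i → δ s (punchIn a b) (punchIn a (punchIn b i)))

      tabulate-injective : ∀ {A : Set} {k} {f g : Fin k → A} → tabulate f ≡ tabulate g → ∀ i → f i ≡ g i
      tabulate-injective {f = f} {g} eq i =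
        trans (sym (lookup∘tabulate f i)) (trans (cong (λ u → lookup u i) eq) (lookup∘tabulate g i))

      -- Equal codes make both tuples minimal at the same pair and equate rows a and b of their
      -- minors, the entries within the pair by vanishing on the diagonal and antisymmetry.
      encode-injective : ∀ s t (M : MinimalPair s) (N : MinimalPair t) → encode s M ≡ encode t N → s ∼ t
      encode-injective s t (a , b′ , M) (_ , _ , N) eq
        with refl , eq₁ ← ,-injective eq
        with refl , eq₂ ← ,-injective eq₁
        with ab , eq₃ ← ,-injective eq₂
        with ai , bi ← ,-injective eq₃ = λ i j → begin
          lookup s i · lookup s j ^⊥   ≡⟨ fromℤ-minor s i j ⟨
          fromℤ (minor s i j)          ≡⟨ ∣⇒fromℤ≡ (minor s i j) (minor t i j) (minors-agree M N with-a with-b i j) ⟩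
          fromℤ (minor t i j)          ≡⟨ fromℤ-minor t i j ⟩
          lookup t i · lookup t j ^⊥   ∎
        where
        open ≡-Reasoning
        b : Fin (suc (suc m))
        b = punchIn a b′
        toMinor : ∀ i j → δ s i j ≡ δ t i j → minor s i j ≡ₙ minor t i j
        toMinor i j h = fromℤ≡⇒∣ (minor s i j) (minor t i j) (trans (fromℤ-minor s i j) (trans h (sym (fromℤ-minor t i j))))
        self : ∀ i → minor s i i ≡ₙ minor t i i
        self i = subst₂ _≡ₙ_ (sym (minor-self s i)) (sym (minor-self t i)) (ℤ.divides ℤ.0ℤ refl)
        flip : ∀ i j → minor s i j ≡ₙ minor t i j → minor s j i ≡ₙ minor t j i
        flip i j h = subst₂ _≡ₙ_ (sym (minor-swap s j i)) (sym (minor-swap t j i))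
          (subst (ℤ.+ n ℤ.∣_) (neg (minor s i j) (minor t i j)) (ℤ.∣m⇒∣-m h))
          where
          neg : ∀ z w → ℤ.- (z ℤ.- w) ≡ ℤ.- z ℤ.- ℤ.- w
          neg = solve-∀ᶻ
        cases : (P : Fin (suc (suc m)) → Set) → P a → P b → (∀ i → P (punchIn a (punchIn b′ i))) → ∀ i → P i
        cases P Pa Pb Pi i with a Fin.≟ i
        ... | yes refl = Pa
        ... | no a≢i with b′ Fin.≟ punchOut a≢i
        ...   | yes b′≡ = subst P (trans (cong (punchIn a) b′≡) (punchIn-punchOut a≢i)) Pb
        ...   | no b′≢  = subst P (trans (cong (punchIn a) (punchIn-punchOut b′≢)) (punchIn-punchOut a≢i)) (Pi (punchOut b′≢))
        with-a : ∀ i → minor s a i ≡ₙ minor t a i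
        with-a = cases (λ i → minor s a i ≡ₙ minor t a i) (self a) (toMinor a b ab) λ i → toMinor a (punchIn a (punchIn b′ i))
          (tabulate-injective ai i)
        with-b : ∀ i → minor s b i ≡ₙ minor t b i
        with-b = cases (λ i → minor s b i ≡ₙ minor t b i) (flip a b (toMinor a b ab)) (self b)
          λ i → toMinor b (punchIn a (punchIn b′ i)) (tabulate-injective bi i)

      classes-bound : (_∼?_ : (s t : Configuration (suc (suc m))) → Dec (s ∼ t)) →
        {reps : List (Configuration (suc (suc m)))} → AllPairs (λ s t → ¬ s ∼ t) reps →
        length reps ≤ suc (suc m) ℕ.* (suc m ℕ.* (n ℕ.* (n ℕ.^ m ℕ.* n ℕ.^ m)))
      classes-bound _∼?_ inequivalent = ℕ.≤-trans
        (Classes.classes≤codes {_~_ = _∼_} _∼?_ (λ s∼t i j → sym (s∼t i j)) (λ s∼t t∼u i j → trans (s∼t i j) (t∼u i j))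
          inequivalent _≟ᶜ_ codes-complete (λ s → encode s (minimalPair s))
          (λ {s} {t} → encode-injective s t (minimalPair s) (minimalPair t)))
        (ℕ.≤-reflexive length-codes)

-- Unwinding the density hypothesis and joining the two bounds.

module Assembly where
  open import Algebra.Bundles using (CommutativeRing)
  open import Data.Fin.Base using (zero; suc)
  open import Data.Fin.Properties as Fin using ()
  open import Data.Integer.Base as ℤ using (+_)
  open import Data.List.Base using (List; length; allFin)
  open import Data.List.Membership.Propositional using (_∈_; lose)
  open import Data.List.Membership.Propositional.Properties using (∈-allFin; ∈-cartesianProductWith⁺; ∈-filter⁺; ∈-filter⁻)
  open import Data.List.Properties using (length-tabulate)
  open import Data.List.Relation.Unary.AllPairs using (AllPairs)
  open import Data.List.Relation.Unary.Any using (Any; here)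
  open import Data.List.Relation.Unary.Any.Properties using (deduplicate⁺)
  import Data.List.Relation.Unary.Unique.DecSetoid.Properties as DecSetoid
  open import Data.List.Relation.Unary.Unique.Propositional.Properties using (allFin⁺)
  open import Data.Nat.Base using (ℕ; zero; suc; _+_; _*_; _^_; _≤_; NonZero; z≤n; s≤s)
  open import Data.Nat.Divisibility using (_∣_)
  open import Data.Nat.Primality using (Prime; prime⇒nonZero)
  open import Data.Nat.Properties
  open import Data.Nat.Tactic.RingSolver using (solve-∀)
  open import Data.Product.Base using (_×_; _,_; proj₁; proj₂)
  open import Data.Vec.Base as Vec using (Vec; []; _∷_; lookup)
  open import Level using (0ℓ)
  open import Relation.Binary.Bundles using (DecSetoid)
  open import Relation.Binary.PropositionalEquality
  open import Relation.Nullary.Decidable using (Dec; _×-dec_; ¬?; yes; no)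
  open import Relation.Nullary.Negation using (¬_)
  open import Relation.Unary using (Pred; Decidable)
  open import Relation.Unary.Properties using (U?)
  open FiniteSums
  open IntegerCoefficients
  open PlaneAlgebra
  open MomentArithmetic
  open Classification
  open SpecialLinearCounting
  open ResidueRings
  open UpperBound

  ^-cancelʳ-≤ : ∀ M {a b} .{{_ : NonZero M}} → b ^ M ≤ a ^ M → b ≤ a
  ^-cancelʳ-≤ M h = ≮⇒≥ λ a<b → <⇒≱ (^-monoˡ-< M a<b) h

  -- The `M`-th root undoes the common denominator in the hypothesis. Since y + 1 = 2 ℓ m, one more
  -- factor `p` completes p^y to (q²)^m with q = p^ℓ: the term -1/(ℓ(k+1)) of s becomes the `p` on
  -- the right.
  density-arithmetic : ∀ p N m M y ℓ .{{_ : NonZero ℓ}} .{{_ : NonZero M}} → M ≡ ℓ * m → suc y ≡ 2 * M →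
    4 ^ (m * M) * ℓ ^ (2 * M) * p ^ (ℓ * y * m) ≤ N ^ (m * M) →
    4 ^ m * (p ^ ℓ * p ^ ℓ) ^ m ≤ p * N ^ m
  density-arithmetic p N m M y ℓ M≡ y≡ h = begin
    4 ^ m * (p ^ ℓ * p ^ ℓ) ^ m   ≡⟨ cong (4 ^ m *_) power ⟩
    4 ^ m * (p * p ^ y)           ≡⟨ swap (4 ^ m) p (p ^ y) ⟩
    p * (4 ^ m * p ^ y)           ≤⟨ *-monoʳ-≤ p (^-cancelʳ-≤ M root) ⟩
    p * N ^ m                     ∎
    where
    open ≤-Reasoning
    swap : ∀ a b c → a * (b * c) ≡ b * (a * c)
    swap = solve-∀
    exponent : ∀ ℓ m y → ℓ * y * m ≡ y * (ℓ * m)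
    exponent = solve-∀
    double : ∀ ℓ m → (ℓ + ℓ) * m ≡ 2 * (ℓ * m)
    double = solve-∀
    power : (p ^ ℓ * p ^ ℓ) ^ m ≡ p * p ^ y
    power = trans (cong (_^ m) (sym (^-distribˡ-+-* p ℓ ℓ)))
      (trans (^-*-assoc p (ℓ + ℓ) m) (cong (p ^_) (trans (double ℓ m) (trans (cong (2 *_) (sym M≡)) (sym y≡)))))
    instance
      ℓ^≢0 : NonZero (ℓ ^ (2 * M))
      ℓ^≢0 = m^n≢0 ℓ (2 * M)
    root : (4 ^ m * p ^ y) ^ M ≤ (N ^ m) ^ M
    root = begin
      (4 ^ m * p ^ y) ^ M
        ≡⟨ ^-*-distrib (4 ^ m) (p ^ y) M ⟩
      (4 ^ m) ^ M * (p ^ y) ^ M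
        ≡⟨ cong₂ _*_ (^-*-assoc 4 m M) (trans (^-*-assoc p y M) (cong (p ^_) (trans (cong (y *_) M≡) (sym (exponent ℓ m y))))) ⟩
      4 ^ (m * M) * p ^ (ℓ * y * m)
        ≤⟨ *-monoˡ-≤ (p ^ (ℓ * y * m)) (m≤m*n (4 ^ (m * M)) (ℓ ^ (2 * M))) ⟩
      4 ^ (m * M) * ℓ ^ (2 * M) * p ^ (ℓ * y * m)
        ≤⟨ h ⟩
      N ^ (m * M)
        ≡⟨ ^-*-assoc N m M ⟨
      (N ^ m) ^ M ∎

  module _ (p q r a N j : ℕ) .{{_ : NonZero p}} (q≡p*r : q ≡ p * r) (N≤ : N ≤ a + q * r)
    (dense : 4 ^ (2 + j) * (q * q) ^ (2 + j) ≤ p * N ^ (2 + j)) where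
    private
      m : ℕ
      m = 2 + j
    open ≤-Reasoning

    -- From p ≤ p^m one gets (4 q²)^m ≤ (p N)^m; the `m`-th root and q = p r do the rest. The 4
    -- leaves at least 3 q r points after discarding q r, enough for both `2qr≤a` and `N≤2a`.
    4qr≤N : 4 * (q * r) ≤ N
    4qr≤N = *-cancelˡ-≤ p (begin
      p * (4 * (q * r))   ≡⟨ rearrange p q r ⟩
      4 * (q * (p * r))   ≡⟨ cong (λ t → 4 * (q * t)) q≡p*r ⟨
      4 * (q * q)         ≤⟨ ^-cancelʳ-≤ m powers ⟩
      p * N               ∎)
      where
      rearrange : ∀ p q r → p * (4 * (q * r)) ≡ 4 * (q * (p * r))
      rearrange = solve-∀
      powers : (4 * (q * q)) ^ m ≤ (p * N) ^ m
      powers = begin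
        (4 * (q * q)) ^ m       ≡⟨ ^-*-distrib 4 (q * q) m ⟩
        4 ^ m * (q * q) ^ m     ≤⟨ dense ⟩
        p * N ^ m               ≤⟨ *-monoˡ-≤ (N ^ m) (m≤m*n p (p ^ suc j) {{m^n≢0 p (suc j)}}) ⟩
        p ^ m * N ^ m           ≡⟨ ^-*-distrib p N m ⟨
        (p * N) ^ m             ∎

    2qr≤a : 2 * (q * r) ≤ a
    2qr≤a = ≤-trans (m≤n+m (2 * (q * r)) (q * r)) (+-cancelʳ-≤ (q * r) _ _ (begin
      q * r + 2 * (q * r) + q * r   ≡⟨ four (q * r) ⟩
      4 * (q * r)                   ≤⟨ ≤-trans 4qr≤N N≤ ⟩
      a + q * r                     ∎))
      where
      four : ∀ x → x + 2 * x + x ≡ 4 * x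
      four = solve-∀

    N≤2a : N ≤ 2 * a
    N≤2a = ≤-trans N≤ (begin
      a + q * r   ≤⟨ +-monoʳ-≤ a (≤-trans (m≤m+n (q * r) _) 2qr≤a) ⟩
      a + a       ≡⟨ cong (_+_ a) (+-identityʳ a) ⟨
      2 * a       ∎)

    -- In 4^m = 2^m · 2^m one factor pays for passing from `N` to `a`.
    dense-units : (q * q) ^ m ≤ p * a ^ m
    dense-units = ≤-trans (m≤n*m _ (2 ^ m) {{m^n≢0 2 m}}) (*-cancelˡ-≤ (2 ^ m) {{m^n≢0 2 m}} (begin
      2 ^ m * (2 ^ m * (q * q) ^ m)   ≡⟨ *-assoc (2 ^ m) (2 ^ m) _ ⟨
      2 ^ m * 2 ^ m * (q * q) ^ m     ≡⟨ cong (_* (q * q) ^ m) (^-*-distrib 2 2 m) ⟨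
      4 ^ m * (q * q) ^ m             ≤⟨ dense ⟩
      p * N ^ m                       ≤⟨ *-monoʳ-≤ p (^-monoˡ-≤ m N≤2a) ⟩
      p * (2 * a) ^ m                 ≡⟨ cong (p *_) (^-*-distrib 2 a m) ⟩
      p * (2 ^ m * a ^ m)             ≡⟨ swap p (2 ^ m) (a ^ m) ⟩
      2 ^ m * (p * a ^ m)             ∎))
      where
      swap : ∀ a b c → a * (b * c) ≡ b * (a * c)
      swap = solve-∀

  -- Both bounds have the same order: (q²)^(2+j) divided by q³ is q · q^j · q^j, the number of
  -- residue strings in a code.
  conclusion-arithmetic : ∀ q j K u w .{{_ : NonZero q}} →
    u ≤ (2 + j) * (suc j * (q * (q ^ j * q ^ j))) → (q * q) ^ (2 + j) ≤ 4 * (K * (q * q * q)) * w →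
    u ≤ (2 + j) * (suc j * (4 * K)) * w
  conclusion-arithmetic q j K u w h₁ h₂ = begin
    u                                             ≤⟨ h₁ ⟩
    (2 + j) * (suc j * (q * (q ^ j * q ^ j)))     ≤⟨ *-monoʳ-≤ (2 + j) (*-monoʳ-≤ (suc j) cancelled) ⟩
    (2 + j) * (suc j * (4 * K * w))               ≡⟨ assoc (2 + j) (suc j) (4 * K) w ⟩
    (2 + j) * (suc j * (4 * K)) * w               ∎
    where
    open ≤-Reasoning
    instance
      q³≢0 : NonZero (q * q * q)
      q³≢0 = m*n≢0 (q * q) q {{m*n≢0 q q}}
    assoc : ∀ a b c d → a * (b * (c * d)) ≡ a * (b * c) * d
    assoc = solve-∀
    e₁ : ∀ q x → q * q * q * (q * (x * x)) ≡ q * q * (q * q * (x * x))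
    e₁ = solve-∀
    e₂ : ∀ q K w → 4 * (K * (q * q * q)) * w ≡ q * q * q * (4 * K * w)
    e₂ = solve-∀
    cancelled : q * (q ^ j * q ^ j) ≤ 4 * K * w
    cancelled = *-cancelˡ-≤ (q * q * q) (begin
      q * q * q * (q * (q ^ j * q ^ j))       ≡⟨ e₁ q (q ^ j) ⟩
      q * q * (q * q * (q ^ j * q ^ j))       ≡⟨ cong (λ x → q * q * (q * q * x)) (^-*-distrib q q j) ⟨
      (q * q) ^ (2 + j)                       ≤⟨ h₂ ⟩
      4 * (K * (q * q * q)) * w               ≡⟨ e₂ q K w ⟩
      q * q * q * (4 * K * w)                 ∎)

  module _ (n : ℕ) .{{_ : NonZero n}} where
    open Plane n

    tuples-complete : {A : Set} {xs : List A} → ∀ {m} (s : Vec A m) → (∀ i → lookup s i ∈ xs) → s ∈ tuples xs m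
    tuples-complete []      h = here refl
    tuples-complete (x ∷ s) h = ∈-cartesianProductWith⁺ _∷_ (h zero) (tuples-complete s λ i → h (suc i))

    ∼-decSetoid : ℕ → DecSetoid 0ℓ 0ℓ
    ∼-decSetoid m = record
      { Carrier = Configuration m ; _≈_ = _∼_
      ; isDecEquivalence = record
        { isEquivalence = record
          { refl = λ i j → refl ; sym = λ s∼t i j → sym (s∼t i j) ; trans = λ s∼t t∼u i j → trans (s∼t i j) (t∼u i j) }
        ; _≟_ = _∼?_ } }

    𝒞-inequivalent : ∀ m {E : Pred Point 0ℓ} (E? : Decidable E) → AllPairs (λ s t → ¬ s ∼ t) (𝒞 m E?)
    𝒞-inequivalent m E? = DecSetoid.deduplicate-! (∼-decSetoid m) (tuples (elements E?) m)

    𝒞-covers : ∀ {m} {E : Pred Point 0ℓ} (E? : Decidable E) (s : Configuration m) →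
      (∀ i → lookup s i ∈ elements E?) → Any (s ∼_) (𝒞 m E?)
    𝒞-covers {m} E? s h = deduplicate⁺ _∼?_ (λ t∼u s∼t i j → trans (s∼t i j) (sym (t∼u i j)))
      (lose (tuples-complete s h) (λ i j → refl))

  module Density (p : ℕ) (p-prime : Prime p) (e j : ℕ) where
    private
      n r m : ℕ
      n = p ^ suc e
      r = p ^ e
      m = 2 + j
      instance
        p≢0 : NonZero p
        p≢0 = prime⇒nonZero p-prime
        n≢0 : NonZero n
        n≢0 = m^n≢0 p (suc e)

    open Plane n
    open Residues n using (Unit)
    open PrimePower p p-prime e using (Unit?; local; nonunits≤r)
    private
      module F = CommutativeRing (ℤ/ n)
      module Counting = LocalRingCounting F._+_ F._*_ F.-_ F.0# F.1# F.isCommutativeRing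

      length≡n : length (allFin n) ≡ n
      length≡n = length-tabulate (λ x → x)

    module _ {E : Pred Point 0ℓ} (E? : Decidable E)
      (dense : 4 ^ m * (n * n) ^ m ≤ p * ∣ E? ∣ ^ m) where

      E′ : Pred Point 0ℓ
      E′ x = E x × Unit (proj₁ x)

      E′? : Decidable E′
      E′? x = E? x ×-dec Unit? (proj₁ x)

      ∣E∣≤∣E′∣+nr : ∣ E? ∣ ≤ ∣ E′? ∣ + n * r
      ∣E∣≤∣E′∣+nr = begin
        ∣ E? ∣                                                          ≡⟨ length-filter E? points ⟩
        ∑[ x ← points ] 𝟙 (E? x)                                        ≤⟨ ∑-mono points (λ x _ → split (E? x) (Unit? (proj₁ x))) ⟩
        ∑ points (λ x → 𝟙 (E′? x) + 𝟙 (¬? (Unit? (proj₁ x))))         ≡⟨ ∑-+ points _ _ ⟩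
        (∑[ x ← points ] 𝟙 (E′? x)) + (∑[ x ← points ] 𝟙 (¬? (Unit? (proj₁ x))))
          ≤⟨ +-mono-≤ (≤-reflexive (sym (length-filter E′? points))) nonunits≤nr ⟩
        ∣ E′? ∣ + n * r ∎
        where
        open ≤-Reasoning
        nonunits≤nr : ∑[ x ← points ] 𝟙 (¬? (Unit? (proj₁ x))) ≤ n * r
        nonunits≤nr = subst (λ k → ∑[ x ← points ] 𝟙 (¬? (Unit? (proj₁ x))) ≤ k * r) length≡n
          (Counting.nonunit-points Fin._≟_ Unit? (λ {x} {y} → local {x} {y}) (allFin n) (allFin⁺ n) ∈-allFin r nonunits≤r)
        split : {P Q : Set} (P? : Dec P) (Q? : Dec Q) → 𝟙 P? ≤ 𝟙 (P? ×-dec Q?) + 𝟙 (¬? Q?)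
        split (no _)  _       = z≤n
        split (yes _) (yes _) = s≤s z≤n
        split (yes _) (no _)  = s≤s z≤n

      -- `Counting` measures the ring by `length (allFin n)`, which equals `n` only propositionally;
      -- hence the substitutions. Tuples are taken from `E′`, representatives from all of `E`.
      many-classes : (n * n) ^ m ≤ 4 * ((2 ^ m + 12) * (n * n * n)) * length (𝒞 m E?)
      many-classes = subst
        (λ k → (k * k) ^ m ≤ 4 * ((2 ^ m + 12) * (k * k * k)) * length (𝒞 m E?)) length≡n
        (Counting.class-bound Fin._≟_ Unit? (λ {x} {y} → local {x} {y}) (allFin n) (allFin⁺ n) ∈-allFin r nonunits≤r
          E′? proj₂ p j length≡n
          (subst (λ k → (k * k) ^ m ≤ p * ∣ E′? ∣ ^ m) (sym length≡n)
            (dense-units p n r ∣ E′? ∣ ∣ E? ∣ j refl ∣E∣≤∣E′∣+nr dense))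
          (subst (λ k → 2 * (k * r) ≤ ∣ E′? ∣) (sym length≡n)
            (2qr≤a p n r ∣ E′? ∣ ∣ E? ∣ j refl ∣E∣≤∣E′∣+nr dense))
          _∼?_ (𝒞-inequivalent n m E?)
          (λ s h → 𝒞-covers n E? s λ i → restrict (h i)))
        where
        restrict : ∀ {x} → x ∈ elements E′? → x ∈ elements E?
        restrict x∈ with ∈-filter⁻ E′? {xs = points} x∈
        ... | x∈points , Ex , _ = ∈-filter⁺ E? x∈points Ex

      conclusion : length (𝒞 m U?) ≤ m * (suc j * (4 * (2 ^ m + 12))) * length (𝒞 m E?)
      conclusion = conclusion-arithmetic n j (2 ^ m + 12) _ _
        (ClassCount.classes-bound p p-prime e _∼?_ (𝒞-inequivalent n m U?)) many-classes

-- The theorem with explicit constants.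

open import Data.Integer.Base using (+_)
open import Data.Integer.Properties using (abs-*)
open import Data.List.Base using (length)
open import Data.Nat.Base using (ℕ; suc; _+_; _*_; _^_; _≤_; NonZero)
open import Data.Nat.Divisibility using (_∣_)
open import Data.Nat.Primality using (Prime)
open import Data.Nat.Properties using (m^n≢0; m*n≢0; *-identityˡ)
open import Data.Product.Base using (Σ-syntax; _,_)
open import Data.Rational.Unnormalised.Base as ℚᵘ using (ℚᵘ; _/_)
open import Level using (0ℓ)
open import Relation.Binary.PropositionalEquality using (_≡_; sym; trans; cong; subst)
open import Relation.Nullary.Negation using (¬_)
open import Relation.Unary using (Pred; Decidable; U)
open import Relation.Unary.Properties using (U?)
open Assembly using (module Density; density-arithmetic)

theorem2 : ∀ (k : ℕ) → 1 ≤ k →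
    Σ[ C ∈ ℕ ] Σ[ c ∈ ℕ ]
      (∀ (p ℓ : ℕ) .{{_ : NonZero p}} .{{_ : NonZero ℓ}} → Prime p → ¬ (2 ∣ p) →
       let instance _ = m^n≢0 p ℓ
                    _ = m*n≢0 ℓ (suc k)
           open Plane (p ^ ℓ)
           s : ℚᵘ
           s = (+ 2 / 1) ℚᵘ.- (+ 1 / (ℓ * suc k))
       in ∀ (E : Pred Point 0ℓ) (E? : Decidable E) →
          ∣ E? ∣ ≥ C · ℓ ^ (+ 2 / suc k) · p ^ ((+ ℓ / 1) ℚᵘ.* s) →
          length (𝒞 (suc k) U?) ≤ c * length (𝒞 (suc k) E?))
-- The 4 keeps the set dense after discarding nonunit first coordinates. In the second constant
-- (k+1) k counts the pairs (a , b), and 4 (2^(k+1) + 12) is the loss in the lower bound.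
theorem2 (suc j) _ = 4 , (2 + j) * (suc j * (4 * (2 ^ (2 + j) + 12))) , bound
  where
  bound : ∀ (p ℓ : ℕ) .{{_ : NonZero p}} .{{_ : NonZero ℓ}} → Prime p → ¬ (2 ∣ p) → _
  bound p (suc e) p-prime _ E E? h = Density.conclusion p p-prime e j E?
    -- The exponent of p contains the absolute value of the integer product of ℓ and the numerator y
    -- of s; `abs-*` turns it into a product in ℕ.
    (density-arithmetic p N (2 + j) D y (suc e) D≡ y≡ (subst
      (λ t → 4 ^ ((2 + j) * D) * suc e ^ (2 * D) * p ^ (t * (2 + j)) ≤ N ^ ((2 + j) * D)) (abs-* (+ suc e) (+ y)) h))
    where
    -- D and y are the forms to which the denominator ℓ (k + 1) of s and its numerator 2 ℓ (k + 1) − 1 compute.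
    N D y : ℕ
    N = Plane.∣_∣ (p ^ suc e) {{m^n≢0 p (suc e)}} E?
    D = 1 * (1 * (suc e * (2 + j)))
    y = suc j + e * (2 + j) + 1 * (suc e * (2 + j))
    D≡ : D ≡ suc e * (2 + j)
    D≡ = trans (*-identityˡ _) (*-identityˡ _)
    y≡ : suc y ≡ 2 * D
    y≡ = sym (cong (2 *_) D≡)
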